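{- Let $\Gamma$ be a Nest graph of girth $3$. Then $\Gamma$ is edge-transitive if and only if one of the following holds: (i) $\Gamma$ is isomorphic to one of the graphs $\mathcal{N}(4;1,2,3;1)$, $\mathcal{N}(5;1,2,3;2)$, $\mathcal{N}(8;1,2,5;3)$, $\mathcal{N}(8;1,3,4;3)$, $\mathcal{N}(10;1,3,4;3)$ or $\mathcal{N}(12;1,3,10;5)$; (ii) $\Gamma \cong \mathcal{N}(n;1,2m+1,2m+2;1)$, where $m\geq 1$ and $n$ is an even divisor of $2(m^2+m+1)$ with $n \geq 4m+2$; (iii) $\Gamma \cong \mathcal{N}(2m;1,b,b+m+1;m-1)$, where $b = 4b_0-1$ for some integer $b_0 > 1$ and $m$ is a divisor of $b^2+3$ with $m \equiv 2 \pmod{4}$ and $b < 2m$. Furthermore, $\Gamma$ is half-arc-transitive if (iii) holds and is arc-transitive otherwise.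
   Context: For integers $n \geq 4$ and $1 \leq a,b,c,k \leq n-1$ with $k \neq n/2$ and $a,b,c$ pairwise distinct, the Nest graph $\mathcal{N}(n;a,b,c;k)$ is the graph with vertex set $\{u_i : i \in \mathbb{Z}_n\} \cup \{v_i : i \in \mathbb{Z}_n\}$ and edge set consisting of all $u_iu_{i+1}$ (rim edges), $v_iv_{i+k}$ (hub edges), and the spokes $u_iv_i$, $u_iv_{i+a}$, $u_iv_{i+b}$, $u_iv_{i+c}$, for $i \in \mathbb{Z}_n$ (indices computed modulo $n$); it is $6$-valent. Parameters written as expressions (e.g. $b+m+1$) are taken modulo $n$ as residues in $\{1,\dots,n-1\}$. A graph is edge-transitive (arc-transitive) if its automorphism group acts transitively on its edges (arcs); it is half-arc-transitive if it is vertex- and edge-transitive but not arc-transitive. -}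

module Defs where

open import Level using (0ℓ)
open import Data.Nat using (ℕ; zero; suc; _+_; _*_; _∸_; _≤_; _<_; _%_)
open import Data.Fin using (Fin; toℕ)
open import Data.Sum using (_⊎_; inj₁; inj₂)
open import Data.Product using (Σ; _×_; _,_; ∃-syntax)
open import Relation.Binary.PropositionalEquality using (_≡_; _≢_)
open import Relation.Nullary using (¬_)
open import Function.Bundles using (_⤖_; _⇔_; Bijection)

record Graph : Set₁ where
  field
    V : Set
    E : V → V → Set
open Graph public

record _≅_ (G H : Graph) : Set where
  field
    bij      : V G ⤖ V H
    preserve : ∀ x y → E G x y ⇔ E H (Bijection.to bij x) (Bijection.to bij y)

Aut : Graph → Set
Aut G = G ≅ G

app : {G H : Graph} → G ≅ H → V G → V H
app σ = Bijection.to (_≅_.bij σ)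

VertexTransitive : Graph → Set
VertexTransitive G = ∀ x y → ∃[ σ ] (app {G} {G} σ x ≡ y)

EdgeTransitive : Graph → Set
EdgeTransitive G = ∀ x y x' y' → E G x y → E G x' y' →
  ∃[ σ ] (((app {G} {G} σ x ≡ x') × (app {G} {G} σ y ≡ y'))
          ⊎ ((app {G} {G} σ x ≡ y') × (app {G} {G} σ y ≡ x')))

ArcTransitive : Graph → Set
ArcTransitive G = ∀ x y x' y' → E G x y → E G x' y' →
  ∃[ σ ] ((app {G} {G} σ x ≡ x') × (app {G} {G} σ y ≡ y'))

HalfArcTransitive : Graph → Set
HalfArcTransitive G = VertexTransitive G × EdgeTransitive G × ¬ ArcTransitive G

-- girth 3: the graph contains a 3-cycle (three distinct pairwise adjacent vertices);
-- since every graph has girth ≥ 3, this is exactly "girth = 3"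
HasGirth3 : Graph → Set
HasGirth3 G = ∃[ x ] ∃[ y ] ∃[ z ]
  ((x ≢ y) × (y ≢ z) × (x ≢ z) × E G x y × E G y z × E G z x)

-- residue of x modulo n (n = 0 never occurs for Nest graphs)
modN : ℕ → ℕ → ℕ
modN x zero    = x
modN x (suc n) = x % suc n

-- vertices: inj₁ i = u_i, inj₂ i = v_i
NestV : ℕ → Set
NestV n = Fin n ⊎ Fin n

data NestArc (n a b c k : ℕ) : NestV n → NestV n → Set where
  rim    : ∀ i j → toℕ j ≡ modN (toℕ i + 1) n → NestArc n a b c k (inj₁ i) (inj₁ j)
  hub    : ∀ i j → toℕ j ≡ modN (toℕ i + k) n → NestArc n a b c k (inj₂ i) (inj₂ j)
  spoke0 : ∀ i j → toℕ j ≡ toℕ i              → NestArc n a b c k (inj₁ i) (inj₂ j)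
  spokeA : ∀ i j → toℕ j ≡ modN (toℕ i + a) n → NestArc n a b c k (inj₁ i) (inj₂ j)
  spokeB : ∀ i j → toℕ j ≡ modN (toℕ i + b) n → NestArc n a b c k (inj₁ i) (inj₂ j)
  spokeC : ∀ i j → toℕ j ≡ modN (toℕ i + c) n → NestArc n a b c k (inj₁ i) (inj₂ j)

Nest : ℕ → ℕ → ℕ → ℕ → ℕ → Graph
Nest n a b c k = record
  { V = NestV n
  ; E = λ x y → NestArc n a b c k x y ⊎ NestArc n a b c k y x
  }

ValidNest : ℕ → ℕ → ℕ → ℕ → ℕ → Set
ValidNest n a b c k =
  (4 ≤ n) × (1 ≤ a) × (a < n) × (1 ≤ b) × (b < n) × (1 ≤ c) × (c < n)
  × (1 ≤ k) × (k < n) × (2 * k ≢ n) × (a ≢ b) × (a ≢ c) × (b ≢ c)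

Case1 : Graph → Set
Case1 Γ = (Γ ≅ Nest 4 1 2 3 1) ⊎ (Γ ≅ Nest 5 1 2 3 2) ⊎ (Γ ≅ Nest 8 1 2 5 3)
        ⊎ (Γ ≅ Nest 8 1 3 4 3) ⊎ (Γ ≅ Nest 10 1 3 4 3) ⊎ (Γ ≅ Nest 12 1 3 10 5)

Even : ℕ → Set
Even n = ∃[ t ] (n ≡ 2 * t)

Divides : ℕ → ℕ → Set
Divides d x = ∃[ q ] (x ≡ q * d)

Case2 : Graph → Set
Case2 Γ = ∃[ m ] ∃[ n ]
  ((1 ≤ m) × Even n × Divides n (2 * (m * m + m + 1)) × (4 * m + 2 ≤ n)
   × (Γ ≅ Nest n 1 (2 * m + 1) (2 * m + 2) 1))

Case3 : Graph → Set
Case3 Γ = ∃[ m ] ∃[ b₀ ]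
  (let b = 4 * b₀ ∸ 1 in
   (1 < b₀) × Divides m (b * b + 3) × (m % 4 ≡ 2) × (b < 2 * m)
   × (Γ ≅ Nest (2 * m) 1 b (modN (b + m + 1) (2 * m)) (m ∸ 1)))

{-# OPTIONS --safe #-}
module Submission where

-- Count, for every edge, the closed walks of each small length through it; in an edge-transitive graph
-- these numbers agree for rim, hub and spoke edges. A triangle lets us move the spokes to 0, 1, a, b. Two
-- walks end at the same vertex exactly when an integral combination of 1, k, a, b vanishes modulo n, so
-- comparing the counts splits into finitely many lattices of relations: apart from small n, which are
-- inspected directly, only 2k = ±2 together with b = a ± k survives. Up to isomorphism k = 1 or
-- k = n/2 + 1, and b = a + k. In both cases counting walks of length 3 between neighbours
-- shows that an automorphism permutes the six directions r, r + g, g, -r, -r - g, -g at all vertices by one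
-- and the same dihedral map, so that Γ behaves like a quotient of the triangular lattice. If edges can be moved
-- to other classes, a rotation by an odd multiple of 60° or its reflection occurs; applying it to the relations r^n = 1,
-- g^2 = r^b, r^m g r = r g gives the divisibility conditions of (ii) and (iii). Conversely these conditions
-- make the rotation well defined, and in case (ii) also a reflection. In case (iii) the reflection that
-- reverses an edge would force m / 2 to divide 3.

open import Defs
open import Data.Bool using (Bool; true; false; if_then_else_; _∧_; _∨_; not; T)
open import Data.Bool.ListAction using (any; all)
open import Data.Empty using (⊥; ⊥-elim)
open import Data.Fin as Fin using (Fin; toℕ; fromℕ<; zero; suc)
import Data.Fin.Properties as Fin
open import Data.Integer as ℤ using (ℤ; +_; -[1+_]; _+_; _*_; _-_; -_; ∣_∣)
open import Data.Integer.DivMod using (n%ℕd<d; a≡a%ℕn+[a/ℕn]*n)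
open import Data.Integer.Divisibility.Signed
import Data.Integer.Properties as ℤ
open import Data.Integer.Tactic.RingSolver using (solve-∀)
open import Data.List as List using (List; []; _∷_; map; _++_; foldr; upTo)
open import Data.List.Membership.Propositional using (_∈_; find)
open import Data.List.Membership.Propositional.Properties using (∈-map⁺; ∈-map⁻; ∈-upTo⁺)
open import Data.List.Membership.Propositional.Properties.WithK using (unique∧set⇒bag)
open import Data.List.Properties using (map-cong)
open import Data.List.Relation.Binary.BagAndSetEquality using (∼bag⇒↭)
open import Data.List.Relation.Binary.Permutation.Propositional as ↭ using (_↭_)
open import Data.List.Relation.Unary.All as All using (All; []; _∷_)
open import Data.List.Relation.Unary.AllPairs using ([]; _∷_)
open import Data.List.Relation.Unary.Any using (here; there; Any; satisfied)
open import Data.List.Relation.Unary.Any.Properties using (++⁺ˡ; ++⁺ʳ)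
open import Data.List.Relation.Unary.Unique.Propositional using (Unique)
open import Data.List.Relation.Unary.Unique.Propositional.Properties using (map⁺)
open import Data.Maybe as Maybe using (Maybe; just; nothing)
open import Data.Nat as ℕ using (ℕ; zero; suc; NonZero)
open import Data.Nat.DivMod as ℕ using (_mod_)
import Data.Nat.Divisibility as ℕ∣
import Data.Nat.Properties as ℕ
import Data.Nat.Tactic.RingSolver as ℕR
open import Data.Product using (_×_; _,_; proj₁; proj₂; ∃-syntax)
open import Data.Sum as Sum using (_⊎_; inj₁; inj₂; [_,_]′)
import Data.Sum.Properties as Sum
open import Function.Base using (_∘_; id; case_of_)
open import Function.Bundles using (_⇔_; _⤖_; mk⤖; mk⇔; Bijection; Equivalence)
open import Relation.Binary.Definitions using (tri<; tri≈; tri>)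
open import Relation.Binary.PropositionalEquality
open import Relation.Nullary using (¬_; Dec; yes; no; does; contradiction)
open import Relation.Nullary.Decidable using (dec-true; dec-false; map′; True; toWitness; _×-dec_; _→-dec_; ¬?; toWitnessFalse)

-- The order n is unbounded, so no count can simply be evaluated. A walk count is kept as a formal
-- sum of vectors, each worth 1 or 0 according to whether its value vanishes modulo n, and
-- edge-transitivity becomes a system of linear equations in these unknowns. The case distinction is
-- a computed tree: an undecided vector is either added to the lattice of known relations or
-- recorded as nonzero, and a branch dies when the bounds 0 and 1 on the remaining unknowns
-- contradict an equation. Vanishing is decidable, so the true parameters follow one path, and the
-- choice of the splits needs no justification. Walks of length 2 to 6 between the ends of an edge
-- suffice. The case k = n/2 + 1 differs from k = 1 in that r and g do not commute: r followed by g
-- is one step in direction r + g, but g followed by r is not. Half of the triangles of the lattice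
-- are missing, and only dihedral maps preserving the remaining half occur. This asymmetry leaves
-- room for half-arc-transitivity.

-- Divisibility certificates.

module _ {n x : ℤ} where

  -- Divisibility claims are proved by certificates throughout: the multipliers are given
  -- explicitly, and what remains is a polynomial identity for the ring solver.
  lin₁ : ∀ {z} a → n ∣ x → z ≡ a * x → n ∣ z
  lin₁ a p refl = ∣n⇒∣m*n a p

  lin₂ : ∀ {y z} a b → n ∣ x → n ∣ y → z ≡ a * x + b * y → n ∣ z
  lin₂ a b p q refl = ∣m∣n⇒∣m+n (∣n⇒∣m*n a p) (∣n⇒∣m*n b q)

  lin₃ : ∀ {y w z} a b c → n ∣ x → n ∣ y → n ∣ w → z ≡ a * x + b * y + c * w → n ∣ z
  lin₃ a b c p q r refl = ∣m∣n⇒∣m+n (lin₂ a b p q refl) (∣n⇒∣m*n c r)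

0<∣<⇒⊥ : ∀ {n m} → 0 ℕ.< m → m ℕ.< n → ¬ (+ n ∣ + m)
0<∣<⇒⊥ {n} {m@(suc _)} _ m<n d = ℕ.<⇒≱ m<n (ℕ∣.∣⇒≤ (∣⇒∣ᵤ d))

cong<⇒≡ : ∀ {n i j} → i ℕ.< n → j ℕ.< n → + n ∣ + i - + j → i ≡ j
cong<⇒≡ {n} {i} {j} i<n j<n d with ℕ.<-cmp i j
... | tri≈ _ eq _ = eq
... | tri< i<j _ _ = ⊥-elim (0<∣<⇒⊥ (ℕ.m<n⇒0<n∸m i<j) (ℕ.≤-<-trans (ℕ.m∸n≤m j i) j<n)
        (lin₁ (- + 1) d (trans (sym (trans (ℤ.m-n≡m⊖n j i) (ℤ.⊖-≥ (ℕ.<⇒≤ i<j)))) (flip (+ i) (+ j)))))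
  where
  flip : ∀ x y → y - x ≡ - + 1 * (x - y)
  flip = solve-∀
... | tri> _ _ j<i = ⊥-elim (0<∣<⇒⊥ (ℕ.m<n⇒0<n∸m j<i) (ℕ.≤-<-trans (ℕ.m∸n≤m i j) i<n)
        (subst (+ n ∣_) (trans (ℤ.m-n≡m⊖n i j) (ℤ.⊖-≥ (ℕ.<⇒≤ j<i))) d))

-- Vertices as integer indices modulo n, and bicirculant graphs.

data Side : Set where
  U W : Side

_≟ˢ_ : (s t : Side) → Dec (s ≡ t)
U ≟ˢ U = yes refl
U ≟ˢ W = no λ ()
W ≟ˢ U = no λ ()
W ≟ˢ W = yes refl

-- (U , i) and (W , i) stand for u_i and v_i; the index is only taken modulo n through _≋_.
Pt : Set
Pt = Side × ℤ

side : Pt → Side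
side = proj₁

data Dir : Set where
  fwd bwd : Dir
  spk     : Fin 4 → Dir

shift : ℤ → (Fin 4 → ℤ) → Side → Dir → ℤ
shift k s U fwd     = + 1
shift k s U bwd     = - + 1
shift k s U (spk j) = s j
shift k s W fwd     = k
shift k s W bwd     = - k
shift k s W (spk j) = - s j

turn : Side → Dir → Side
turn U (spk _) = W
turn W (spk _) = U
turn x _       = x

-- A spoke keeps its number when traversed from its other end, so only rim and hub steps change.
back : Dir → Dir
back fwd     = bwd
back bwd     = fwd
back (spk j) = spk j

move : ℤ → (Fin 4 → ℤ) → Pt → Dir → Pt
move k s (x , i) d = turn x d , i + shift k s x d

module Residue (n : ℕ) .{{_ : NonZero n}} where

  infix 4 _≋_
  infix 3 _⨾_
  -- Congruence of integer indices takes the place of equality in `Fin n`, so that all index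
  -- arithmetic is polynomial over ℤ.
  record _≋_ (p q : Pt) : Set where
    constructor _⨾_
    field
      side-≡  : proj₁ p ≡ proj₁ q
      index-∣ : + n ∣ proj₂ p - proj₂ q
  open _≋_ public

  ≡⇒∣ : ∀ {i j} → i ≡ j → + n ∣ i - j
  ≡⇒∣ {i} refl = divides (+ 0) (ℤ.+-inverseʳ i)

  ≋-refl : ∀ {p} → p ≋ p
  ≋-refl {_ , i} = refl ⨾ ≡⇒∣ {i} refl

  ≋-sym : ∀ {p q} → p ≋ q → q ≋ p
  ≋-sym {_ , i} {_ , j} (e ⨾ d) = sym e ⨾ lin₁ (- + 1) d (lem i j)
    where
    lem : ∀ i j → j - i ≡ - + 1 * (i - j)
    lem = solve-∀

  ≋-trans : ∀ {p q r} → p ≋ q → q ≋ r → p ≋ r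
  ≋-trans {_ , i} {_ , j} {_ , l} (refl ⨾ d) (e ⨾ d′) =
    e ⨾ lin₂ (+ 1) (+ 1) d d′ (lem i j l)
    where
    lem : ∀ i j l → i - l ≡ + 1 * (i - j) + + 1 * (j - l)
    lem = solve-∀

  lift : NestV n → Pt
  lift (inj₁ i) = U , + toℕ i
  lift (inj₂ i) = W , + toℕ i

  residue : ℤ → Fin n
  residue i = fromℕ< (n%ℕd<d i n)

  ⟦_⟧ : Pt → NestV n
  ⟦ U , i ⟧ = inj₁ (residue i)
  ⟦ W , i ⟧ = inj₂ (residue i)

  residue-≡ : ∀ i → + n ∣ + toℕ (residue i) - i
  residue-≡ i rewrite Fin.toℕ-fromℕ< (n%ℕd<d i n) =
    divides (- (i ℤ./ℕ n)) (trans (cong (λ z → + (i ℤ.%ℕ n) - z) (a≡a%ℕn+[a/ℕn]*n i n)) (lem (+ (i ℤ.%ℕ n)) (i ℤ./ℕ n) (+ n)))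
    where
    lem : ∀ r q m → r - (r + q * m) ≡ - q * m
    lem = solve-∀

  lift-⟦⟧ : ∀ p → lift ⟦ p ⟧ ≋ p
  lift-⟦⟧ (U , i) = refl ⨾ residue-≡ i
  lift-⟦⟧ (W , i) = refl ⨾ residue-≡ i

  lift-inj : ∀ {x y} → lift x ≋ lift y → x ≡ y
  lift-inj {inj₁ i} {inj₁ j} (_ ⨾ d) = cong inj₁ (Fin.toℕ-injective (cong<⇒≡ (Fin.toℕ<n i) (Fin.toℕ<n j) d))
  lift-inj {inj₂ i} {inj₂ j} (_ ⨾ d) = cong inj₂ (Fin.toℕ-injective (cong<⇒≡ (Fin.toℕ<n i) (Fin.toℕ<n j) d))

  ≋⇒≡ : ∀ {p q} → p ≋ q → ⟦ p ⟧ ≡ ⟦ q ⟧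
  ≋⇒≡ {p} {q} e = lift-inj (≋-trans (lift-⟦⟧ p) (≋-trans e (≋-sym (lift-⟦⟧ q))))

  ≡⇒≋ : ∀ {p q} → ⟦ p ⟧ ≡ ⟦ q ⟧ → p ≋ q
  ≡⇒≋ {p} {q} e = ≋-trans (≋-sym (lift-⟦⟧ p)) (subst (λ x → lift x ≋ q) (sym e) (lift-⟦⟧ q))

  ⟦lift⟧ : ∀ x → ⟦ lift x ⟧ ≡ x
  ⟦lift⟧ x = lift-inj (lift-⟦⟧ (lift x))

  module _ (k : ℤ) (s : Fin 4 → ℤ) where

    move-≋ : ∀ {p q} d → p ≋ q → move k s p d ≋ move k s q d
    move-≋ {x , i} {_ , j} d (refl ⨾ e) = refl ⨾ lin₁ (+ 1) e (lem i j (shift k s x d))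
      where
      lem : ∀ i j t → (i + t) - (j + t) ≡ + 1 * (i - j)
      lem = solve-∀

    turn-back : ∀ x d → turn (turn x d) (back d) ≡ x
    turn-back U fwd     = refl
    turn-back U bwd     = refl
    turn-back U (spk _) = refl
    turn-back W fwd     = refl
    turn-back W bwd     = refl
    turn-back W (spk _) = refl

    move-back : ∀ p d → move k s (move k s p d) (back d) ≋ p
    move-back (x , i) d = turn-back x d ⨾ ≡⇒∣ (trans (ℤ.+-assoc i _ _) (trans (cong (λ z → i + z) (canc x d)) (ℤ.+-identityʳ i)))
      where
      canc : ∀ x d → shift k s x d + shift k s (turn x d) (back d) ≡ + 0
      canc U fwd     = refl
      canc U bwd     = refl
      canc U (spk j) = ℤ.+-inverseʳ (s j)
      canc W fwd     = ℤ.+-inverseʳ k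
      canc W bwd     = ℤ.+-inverseˡ k
      canc W (spk j) = ℤ.+-inverseˡ (s j)

    record Adj (p q : Pt) : Set where
      constructor via
      field
        dir   : Dir
        moved : q ≋ move k s p dir

    Adj-sym : ∀ {p q} → Adj p q → Adj q p
    Adj-sym {p} (via d e) = via (back d) (≋-sym (≋-trans (move-≋ (back d) e) (move-back p d)))

    Adj-≋ : ∀ {p p′ q q′} → p ≋ p′ → q ≋ q′ → Adj p q → Adj p′ q′
    Adj-≋ e f (via d g) = via d (≋-trans (≋-sym f) (≋-trans g (move-≋ d e)))

  -- Hub step and spoke offsets are arbitrary integers, because changes of coordinates lead out of
  -- the range allowed for Nest parameters.
  Bicirc : ℤ → (Fin 4 → ℤ) → Graph
  Bicirc k s = record { V = NestV n ; E = λ x y → Adj k s (lift x) (lift y) }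

  module _ (k : ℤ) (s : Fin 4 → ℤ) where

    Adj⇒E : ∀ {p q} → Adj k s p q → E (Bicirc k s) ⟦ p ⟧ ⟦ q ⟧
    Adj⇒E = Adj-≋ k s (≋-sym (lift-⟦⟧ _)) (≋-sym (lift-⟦⟧ _))

    edge : ∀ p d → E (Bicirc k s) ⟦ p ⟧ ⟦ move k s p d ⟧
    edge p d = Adj⇒E (via d ≋-refl)

  module _ {k k′ : ℤ} {s s′ : Fin 4 → ℤ} (f g : Pt → Pt)
    (f-≋ : ∀ {p q} → p ≋ q → f p ≋ f q) (g-≋ : ∀ {p q} → p ≋ q → g p ≋ g q)
    (fg : ∀ p → f (g p) ≋ p) (gf : ∀ p → g (f p) ≋ p)
    (f-adj : ∀ p d → Adj k′ s′ (f p) (f (move k s p d)))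
    (g-adj : ∀ p d → Adj k s (g p) (g (move k′ s′ p d))) where

    private
      F G : NestV n → NestV n
      F x = ⟦ f (lift x) ⟧
      G x = ⟦ g (lift x) ⟧
      FG : ∀ x → F (G x) ≡ x
      FG x = trans (≋⇒≡ (≋-trans (f-≋ (lift-⟦⟧ _)) (fg (lift x)))) (⟦lift⟧ x)
      GF : ∀ x → G (F x) ≡ x
      GF x = trans (≋⇒≡ (≋-trans (g-≋ (lift-⟦⟧ _)) (gf (lift x)))) (⟦lift⟧ x)
      FE : ∀ {p q} → Adj k s p q → Adj k′ s′ (f p) (f q)
      FE {p} (via d e) = Adj-≋ k′ s′ ≋-refl (≋-sym (f-≋ e)) (f-adj p d)
      GE : ∀ {p q} → Adj k′ s′ p q → Adj k s (g p) (g q)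
      GE {p} (via d e) = Adj-≋ k s ≋-refl (≋-sym (g-≋ e)) (g-adj p d)

    -- Edges are reflected by applying `g`: it is enough that two mutually inverse maps both
    -- preserve adjacency.
    mkIso : Bicirc k s ≅ Bicirc k′ s′
    mkIso = record
      { bij = mk⤖ ((λ {x} {y} e → trans (sym (GF x)) (trans (cong G e) (GF y)))
                  , λ y → G y , λ { refl → FG y })
      ; preserve = λ x y → mk⇔
          (λ e → Adj-≋ k′ s′ (≋-sym (lift-⟦⟧ _)) (≋-sym (lift-⟦⟧ _)) (FE e))
          (λ e → Adj-≋ k s (lem x) (lem y) (GE e)) }
      where
      lem : ∀ x → g (lift (F x)) ≋ lift x
      lem x = ≋-trans (g-≋ (lift-⟦⟧ _)) (gf (lift x))

    mkIso-app : ∀ p → app {Bicirc k s} {Bicirc k′ s′} mkIso ⟦ p ⟧ ≡ ⟦ f p ⟧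
    mkIso-app p = ≋⇒≡ (f-≋ (lift-⟦⟧ p))

-- Isomorphisms and the transport of symmetry.

module _ {G H : Graph} (φ : G ≅ H) where

  from : V H → V G
  from y = proj₁ (Bijection.surjective (_≅_.bij φ) y)

  app-from : ∀ y → app {G} {H} φ (from y) ≡ y
  app-from y = proj₂ (Bijection.surjective (_≅_.bij φ) y) refl

  app-inj : ∀ {x y} → app {G} {H} φ x ≡ app {G} {H} φ y → x ≡ y
  app-inj = Bijection.injective (_≅_.bij φ)

  from-app : ∀ x → from (app {G} {H} φ x) ≡ x
  from-app x = app-inj (app-from _)

  app-E : ∀ {x y} → E G x y → E H (app {G} {H} φ x) (app {G} {H} φ y)
  app-E {x} {y} = Equivalence.to (_≅_.preserve φ x y)

  E-app : ∀ {x y} → E H (app {G} {H} φ x) (app {G} {H} φ y) → E G x y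
  E-app {x} {y} = Equivalence.from (_≅_.preserve φ x y)

  ≅-sym : H ≅ G
  ≅-sym = record
    { bij = mk⤖ ((λ {x} {y} e → trans (sym (app-from x)) (trans (cong (app {G} {H} φ) e) (app-from y)))
                , λ x → app {G} {H} φ x , λ { refl → from-app x })
    ; preserve = λ x y → mk⇔
        (λ e → E-app (subst₂ (E H) (sym (app-from x)) (sym (app-from y)) e))
        (λ e → subst₂ (E H) (app-from x) (app-from y) (app-E e)) }

≅-trans : ∀ {G H K} → G ≅ H → H ≅ K → G ≅ K
≅-trans {G} {H} {K} φ ψ = record
  { bij = mk⤖ ((λ e → app-inj φ (app-inj ψ e))
              , λ z → from φ (from ψ z) , λ { refl → trans (cong (app {H} {K} ψ) (app-from φ _)) (app-from ψ z) })
  ; preserve = λ x y → mk⇔ (λ e → app-E ψ (app-E φ e)) (λ e → E-app φ (E-app ψ e)) }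

module _ {G H : Graph} (φ : G ≅ H) where

  conj : Aut G → Aut H
  conj σ = ≅-trans (≅-sym φ) (≅-trans σ φ)

  private
    f = app {G} {H} φ
    f⁻¹ = from φ

    conj-app : ∀ σ {x y} → app {G} {G} σ (f⁻¹ x) ≡ f⁻¹ y → app {H} {H} (conj σ) x ≡ y
    conj-app σ e = trans (cong f e) (app-from φ _)

    pull : ∀ {x y} → E H x y → E G (f⁻¹ x) (f⁻¹ y)
    pull = app-E (≅-sym φ)

  transport-VT : VertexTransitive G → VertexTransitive H
  transport-VT vt x y with vt (f⁻¹ x) (f⁻¹ y)
  ... | σ , e = conj σ , conj-app σ e

  transport-AT : ArcTransitive G → ArcTransitive H
  transport-AT at x y x′ y′ e e′ with at _ _ _ _ (pull e) (pull e′)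
  ... | σ , a , b = conj σ , conj-app σ a , conj-app σ b

  transport-ET : EdgeTransitive G → EdgeTransitive H
  transport-ET et x y x′ y′ e e′ with et _ _ _ _ (pull e) (pull e′)
  ... | σ , inj₁ (a , b) = conj σ , inj₁ (conj-app σ a , conj-app σ b)
  ... | σ , inj₂ (a , b) = conj σ , inj₂ (conj-app σ a , conj-app σ b)

AT⇒ET : ∀ {G} → ArcTransitive G → EdgeTransitive G
AT⇒ET at x y x′ y′ e e′ with at x y x′ y′ e e′
... | σ , a , b = σ , inj₁ (a , b)

-- Nest graphs as bicirculants.

spokes : ℤ → ℤ → ℤ → ℤ → Fin 4 → ℤ
spokes a b c d zero                   = a
spokes a b c d (suc zero)             = b
spokes a b c d (suc (suc zero))       = c
spokes a b c d (suc (suc (suc zero))) = d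

module _ (n′ : ℕ) where
  private
    n = suc n′
  open Residue n

  private
    mod-to : ∀ {i j t} → j ≡ (i ℕ.+ t) ℕ.% n → + n ∣ + j - (+ i + + t)
    mod-to {i} {t = t} refl = divides (- + ((i ℕ.+ t) ℕ./ n)) (trans (cong (λ z → + ((i ℕ.+ t) ℕ.% n) - z)
      (trans (cong +_ (ℕ.m≡m%n+[m/n]*n (i ℕ.+ t) n)) (trans (ℤ.pos-+ ((i ℕ.+ t) ℕ.% n) _) (cong (λ z → + ((i ℕ.+ t) ℕ.% n) + z) (ℤ.pos-* ((i ℕ.+ t) ℕ./ n) n)))))
      (lem (+ ((i ℕ.+ t) ℕ.% n)) (+ ((i ℕ.+ t) ℕ./ n)) (+ n)))
      where
      lem : ∀ r q m → r - (r + q * m) ≡ - q * m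
      lem = solve-∀

    mod-from : ∀ {i j t} → j ℕ.< n → + n ∣ + j - (+ i + + t) → j ≡ (i ℕ.+ t) ℕ.% n
    mod-from {i} {j} {t} j<n d = cong<⇒≡ j<n (ℕ.m%n<n (i ℕ.+ t) n)
      (lin₂ (+ 1) (- + 1) d (mod-to {i} {t = t} refl) (lem (+ j) (+ i + + t) (+ ((i ℕ.+ t) ℕ.% n))))
      where
      lem : ∀ x y z → x - z ≡ + 1 * (x - y) + - + 1 * (z - y)
      lem = solve-∀

  module _ (a b c k : ℕ) where
    private
      s = spokes (+ 0) (+ a) (+ b) (+ c)

      arc⇒ : ∀ {x y} → NestArc n a b c k x y → Adj (+ k) s (lift x) (lift y)
      arc⇒ (rim i j e)    = via fwd (refl ⨾ mod-to {toℕ i} {t = 1} e)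
      arc⇒ (hub i j e)    = via fwd (refl ⨾ mod-to {toℕ i} {t = k} e)
      arc⇒ (spoke0 i j e) = via (spk zero) (refl ⨾ ≡⇒∣ (trans (cong +_ e) (sym (ℤ.+-identityʳ _))))
      arc⇒ (spokeA i j e) = via (spk (suc zero)) (refl ⨾ mod-to {toℕ i} {t = a} e)
      arc⇒ (spokeB i j e) = via (spk (suc (suc zero))) (refl ⨾ mod-to {toℕ i} {t = b} e)
      arc⇒ (spokeC i j e) = via (spk (suc (suc (suc zero)))) (refl ⨾ mod-to {toℕ i} {t = c} e)

      uv⇐ : ∀ i j d → lift (inj₂ j) ≋ move (+ k) s (lift (inj₁ i)) d → NestArc n a b c k (inj₁ i) (inj₂ j)
      uv⇐ i j (spk zero) (_ ⨾ e) = spoke0 i j (cong<⇒≡ (Fin.toℕ<n j) (Fin.toℕ<n i)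
        (subst (λ z → + n ∣ + toℕ j - z) (ℤ.+-identityʳ (+ toℕ i)) e))
      uv⇐ i j (spk (suc zero)) (_ ⨾ e) = spokeA i j (mod-from {toℕ i} {t = a} (Fin.toℕ<n j) e)
      uv⇐ i j (spk (suc (suc zero))) (_ ⨾ e) = spokeB i j (mod-from {toℕ i} {t = b} (Fin.toℕ<n j) e)
      uv⇐ i j (spk (suc (suc (suc zero)))) (_ ⨾ e) = spokeC i j (mod-from {toℕ i} {t = c} (Fin.toℕ<n j) e)
      uv⇐ i j fwd (() ⨾ _)
      uv⇐ i j bwd (() ⨾ _)

      arc⇐ : ∀ x y → Adj (+ k) s (lift x) (lift y) → NestArc n a b c k x y ⊎ NestArc n a b c k y x
      arc⇐ (inj₁ i) (inj₁ j) (via fwd (_ ⨾ e)) = inj₁ (rim i j (mod-from {toℕ i} {t = 1} (Fin.toℕ<n j) e))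
      arc⇐ (inj₁ i) (inj₁ j) (via bwd (_ ⨾ e)) = inj₂ (rim j i (mod-from {toℕ j} {t = 1} (Fin.toℕ<n i)
        (lin₁ (- + 1) e (lem (+ toℕ i) (+ toℕ j) (+ 1)))))
        where
        lem : ∀ x y z → x - (y + z) ≡ - + 1 * (y - (x + - z))
        lem = solve-∀
      arc⇐ (inj₂ i) (inj₂ j) (via fwd (_ ⨾ e)) = inj₁ (hub i j (mod-from {toℕ i} {t = k} (Fin.toℕ<n j) e))
      arc⇐ (inj₂ i) (inj₂ j) (via bwd (_ ⨾ e)) = inj₂ (hub j i (mod-from {toℕ j} {t = k} (Fin.toℕ<n i)
        (lin₁ (- + 1) e (lem (+ toℕ i) (+ toℕ j) (+ k)))))
        where
        lem : ∀ x y z → x - (y + z) ≡ - + 1 * (y - (x + - z))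
        lem = solve-∀
      arc⇐ (inj₁ i) (inj₂ j) (via d e) = inj₁ (uv⇐ i j d e)
      arc⇐ (inj₂ i) (inj₁ j) e with Adj-sym (+ k) s e
      ... | via d e′ = inj₂ (uv⇐ j i d e′)

    nest≅bicirc : Nest n a b c k ≅ Bicirc (+ k) s
    nest≅bicirc = record
      { bij = mk⤖ ((λ e → e) , λ y → y , λ e → e)
      ; preserve = λ x y → mk⇔ [ arc⇒ , (λ e → Adj-sym (+ k) s (arc⇒ e)) ]′ (arc⇐ x y) }

-- Counting walks, and invariance of the counts under automorphisms.

pattern i₀ = zero
pattern i₁ = suc zero
pattern i₂ = suc (suc zero)
pattern i₃ = suc (suc (suc zero))

dirs : List Dir
dirs = fwd ∷ bwd ∷ spk i₀ ∷ spk i₁ ∷ spk i₂ ∷ spk i₃ ∷ []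

dirs-! : Unique dirs
dirs-! = ((λ ()) ∷ (λ ()) ∷ (λ ()) ∷ (λ ()) ∷ (λ ()) ∷ [])
       ∷ ((λ ()) ∷ (λ ()) ∷ (λ ()) ∷ (λ ()) ∷ [])
       ∷ ((λ ()) ∷ (λ ()) ∷ (λ ()) ∷ [])
       ∷ ((λ ()) ∷ (λ ()) ∷ [])
       ∷ ((λ ()) ∷ [])
       ∷ [] ∷ []

dir∈ : ∀ d → d ∈ dirs
dir∈ fwd      = here refl
dir∈ bwd      = there (here refl)
dir∈ (spk i₀) = there (there (here refl))
dir∈ (spk i₁) = there (there (there (here refl)))
dir∈ (spk i₂) = there (there (there (there (here refl))))
dir∈ (spk i₃) = there (there (there (there (there (here refl)))))

∑ : {A : Set} → List A → (A → ℤ) → ℤ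
∑ []       f = + 0
∑ (x ∷ xs) f = f x + ∑ xs f

module _ {A : Set} where

  ∑-cong : ∀ (xs : List A) {f g} → (∀ x → f x ≡ g x) → ∑ xs f ≡ ∑ xs g
  ∑-cong []       e = refl
  ∑-cong (x ∷ xs) e = cong₂ _+_ (e x) (∑-cong xs e)

  ∑-map : ∀ {B : Set} (g : B → A) xs f → ∑ (map g xs) f ≡ ∑ xs (f ∘ g)
  ∑-map g []       f = refl
  ∑-map g (x ∷ xs) f = cong (λ z → f (g x) + z) (∑-map g xs f)

  ∑-↭ : ∀ {xs ys : List A} f → xs ↭ ys → ∑ xs f ≡ ∑ ys f
  ∑-↭ f ↭.refl          = refl
  ∑-↭ f (↭.prep x p)    = cong (λ z → f x + z) (∑-↭ f p)
  ∑-↭ f (↭.swap {xs} {ys} x y p) =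
    trans (cong (λ z → f x + (f y + z)) (∑-↭ f p)) (lem (f x) (f y) (∑ ys f))
    where
    lem : ∀ a b c → a + (b + c) ≡ b + (a + c)
    lem = solve-∀
  ∑-↭ f (↭.trans p q)   = trans (∑-↭ f p) (∑-↭ f q)

module Walks (n : ℕ) .{{nz : NonZero n}} (k : ℤ) (s : Fin 4 → ℤ) where
  open Residue n public

  Γ : Graph
  Γ = Bicirc k s

  _≟ᵛ_ : (x y : NestV n) → Dec (x ≡ y)
  _≟ᵛ_ = Sum.≡-dec Fin._≟_ Fin._≟_

  infixl 6 _▹_
  _▹_ : Pt → Dir → Pt
  _▹_ = move k s

  nb : NestV n → List (NestV n)
  nb x = map (λ d → ⟦ lift x ▹ d ⟧) dirs

  cnt : ℕ → NestV n → NestV n → ℤ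
  cnt zero    x y = if does (x ≟ᵛ y) then + 1 else + 0
  cnt (suc L) x y = ∑ (nb x) (λ z → cnt L z y)

  E⇒∈ : ∀ {x y} → E Γ x y → y ∈ nb x
  E⇒∈ {x} {y} (via d e) = subst (_∈ nb x) (trans (≋⇒≡ (≋-sym e)) (⟦lift⟧ y)) (∈-map⁺ (λ d → ⟦ lift x ▹ d ⟧) (dir∈ d))

  ∈⇒E : ∀ {x y} → y ∈ nb x → E Γ x y
  ∈⇒E {x} m with ∈-map⁻ (λ d → ⟦ lift x ▹ d ⟧) m
  ... | d , _ , refl = via d (lift-⟦⟧ _)

  -- Γ is 6-valent.
  Simple : Set
  Simple = ∀ x {d d′} → (x , + 0) ▹ d ≋ (x , + 0) ▹ d′ → d ≡ d′

  module _ (simple : Simple) where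

    ▹-inj : ∀ p {d d′} → p ▹ d ≋ p ▹ d′ → d ≡ d′
    ▹-inj (x , i) {d} {d′} (e ⨾ f) = simple x (e ⨾ lin₁ (+ 1) f (lem i (shift k s x d) (shift k s x d′)))
      where
      lem : ∀ i a b → (+ 0 + a) - (+ 0 + b) ≡ + 1 * ((i + a) - (i + b))
      lem = solve-∀

    nb-! : ∀ x → Unique (nb x)
    nb-! x = map⁺ (λ e → ▹-inj (lift x) (≡⇒≋ e)) dirs-!

    module _ (σ : Aut Γ) where
      private
        f = app {Γ} {Γ} σ

      -- Both lists are free of repetitions, by 6-valency, and have the same members, so they agree
      -- up to order.
      app-nb : ∀ x → map f (nb x) ↭ nb (f x)
      app-nb x = ∼bag⇒↭ (unique∧set⇒bag (map⁺ (app-inj σ) (nb-! x)) (nb-! (f x)) (mk⇔ to fro))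
        where
        to : ∀ {z} → z ∈ map f (nb x) → z ∈ nb (f x)
        to m with ∈-map⁻ f m
        ... | w , w∈ , refl = E⇒∈ (app-E σ (∈⇒E w∈))
        fro : ∀ {z} → z ∈ nb (f x) → z ∈ map f (nb x)
        fro {z} m = subst (_∈ map f (nb x)) (app-from σ z)
          (∈-map⁺ f (E⇒∈ (E-app σ (subst (E Γ (f x)) (sym (app-from σ z)) (∈⇒E m)))))

      cnt-app : ∀ L x y → cnt L (f x) (f y) ≡ cnt L x y
      cnt-app zero x y with x ≟ᵛ y | f x ≟ᵛ f y
      ... | yes _ | yes _ = refl
      ... | no _  | no _  = refl
      ... | yes e | no ¬e = contradiction (cong f e) ¬e
      ... | no ¬e | yes e = contradiction (app-inj σ e) ¬e
      cnt-app (suc L) x y = begin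
        ∑ (nb (f x)) (λ z → cnt L z (f y))    ≡⟨ ∑-↭ (λ z → cnt L z (f y)) (app-nb x) ⟨
        ∑ (map f (nb x)) (λ z → cnt L z (f y)) ≡⟨ ∑-map f (nb x) (λ z → cnt L z (f y)) ⟩
        ∑ (nb x) (λ z → cnt L (f z) (f y))    ≡⟨ ∑-cong (nb x) (λ z → cnt-app L z y) ⟩
        ∑ (nb x) (λ z → cnt L z y)            ∎
        where open ≡-Reasoning

  nb-⟦⟧ : ∀ p → nb ⟦ p ⟧ ≡ map (λ d → ⟦ p ▹ d ⟧) dirs
  nb-⟦⟧ p = map-cong (λ d → ≋⇒≡ (move-≋ k s d (lift-⟦⟧ p))) dirs

  cnt-suc : ∀ L p y → cnt (suc L) ⟦ p ⟧ y ≡ ∑ dirs (λ d → cnt L ⟦ p ▹ d ⟧ y)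
  cnt-suc L p y = trans (cong (λ l → ∑ l (λ z → cnt L z y)) (nb-⟦⟧ p)) (∑-map (λ d → ⟦ p ▹ d ⟧) dirs (λ z → cnt L z y))

-- Walk counts as formal sums of relation vectors.

-- A vector (p , q , r , t) stands for the residue p + q k + r a + t b.
data V4 : Set where
  vec : (p q r t : ℤ) → V4

infixl 6 _⊕_ _⊖_
infixl 7 _·_
_⊕_ _⊖_ : V4 → V4 → V4
vec p q r t ⊕ vec p′ q′ r′ t′ = vec (p + p′) (q + q′) (r + r′) (t + t′)

_·_ : ℤ → V4 → V4
c · vec p q r t = vec (c * p) (c * q) (c * r) (c * t)

v ⊖ w = v ⊕ (- + 1) · w

0ᵛ : V4
0ᵛ = vec (+ 0) (+ 0) (+ 0) (+ 0)

ev : ℤ → ℤ → ℤ → V4 → ℤ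
ev k a b (vec p q r t) = p + q * k + r * a + t * b

module _ (k a b : ℤ) where

  private
    medial : ∀ p q r t → (p + q) + (r + t) ≡ (p + r) + (q + t)
    medial = solve-∀

  ev-⊕ : ∀ v w → ev k a b (v ⊕ w) ≡ ev k a b v + ev k a b w
  ev-⊕ (vec p q r t) (vec p′ q′ r′ t′) = begin
    p + p′ + (q + q′) * k + (r + r′) * a + (t + t′) * b
      ≡⟨ cong₂ _+_ (cong₂ _+_ (cong (λ z → p + p′ + z) (ℤ.*-distribʳ-+ k q q′)) (ℤ.*-distribʳ-+ a r r′)) (ℤ.*-distribʳ-+ b t t′) ⟩
    p + p′ + (q * k + q′ * k) + (r * a + r′ * a) + (t * b + t′ * b)
      ≡⟨ cong (λ z → z + (r * a + r′ * a) + (t * b + t′ * b)) (medial p p′ (q * k) (q′ * k)) ⟩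
    (p + q * k) + (p′ + q′ * k) + (r * a + r′ * a) + (t * b + t′ * b)
      ≡⟨ cong (λ z → z + (t * b + t′ * b)) (medial (p + q * k) (p′ + q′ * k) (r * a) (r′ * a)) ⟩
    (p + q * k + r * a) + (p′ + q′ * k + r′ * a) + (t * b + t′ * b)
      ≡⟨ medial (p + q * k + r * a) (p′ + q′ * k + r′ * a) (t * b) (t′ * b) ⟩
    (p + q * k + r * a + t * b) + (p′ + q′ * k + r′ * a + t′ * b) ∎
    where open ≡-Reasoning

  ev-· : ∀ c v → ev k a b (c · v) ≡ c * ev k a b v
  ev-· c (vec p q r t) = begin
    c * p + c * q * k + c * r * a + c * t * b
      ≡⟨ cong₂ _+_ (cong₂ _+_ (cong (λ z → c * p + z) (ℤ.*-assoc c q k)) (ℤ.*-assoc c r a)) (ℤ.*-assoc c t b) ⟩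
    c * p + c * (q * k) + c * (r * a) + c * (t * b)
      ≡⟨ cong (λ z → z + c * (r * a) + c * (t * b)) (ℤ.*-distribˡ-+ c p (q * k)) ⟨
    c * (p + q * k) + c * (r * a) + c * (t * b)
      ≡⟨ cong (λ z → z + c * (t * b)) (ℤ.*-distribˡ-+ c (p + q * k) (r * a)) ⟨
    c * (p + q * k + r * a) + c * (t * b)
      ≡⟨ ℤ.*-distribˡ-+ c (p + q * k + r * a) (t * b) ⟨
    c * (p + q * k + r * a + t * b) ∎
    where open ≡-Reasoning

  ev-⊖ : ∀ v w → ev k a b (v ⊖ w) ≡ ev k a b v - ev k a b w
  ev-⊖ v w = trans (ev-⊕ v ((- + 1) · w))
    (cong (λ z → ev k a b v + z) (trans (ev-· (- + 1) w) (ℤ.-1*i≡-i _)))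

spokeᵛ : Fin 4 → V4
spokeᵛ i₀ = 0ᵛ
spokeᵛ i₁ = vec (+ 1) (+ 0) (+ 0) (+ 0)
spokeᵛ i₂ = vec (+ 0) (+ 0) (+ 1) (+ 0)
spokeᵛ i₃ = vec (+ 0) (+ 0) (+ 0) (+ 1)

shiftᵛ : Side → Dir → V4
shiftᵛ U fwd     = vec (+ 1) (+ 0) (+ 0) (+ 0)
shiftᵛ U bwd     = vec (- + 1) (+ 0) (+ 0) (+ 0)
shiftᵛ W fwd     = vec (+ 0) (+ 1) (+ 0) (+ 0)
shiftᵛ W bwd     = vec (+ 0) (- + 1) (+ 0) (+ 0)
shiftᵛ U (spk j) = spokeᵛ j
shiftᵛ W (spk j) = (- + 1) · spokeᵛ j

ev-shift : ∀ k a b x d → ev k a b (shiftᵛ x d) ≡ shift k (spokes (+ 0) (+ 1) a b) x d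
ev-shift k a b = go
  where
  0+1* : ∀ x → + 0 + + 1 * x ≡ x
  0+1* x = trans (ℤ.+-identityˡ _) (ℤ.*-identityˡ x)
  0-1* : ∀ x → + 0 + - + 1 * x ≡ - x
  0-1* x = trans (ℤ.+-identityˡ _) (ℤ.-1*i≡-i x)
  +0 : ∀ {x y} → x ≡ y → x + + 0 ≡ y
  +0 e = trans (ℤ.+-identityʳ _) e
  go : ∀ x d → ev k a b (shiftᵛ x d) ≡ shift k (spokes (+ 0) (+ 1) a b) x d
  go U fwd      = refl
  go U bwd      = refl
  go U (spk i₀) = refl
  go U (spk i₁) = refl
  go U (spk i₂) = +0 (0+1* a)
  go U (spk i₃) = 0+1* b
  go W fwd      = +0 (+0 (0+1* k))
  go W bwd      = +0 (+0 (0-1* k))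
  go W (spk i₀) = refl
  go W (spk i₁) = refl
  go W (spk i₂) = +0 (0-1* a)
  go W (spk i₃) = 0-1* b

data Cmp : Set where
  lt eq gt : Cmp

cmpℕ : ℕ → ℕ → Cmp
cmpℕ m n = if m ℕ.≡ᵇ n then eq else if m ℕ.<ᵇ n then lt else gt

cmpℤ : ℤ → ℤ → Cmp
cmpℤ (+ m)    (+ n)    = cmpℕ m n
cmpℤ (+ m)    -[1+ n ] = gt
cmpℤ -[1+ m ] (+ n)    = lt
cmpℤ -[1+ m ] -[1+ n ] = cmpℕ n m

andThen : Cmp → Cmp → Cmp
andThen lt _ = lt
andThen gt _ = gt
andThen eq c = c

cmpᵛ : V4 → V4 → Cmp
cmpᵛ (vec p q r t) (vec p′ q′ r′ t′) =
  andThen (cmpℤ p p′) (andThen (cmpℤ q q′) (andThen (cmpℤ r r′) (cmpℤ t t′)))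

cmpℕ-eq : ∀ m n → cmpℕ m n ≡ eq → m ≡ n
cmpℕ-eq m n e with m ℕ.≡ᵇ n in m≡n
... | true = ℕ.≡ᵇ⇒≡ m n (subst T (sym m≡n) _)
... | false with m ℕ.<ᵇ n
cmpℕ-eq m n () | false | true
cmpℕ-eq m n () | false | false

cmpℤ-eq : ∀ x y → cmpℤ x y ≡ eq → x ≡ y
cmpℤ-eq (+ m)    (+ n)    e = cong +_ (cmpℕ-eq m n e)
cmpℤ-eq -[1+ m ] -[1+ n ] e = cong -[1+_] (sym (cmpℕ-eq n m e))

andThen-eq : ∀ c d → andThen c d ≡ eq → c ≡ eq × d ≡ eq
andThen-eq eq d e = refl , e

cmpᵛ-eq : ∀ v w → cmpᵛ v w ≡ eq → v ≡ w
cmpᵛ-eq (vec p q r t) (vec p′ q′ r′ t′) e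
  with andThen-eq (cmpℤ p p′) _ e
... | e₁ , f with andThen-eq (cmpℤ q q′) _ f
... | e₂ , g with andThen-eq (cmpℤ r r′) _ g
... | e₃ , e₄ rewrite cmpℤ-eq p p′ e₁ | cmpℤ-eq q q′ e₂ | cmpℤ-eq r r′ e₃ | cmpℤ-eq t t′ e₄ = refl

addᶜ : List ℤ → List ℤ → List ℤ
addᶜ []       ys       = ys
addᶜ (x ∷ xs) []       = x ∷ xs
addᶜ (x ∷ xs) (y ∷ ys) = x + y ∷ addᶜ xs ys

nth : ℕ → List ℤ → ℤ
nth _       []       = + 0
nth zero    (x ∷ xs) = x
nth (suc q) (x ∷ xs) = nth q xs

nth-addᶜ : ∀ q xs ys → nth q (addᶜ xs ys) ≡ nth q xs + nth q ys
nth-addᶜ q       []       ys       = sym (ℤ.+-identityˡ _)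
nth-addᶜ zero    (x ∷ xs) []       = sym (ℤ.+-identityʳ x)
nth-addᶜ (suc q) (x ∷ xs) []       = sym (ℤ.+-identityʳ _)
nth-addᶜ zero    (x ∷ xs) (y ∷ ys) = refl
nth-addᶜ (suc q) (x ∷ xs) (y ∷ ys) = nth-addᶜ q xs ys

nth-map : ∀ (f : ℤ → ℤ) → f (+ 0) ≡ + 0 → ∀ q xs → nth q (map f xs) ≡ f (nth q xs)
nth-map f f0 q       []       = sym f0
nth-map f f0 zero    (x ∷ xs) = refl
nth-map f f0 (suc q) (x ∷ xs) = nth-map f f0 q xs

-- A table is a formal sum of vectors with coefficient lists, ordered by cmpᵛ so that sums are merges.
Table : Set
Table = List (V4 × List ℤ)

-- A table carries several linear forms at once, and `q` selects one of them. In the applications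
-- `χ v` is the indicator that the value of `v`, possibly translated, is divisible by n.
evT : (V4 → ℤ) → ℕ → Table → ℤ
evT χ q t = ∑ t λ { (v , c) → nth q c * χ v }

-- The continuation `f` stands for merging with the rest of the first table; with it the recursion
-- is structural in the second table alone.
mergeCons : V4 → List ℤ → (Table → Table) → Table → Table
mergeCons v c f []             = (v , c) ∷ f []
mergeCons v c f ((w , d) ∷ ys) with cmpᵛ v w
... | lt = (v , c) ∷ f ((w , d) ∷ ys)
... | gt = (w , d) ∷ mergeCons v c f ys
... | eq = (v , addᶜ c d) ∷ f ys

merge : Table → Table → Table
merge []             ys = ys
merge ((v , c) ∷ xs) ys = mergeCons v c (merge xs) ys

merges : List Table → Table
merges []       = []
merges (t ∷ ts) = merge t (merges ts)

shiftT : V4 → Table → Table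
shiftT w = map λ { (v , c) → v ⊕ w , c }

-- A table with a single coefficient per vector is spread over all linear forms by multiplying that
-- coefficient with the column `cs`.
scaleT : List ℤ → Table → Table
scaleT cs = map λ { (v , c) → v , map (λ x → x * nth 0 c) cs }

module _ (χ : V4 → ℤ) (q : ℕ) where

  evT-mergeCons : ∀ v c xs f → (∀ ys → evT χ q (f ys) ≡ evT χ q xs + evT χ q ys) →
                  ∀ ys → evT χ q (mergeCons v c f ys) ≡ evT χ q ((v , c) ∷ xs) + evT χ q ys
  evT-mergeCons v c xs f h [] = trans (cong (λ z → nth q c * χ v + z) (h [])) (sym (ℤ.+-assoc (nth q c * χ v) _ _))
  evT-mergeCons v c xs f h ((w , d) ∷ ys) with cmpᵛ v w in e
  ... | lt = trans (cong (λ z → nth q c * χ v + z) (h ((w , d) ∷ ys))) (sym (ℤ.+-assoc (nth q c * χ v) _ _))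
  ... | gt = trans (cong (λ z → nth q d * χ w + z) (evT-mergeCons v c xs f h ys)) (lem (nth q d * χ w) (evT χ q ((v , c) ∷ xs)) (evT χ q ys))
    where
    lem : ∀ x y z → x + (y + z) ≡ y + (x + z)
    lem = solve-∀
  ... | eq with refl ← cmpᵛ-eq v w e =
    trans (cong₂ (λ y z → y * χ v + z) (nth-addᶜ q c d) (h ys)) (lem (nth q c) (nth q d) (χ v) (evT χ q xs) (evT χ q ys))
    where
    lem : ∀ x y z s t → (x + y) * z + (s + t) ≡ (x * z + s) + (y * z + t)
    lem = solve-∀

  evT-merge : ∀ xs ys → evT χ q (merge xs ys) ≡ evT χ q xs + evT χ q ys
  evT-merge []             ys = sym (ℤ.+-identityˡ _)
  evT-merge ((v , c) ∷ xs) ys = evT-mergeCons v c xs (merge xs) (evT-merge xs) ys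

  evT-merges : ∀ {A : Set} (f : A → Table) xs → evT χ q (merges (map f xs)) ≡ ∑ xs (λ x → evT χ q (f x))
  evT-merges f []       = refl
  evT-merges f (x ∷ xs) = trans (evT-merge (f x) _) (cong (λ z → evT χ q (f x) + z) (evT-merges f xs))

  evT-shift : ∀ w t → evT χ q (shiftT w t) ≡ evT (λ v → χ (v ⊕ w)) q t
  evT-shift w t = ∑-map _ t _

  evT-scale : ∀ cs t → evT χ q (scaleT cs t) ≡ nth q cs * evT χ 0 t
  evT-scale cs []            = sym (ℤ.*-zeroʳ (nth q cs))
  evT-scale cs ((v , c) ∷ t) = trans
    (cong₂ (λ y z → y * χ v + z) (nth-map (_* nth 0 c) refl q cs) (evT-scale cs t))
    (lem (nth q cs) (nth 0 c) (χ v) _)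
    where
    lem : ∀ x y z s → x * y * z + x * s ≡ x * (y * z + s)
    lem = solve-∀

evT-cong : ∀ {χ χ′} q t → (∀ v → χ v ≡ χ′ v) → evT χ q t ≡ evT χ′ q t
evT-cong q t e = ∑-cong t λ { (v , c) → cong (nth q c *_) (e v) }

select : Table × Table → Side → Table
select (u , w) U = u
select (u , w) W = w

-- The table at side `x` lists the displacements of all walks of the current length from `x` to a
-- fixed side. A longer walk begins with a step `d`, whose displacement is added to the table of the
-- side it reaches.
step : Table × Table → Table × Table
step ts = go U , go W
  where
  go : Side → Table
  go x = merges (map (λ d → shiftT (shiftᵛ x d) (select ts (turn x d))) dirs)

start : Side → Table × Table
start U = (0ᵛ , + 1 ∷ []) ∷ [] , []
start W = [] , (0ᵛ , + 1 ∷ []) ∷ []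

walks : Side → ℕ → Table × Table
walks y zero    = start y
walks y (suc L) = step (walks y L)

indicator : ∀ {P : Set} → Dec P → ℤ
indicator (yes _) = + 1
indicator (no _)  = + 0

module _ {P : Set} where

  indicator-yes : (d : Dec P) → P → indicator d ≡ + 1
  indicator-yes (yes _) p = refl
  indicator-yes (no ¬p) p = contradiction p ¬p

  indicator-no : (d : Dec P) → ¬ P → indicator d ≡ + 0
  indicator-no (no _)  ¬p = refl
  indicator-no (yes p) ¬p = contradiction p ¬p

  indicator-cong : ∀ {Q : Set} (d : Dec P) (e : Dec Q) → (P → Q) → (Q → P) → indicator d ≡ indicator e
  indicator-cong (yes p) e f g = sym (indicator-yes′ e (f p))
    where
    indicator-yes′ : ∀ {Q : Set} (d : Dec Q) → Q → indicator d ≡ + 1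
    indicator-yes′ (yes _) p = refl
    indicator-yes′ (no ¬p) p = contradiction p ¬p
  indicator-cong (no ¬p) (yes q) f g = contradiction (g q) ¬p
  indicator-cong (no ¬p) (no _)  f g = refl

ind : ℕ → ℤ → ℤ
ind n z = indicator (+ n ∣? z)

module _ {n : ℕ} where

  ind-cong : ∀ {x y} → (+ n ∣ x → + n ∣ y) → (+ n ∣ y → + n ∣ x) → ind n x ≡ ind n y
  ind-cong {x} {y} = indicator-cong (+ n ∣? x) (+ n ∣? y)

  ind-yes : ∀ {x} → + n ∣ x → ind n x ≡ + 1
  ind-yes {x} = indicator-yes (+ n ∣? x)

  ind-no : ∀ {x} → ¬ (+ n ∣ x) → ind n x ≡ + 0
  ind-no {x} = indicator-no (+ n ∣? x)

module SymbolicWalks (n : ℕ) .{{nz : NonZero n}} (k a b : ℤ) where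
  open Walks n k (spokes (+ 0) (+ 1) a b) public

  private
    χ : ℤ → V4 → ℤ
    χ δ v = ind n (ev k a b v - δ)

    to-δ : ∀ i j → + 0 - (j - i) ≡ + 1 * (i - j)
    to-δ = solve-∀
    from-δ : ∀ i j → i - j ≡ + 1 * (+ 0 - (j - i))
    from-δ = solve-∀
    move-δ : ∀ i j s v → v - (j - (i + s)) ≡ v + s - (j - i)
    move-δ = solve-∀

    cnt-0 : ∀ x i j → cnt 0 ⟦ x , i ⟧ ⟦ x , j ⟧ ≡ ind n (+ 0 - (j - i))
    cnt-0 x i j with ⟦ x , i ⟧ ≟ᵛ ⟦ x , j ⟧
    ... | yes e = sym (ind-yes {n} (lin₁ (+ 1) (index-∣ (≡⇒≋ e)) (to-δ i j)))
    ... | no ¬e = sym (ind-no {n} λ d → ¬e (≋⇒≡ (refl ⨾ lin₁ (+ 1) d (from-δ i j))))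

    single : ∀ {z y} → z ≡ y → z ≡ + 1 * y + + 0
    single {y = y} e = trans e (sym (trans (ℤ.+-identityʳ _) (ℤ.*-identityˡ y)))

  -- The tables do not depend on n; reduction modulo n enters only in the test whether a
  -- displacement is congruent to `j - i`.
  cnt-walks : ∀ L x i y j → cnt L ⟦ x , i ⟧ ⟦ y , j ⟧ ≡ evT (χ (j - i)) 0 (select (walks y L) x)
  cnt-walks zero U i U j = single (cnt-0 U i j)
  cnt-walks zero W i W j = single (cnt-0 W i j)
  cnt-walks zero U i W j = refl
  cnt-walks zero W i U j = refl
  cnt-walks (suc L) x i y j = begin
    cnt (suc L) ⟦ x , i ⟧ ⟦ y , j ⟧
      ≡⟨ cnt-suc L (x , i) ⟦ y , j ⟧ ⟩
    ∑ dirs (λ d → cnt L ⟦ (x , i) ▹ d ⟧ ⟦ y , j ⟧)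
      ≡⟨ ∑-cong dirs one ⟩
    ∑ dirs (λ d → evT (χ (j - i)) 0 (shiftT (shiftᵛ x d) (select (walks y L) (turn x d))))
      ≡⟨ evT-merges (χ (j - i)) 0 (λ d → shiftT (shiftᵛ x d) (select (walks y L) (turn x d))) dirs ⟨
    evT (χ (j - i)) 0 (merges (map (λ d → shiftT (shiftᵛ x d) (select (walks y L) (turn x d))) dirs))
      ≡⟨ cong (evT (χ (j - i)) 0) (sel x) ⟨
    evT (χ (j - i)) 0 (select (walks y (suc L)) x) ∎
    where
    open ≡-Reasoning
    sel : ∀ x → select (step (walks y L)) x ≡ merges (map (λ d → shiftT (shiftᵛ x d) (select (walks y L) (turn x d))) dirs)
    sel U = refl
    sel W = refl
    move-χ : ∀ s v → ind n (v - (j - (i + s))) ≡ ind n (v + s - (j - i))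
    move-χ s v = cong (ind n) (move-δ i j s v)
    one : ∀ d → cnt L ⟦ (x , i) ▹ d ⟧ ⟦ y , j ⟧ ≡ evT (χ (j - i)) 0 (shiftT (shiftᵛ x d) (select (walks y L) (turn x d)))
    one d = trans (cnt-walks L (turn x d) (i + _) y j)
      (trans (evT-cong 0 (select (walks y L) (turn x d)) (λ v →
          trans (move-χ (shift k (spokes (+ 0) (+ 1) a b) x d) (ev k a b v))
                (cong (λ z → ind n (z - (j - i))) (sym (trans (ev-⊕ k a b v (shiftᵛ x d)) (cong (λ z → ev k a b v + z) (ev-shift k a b x d)))))))
        (sym (evT-shift (χ (j - i)) 0 (shiftᵛ x d) (select (walks y L) (turn x d)))))

-- The search through lattices of relations.

-- Lattice reduction: a basis lists relations with strictly decreasing pivots.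
isZeroℤ : ℤ → Bool
isZeroℤ (+ zero) = true
isZeroℤ _        = false

pivot : V4 → ℕ
pivot (vec p q r t) =
  if not (isZeroℤ t) then 4 else if not (isZeroℤ r) then 3 else
  if not (isZeroℤ q) then 2 else if not (isZeroℤ p) then 1 else 0

coord : ℕ → V4 → ℤ
coord 0 _             = + 0
coord 1 (vec p q r t) = p
coord 2 (vec p q r t) = q
coord 3 (vec p q r t) = r
coord _ (vec p q r t) = t

negative : ℤ → Bool
negative (+ _)    = false
negative -[1+ _ ] = true

-- A vector and its negative vanish together; fixing the sign lets them share one entry.
normalise : V4 → V4
normalise v = if negative (coord (pivot v) v) then (- + 1) · v else v

-- Minus the rounded quotient, so that reducing adds multiples of the basis.
quot : ℤ → ℤ → ℤ
quot x (+ suc m) = - ((x + x + + suc m) ℤ./ℕ suc (m ℕ.+ suc m))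
quot x _         = + 0

-- A relation together with the position and the value of its pivot.
data Row : Set where
  row : ℕ → ℤ → V4 → Row

vector : Row → V4
vector (row _ _ v) = v

toRow′ : V4 → ℕ → Row
toRow′ v i = row i (coord i v) v

toRow : V4 → Row
toRow v = toRow′ v (pivot v)

addMultiple : V4 → ℤ → V4 → V4
addMultiple v (+ zero) b = v
addMultiple v c        b = v ⊕ c · b

reduceBy′ : ℤ → ℤ → V4 → V4 → V4
reduceBy′ (+ zero) d b v = v
reduceBy′ x        d b v = addMultiple v (quot x d) b

reduceBy : Row → V4 → V4
reduceBy (row i d b) v = reduceBy′ (coord i v) d b v

reduce : List Row → V4 → V4
reduce []       v = normalise v
reduce (b ∷ bs) v = reduce bs (reduceBy b v)

-- For equal pivots this is Euclid's algorithm: the reduced vector takes the place of the old row,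
-- which is inserted again, until the pivot entry disappears. Running out of fuel only forgets a
-- relation, so all rows remain valid.
insert : ℕ → V4 → List Row → List Row
insert zero    v bs       = bs
insert (suc f) v []       = toRow (normalise v) ∷ []
insert (suc f) v (row i d b ∷ bs) with cmpℕ (pivot v) i
... | gt = toRow (normalise v) ∷ row i d b ∷ bs
... | lt = row i d b ∷ insert f v bs
... | eq with cmpℕ (pivot (reduceBy (row i d b) v)) i
...   | eq = insert f b (toRow (normalise (reduceBy (row i d b) v)) ∷ bs)
...   | _  = row i d b ∷ insert f (reduceBy (row i d b) v) bs

isZeroᵛ : V4 → Bool
isZeroᵛ (vec p q r t) = isZeroℤ p ∧ isZeroℤ q ∧ isZeroℤ r ∧ isZeroℤ t

same : V4 → V4 → Bool
same v w = case cmpᵛ v w of λ { eq → true ; _ → false }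

member : V4 → List V4 → Bool
member v = any (same v)

isZeroᶜ : List ℤ → Bool
isZeroᶜ = all isZeroℤ

-- The constants collect the coefficients of vectors known to vanish; the table holds the vectors
-- that are still undecided.
Sums : Set
Sums = List ℤ × Table

addEntry : V4 → List ℤ → Table → Table
addEntry v c []             = (v , c) ∷ []
addEntry v c ((w , d) ∷ es) = if same v w then (w , addᶜ c d) ∷ es else (w , d) ∷ addEntry v c es

absorb : List V4 → Table → Sums → Sums
absorb ap []             sums      = sums
absorb ap ((v , c) ∷ es) (c₀ , ds) =
  if isZeroᵛ v then absorb ap es (addᶜ c c₀ , ds) else
  if member v ap then absorb ap es (c₀ , ds) else
  absorb ap es (c₀ , addEntry v c ds)

prune : Table → Table
prune []             = []
prune ((v , c) ∷ es) = if isZeroᶜ c then prune es else (v , c) ∷ prune es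

pruned : Sums → Sums
pruned (c , es) = c , prune es

-- A pair (`ys`, `ns`) describes a situation in which the goal is reached: all of `ys` vanish and
-- none of `ns` does.
Template : Set
Template = List V4 × List V4

-- `sums` holds the equations in use. `phases` holds those for longer walks, which are loaded once
-- there is nothing left to split on.
record State : Set where
  constructor state
  field
    basis     : List Row
    apart     : List V4
    sums      : Sums
    phases    : List Table
    templates : List Template
open State

reduceT : List Row → Table → Table
reduceT bs = map λ { (v , c) → reduce bs v , c }

load : List Row → List V4 → Table → Sums → Sums
load bs ap t sums = pruned (absorb ap (reduceT bs t) sums)

nonzero : List V4 → List V4
nonzero []       = []
nonzero (v ∷ vs) = if isZeroᵛ v then nonzero vs else v ∷ nonzero vs

without : List V4 → List V4 → List V4
without ap []       = []
without ap (v ∷ vs) = if member v ap then without ap vs else v ∷ without ap vs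

keep : List V4 → Template → List Template → List Template
keep ap (ys , ns) ts =
  if any (λ v → member v ap) ys ∨ any isZeroᵛ ns then ts else (ys , without ap ns) ∷ ts

templatesYes : List Row → List V4 → List Template → List Template
templatesYes bs ap []               = []
templatesYes bs ap ((ys , ns) ∷ ts) =
  keep ap (nonzero (map (reduce bs) ys) , map (reduce bs) ns) (templatesYes bs ap ts)

templatesNo : V4 → List Template → List Template
templatesNo v []               = []
templatesNo v ((ys , ns) ∷ ts) =
  if member v ys then templatesNo v ts else (ys , without (v ∷ []) ns) ∷ templatesNo v ts

fuel : ℕ
fuel = 60

rebase : List Row → List V4 → Sums → List Table → List Template → State
rebase bs ap (c , es) ps ts = state bs ap (load bs ap es (c , [])) ps (templatesYes bs ap ts)

assume′ : List Row → State → State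
assume′ bs (state _ ap sums ps ts) = rebase bs (map (reduce bs) ap) sums ps ts

assume : V4 → State → State
assume v st = assume′ (insert fuel v (basis st)) st

deny : V4 → State → State
deny v (state bs ap (c , es) ps ts) =
  state bs (v ∷ ap) (absorb (v ∷ []) es (c , [])) ps (templatesNo v ts)

negPart posPart : ℤ → ℤ
negPart (+ _)    = + 0
negPart -[1+ m ] = -[1+ m ]
posPart (+ m)    = + m
posPart -[1+ _ ] = + 0

bound : (ℤ → ℤ) → Sums → List ℤ
bound part (c , [])             = c
bound part (c , ((_ , d) ∷ es)) = addᶜ (map part d) (bound part (c , es))

positive : ℤ → Bool
positive (+ suc _) = true
positive _         = false

-- Every undecided indicator lies between 0 and 1. This bounds each sum on both sides, and zero has
-- to lie within the bounds.
refuted : State → Bool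
refuted (state bs ap sums ps ts) =
  any isZeroᵛ ap ∨ any positive (bound negPart sums) ∨ any negative (bound posPart sums)

accepted : List Template → Bool
accepted []                    = false
accepted (([] , []) ∷ ts)      = true
accepted (_ ∷ ts)              = accepted ts

-- Heuristics: they only influence the size of the search tree.
weight : V4 → ℕ
weight (vec p q r t) = ∣ p ∣ ℕ.+ ∣ q ∣ ℕ.+ ∣ r ∣ ℕ.+ ∣ t ∣

tightest : ℕ → List ℤ → List ℤ → Maybe (ℕ × ℕ × Bool)
tightest q []       _        = nothing
tightest q (_ ∷ _)  []       = nothing
tightest q (l ∷ ls) (h ∷ hs) with cmpℤ l h | tightest (suc q) ls hs
... | eq | r       = r
... | _  | nothing = just (∣ l ∣ ℕ.⊓ ∣ h ∣ , q , (∣ h ∣ ℕ.<ᵇ ∣ l ∣))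
... | _  | just (s , q′ , b) =
  if s ℕ.<ᵇ (∣ l ∣ ℕ.⊓ ∣ h ∣) then just (s , q′ , b)
  else just (∣ l ∣ ℕ.⊓ ∣ h ∣ , q , (∣ h ∣ ℕ.<ᵇ ∣ l ∣))

heaviest : (List ℤ → ℤ) → Table → Maybe (ℤ × V4)
heaviest f []             = nothing
heaviest f ((v , c) ∷ es) with heaviest f es
... | nothing = just (f c , v)
... | just (x , w) with cmpℤ x (f c)
...   | lt = just (f c , v)
...   | gt = just (x , w)
...   | eq = if weight v ℕ.<ᵇ weight w then just (f c , v) else just (x , w)

candidate : List Template → Maybe V4
candidate []                       = nothing
candidate (([] , v ∷ _) ∷ ts)      = just v
candidate (_ ∷ ts)                 = candidate ts

fromSums : Sums → Maybe V4
fromSums sums with tightest 0 (bound negPart sums) (bound posPart sums)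
... | nothing = nothing
... | just (_ , q , up) =
  Maybe.map proj₂ (heaviest (λ c → if up then nth q c else - nth q c) (proj₂ sums))

choose : State → Maybe V4
choose st with candidate (templates st)
... | just v  = just v
... | nothing = fromSums (sums st)

both : Maybe (List (List V4)) → Maybe (List (List V4)) → Maybe (List (List V4))
both (just xs) (just ys) = just (xs ++ ys)
both _         _         = nothing

-- Lattices whose quotient has one of these orders are left to a direct inspection.
exhausted : List Table → List Row → Bool
exhausted (_ ∷ _ ∷ _) bs = false
exhausted _           bs = any (λ m → isZeroᵛ (reduce bs (vec (+ m) (+ 0) (+ 0) (+ 0)))) (4 ∷ 5 ∷ 8 ∷ 10 ∷ [])

-- A result `just R` means that every branch is refuted or accepted except those whose bases are
-- collected in `R`; `nothing` means that the depth was exceeded.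
search : ℕ → State → Maybe (List (List V4))
search zero    _  = nothing
search (suc f) st =
  if refuted st then just [] else
  if accepted (templates st) then just [] else
  (case choose st of λ
    { (just v) → both (search f (assume v st)) (search f (deny v st))
    ; nothing  → case phases st of λ
        { []       → just (map vector (basis st) ∷ [])
        ; (p ∷ ps) → if exhausted ps (basis st) then just (map vector (basis st) ∷ []) else search f (record st { sums = load (basis st) (apart st) p ([] , []) ; phases = ps }) } })

-- Six equations for six equal counts: twice the rim plus twice the hub minus the four spokes, and
-- each other edge minus the rim. The coefficients of each equation sum to zero over the edges. The
-- first follows from the others, but gives different bounds once the unknowns are confined to 0 and
-- 1.
column : ℕ → List ℤ
column 0 = + 2 ∷ - + 1 ∷ - + 1 ∷ - + 1 ∷ - + 1 ∷ - + 1 ∷ []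
column 1 = + 2 ∷ + 1 ∷ []
column 2 = - + 1 ∷ + 0 ∷ + 1 ∷ []
column 3 = - + 1 ∷ + 0 ∷ + 0 ∷ + 1 ∷ []
column 4 = - + 1 ∷ + 0 ∷ + 0 ∷ + 0 ∷ + 1 ∷ []
column _ = - + 1 ∷ + 0 ∷ + 0 ∷ + 0 ∷ + 0 ∷ + 1 ∷ []

-- The edges of Γ up to translation: rim, hub and the four spokes.
data Edge : Set where
  rimᵉ hubᵉ : Edge
  spkᵉ      : Fin 4 → Edge

edges : List Edge
edges = rimᵉ ∷ hubᵉ ∷ spkᵉ i₀ ∷ spkᵉ i₁ ∷ spkᵉ i₂ ∷ spkᵉ i₃ ∷ []

source : Edge → Side
source rimᵉ     = U
source hubᵉ     = W
source (spkᵉ _) = U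

along : Edge → Dir
along rimᵉ     = fwd
along hubᵉ     = fwd
along (spkᵉ j) = spk j

-- Displacements are taken relative to that of the edge, so that a walk joins the ends of the edge
-- exactly when its vector vanishes.
edgeTable : (Side → Table × Table) → Edge → Table
edgeTable ws e = shiftT ((- + 1) · shiftᵛ (source e) (along e)) (select (ws (turn (source e) (along e))) (source e))

columnᵉ : Edge → List ℤ
columnᵉ rimᵉ     = column 0
columnᵉ hubᵉ     = column 1
columnᵉ (spkᵉ j) = column (2 ℕ.+ toℕ j)

imbalance : (Side → Table × Table) → Table
imbalance ws = merges (map (λ e → scaleT (columnᵉ e) (edgeTable ws e)) edges)

ends : Table × Table → Table × Table → Side → Table × Table
ends u w U = u
ends u w W = w

imbalances : ℕ → (u w : Table × Table) → List Table
imbalances zero    u w = []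
imbalances (suc f) u w =
  imbalance (ends u w) ∷ imbalances f (step u) (step w)

-- Nondegeneracy: n divides none of 1, 2, 3, the hub step k satisfies neither k = 0 nor 2k = 0, and
-- the spokes 0, 1, a, b are distinct modulo n.
distinct : List V4
distinct = vec (+ 1) (+ 0) (+ 0) (+ 0) ∷ vec (+ 2) (+ 0) (+ 0) (+ 0) ∷ vec (+ 3) (+ 0) (+ 0) (+ 0)
         ∷ vec (+ 0) (+ 1) (+ 0) (+ 0) ∷ vec (+ 0) (+ 2) (+ 0) (+ 0)
         ∷ vec (+ 0) (+ 0) (+ 1) (+ 0) ∷ vec (+ 0) (+ 0) (+ 0) (+ 1)
         ∷ vec (- + 1) (+ 0) (+ 1) (+ 0) ∷ vec (- + 1) (+ 0) (+ 0) (+ 1) ∷ vec (+ 0) (+ 0) (- + 1) (+ 1) ∷ []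

initial : List V4 → List V4 → ℕ → List Template → State
initial rels ap L ts = assume′ (foldr (insert fuel) [] rels)
  (state [] ap ([] , []) (imbalances L (step (step (start U))) (step (step (start W)))) ts)

-- Up to signs: 2k = 2 and b = a + k.
family : List Template
family = (vec (- + 2) (+ 2) (+ 0) (+ 0) ∷ vec (+ 0) (- + 1) (- + 1) (+ 1) ∷ [] , [])
       ∷ (vec (+ 2) (+ 2) (+ 0) (+ 0) ∷ vec (+ 0) (- + 1) (- + 1) (+ 1) ∷ [] , [])
       ∷ (vec (- + 2) (+ 2) (+ 0) (+ 0) ∷ vec (+ 0) (+ 1) (- + 1) (+ 1) ∷ [] , [])
       ∷ (vec (+ 2) (+ 2) (+ 0) (+ 0) ∷ vec (+ 0) (+ 1) (- + 1) (+ 1) ∷ [] , []) ∷ []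

-- Soundness of the search.

∧-true : ∀ {x y} → x ∧ y ≡ true → x ≡ true × y ≡ true
∧-true {true} e = refl , e

∨-true : ∀ {x y} → x ∨ y ≡ true → x ≡ true ⊎ y ≡ true
∨-true {true}  e = inj₁ refl
∨-true {false} e = inj₂ e

any-true : ∀ {A : Set} (f : A → Bool) xs → any f xs ≡ true → Any (λ x → f x ≡ true) xs
any-true f (x ∷ xs) e with f x in fx
... | true  = here fx
... | false = there (any-true f xs e)

isZeroℤ-sound : ∀ x → isZeroℤ x ≡ true → x ≡ + 0
isZeroℤ-sound (+ zero) e = refl

isZeroᵛ-sound : ∀ v → isZeroᵛ v ≡ true → v ≡ 0ᵛ
isZeroᵛ-sound (vec p q r t) e with ∧-true {isZeroℤ p} e
... | e₁ , f with ∧-true {isZeroℤ q} f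
... | e₂ , g with ∧-true {isZeroℤ r} g
... | e₃ , e₄ rewrite isZeroℤ-sound p e₁ | isZeroℤ-sound q e₂ | isZeroℤ-sound r e₃ | isZeroℤ-sound t e₄ = refl

isZeroᶜ-sound : ∀ q c → isZeroᶜ c ≡ true → nth q c ≡ + 0
isZeroᶜ-sound q       []       e = refl
isZeroᶜ-sound zero    (x ∷ c)  e = isZeroℤ-sound x (proj₁ (∧-true {isZeroℤ x} e))
isZeroᶜ-sound (suc q) (x ∷ c)  e = isZeroᶜ-sound q c (proj₂ (∧-true {isZeroℤ x} e))

same-sound : ∀ v w → same v w ≡ true → v ≡ w
same-sound v w e with cmpᵛ v w in c
... | eq = cmpᵛ-eq v w c

positive-nth : ∀ c → any positive c ≡ true → ∃[ q ] + 0 ℤ.< nth q c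
positive-nth (x ∷ c) e with ∨-true {positive x} e
positive-nth (+ suc m ∷ c) e | inj₁ _ = 0 , ℤ.+<+ (ℕ.s≤s ℕ.z≤n)
... | inj₂ f with positive-nth c f
...   | q , l = suc q , l

negative-nth : ∀ c → any negative c ≡ true → ∃[ q ] nth q c ℤ.< + 0
negative-nth (x ∷ c) e with ∨-true {negative x} e
negative-nth (-[1+ m ] ∷ c) e | inj₁ _ = 0 , ℤ.-<+
... | inj₂ f with negative-nth c f
...   | q , l = suc q , l

both-just : ∀ x y {R} → both x y ≡ just R → ∃[ xs ] ∃[ ys ] x ≡ just xs × y ≡ just ys × R ≡ xs ++ ys
both-just (just xs) (just ys) refl = xs , ys , refl , refl , refl

module Sound (n : ℕ) (k a b : ℤ) where

  -- A record instead of the bare divisibility, since `v` cannot be recovered by unification from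
  -- its value.
  record Z (v : V4) : Set where
    constructor vanishes
    field
      unZ : + n ∣ ev k a b v
  open Z public

  χ : V4 → ℤ
  χ v = ind n (ev k a b v)

  Z? : ∀ v → Dec (Z v)
  Z? v with + n ∣? ev k a b v
  ... | yes p = yes (vanishes p)
  ... | no ¬p = no (¬p ∘ unZ)

  Z-0 : Z 0ᵛ
  Z-0 = vanishes (divides (+ 0) refl)

  Z-⊕ : ∀ {v w} → Z v → Z w → Z (v ⊕ w)
  Z-⊕ {v} {w} (vanishes p) (vanishes q) = vanishes (subst (+ n ∣_) (sym (ev-⊕ k a b v w)) (∣m∣n⇒∣m+n p q))

  Z-⊕⁻ : ∀ {v w} → Z w → Z (v ⊕ w) → Z v
  Z-⊕⁻ {v} {w} (vanishes q) (vanishes p) = vanishes (lin₂ (+ 1) (- + 1) p q (trans (lem (ev k a b v) (ev k a b w))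
      (cong (λ z → + 1 * z + - + 1 * ev k a b w) (sym (ev-⊕ k a b v w)))))
    where
    lem : ∀ x y → x ≡ + 1 * (x + y) + - + 1 * y
    lem = solve-∀

  Z-· : ∀ c {v} → Z v → Z (c · v)
  Z-· c {v} (vanishes p) = vanishes (subst (+ n ∣_) (sym (ev-· k a b c v)) (∣n⇒∣m*n c p))

  infix 4 _~_
  _~_ : V4 → V4 → Set
  v ~ w = (Z v → Z w) × (Z w → Z v)

  addMultiple-~ : ∀ v c {b} → Z b → v ~ addMultiple v c b
  addMultiple-~ v (+ zero)     z = id , id
  addMultiple-~ v c@(+ suc _)  z = (λ p → Z-⊕ {v} p (Z-· c z)) , Z-⊕⁻ {v} (Z-· c z)
  addMultiple-~ v c@(-[1+ _ ]) z = (λ p → Z-⊕ {v} p (Z-· c z)) , Z-⊕⁻ {v} (Z-· c z)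

  reduceBy-~ : ∀ r v → Z (vector r) → v ~ reduceBy r v
  reduceBy-~ (row i d b) v z with coord i v
  ... | + zero       = id , id
  ... | x@(+ suc _)  = addMultiple-~ v (quot x d) z
  ... | x@(-[1+ _ ]) = addMultiple-~ v (quot x d) z

  normalise-~ : ∀ v → v ~ normalise v
  normalise-~ v with negative (coord (pivot v) v)
  ... | false = id , id
  ... | true  = Z-· (- + 1) , λ p → vanishes (subst (+ n ∣_)
    (trans (ev-· k a b (- + 1) ((- + 1) · v)) (trans (cong (λ z → - + 1 * z) (ev-· k a b (- + 1) v)) (lem (ev k a b v)))) (unZ (Z-· (- + 1) {(- + 1) · v} p)))
    where
    lem : ∀ x → - + 1 * (- + 1 * x) ≡ x
    lem = solve-∀

  ZRows : List Row → Set
  ZRows = All (Z ∘ vector)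

  -- Reduction adds multiples of vanishing vectors and at most changes the sign.
  reduce-~ : ∀ {bs} → ZRows bs → ∀ v → v ~ reduce bs v
  reduce-~ []                  v = normalise-~ v
  reduce-~ {r ∷ _} (z ∷ zs) v =
    let (f , g) = reduceBy-~ r v z
        (f′ , g′) = reduce-~ zs (reduceBy r v)
    in f′ ∘ f , g ∘ g′

  insert-Z : ∀ f v {bs} → Z v → ZRows bs → ZRows (insert f v bs)
  insert-Z zero    v z zs = zs
  insert-Z (suc f) v z [] = proj₁ (normalise-~ v) z ∷ []
  insert-Z (suc f) v {row i d b ∷ bs} z (y ∷ zs) with cmpℕ (pivot v) i
  ... | gt = proj₁ (normalise-~ v) z ∷ y ∷ zs
  ... | lt = y ∷ insert-Z f v z zs
  ... | eq with cmpℕ (pivot (reduceBy (row i d b) v)) i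
  ...   | eq = insert-Z f b y (proj₁ (normalise-~ _) (proj₁ (reduceBy-~ (row i d b) v y) z) ∷ zs)
  ...   | lt = y ∷ insert-Z f _ (proj₁ (reduceBy-~ (row i d b) v y) z) zs
  ...   | gt = y ∷ insert-Z f _ (proj₁ (reduceBy-~ (row i d b) v y) z) zs

  Apart : List V4 → Set
  Apart = All (¬_ ∘ Z)

  member-sound : ∀ v {ap} → Apart ap → member v ap ≡ true → ¬ Z v
  member-sound v {w ∷ ap} (z ∷ zs) e with ∨-true {same v w} e
  ... | inj₁ s = subst (¬_ ∘ Z) (sym (same-sound v w s)) z
  ... | inj₂ m = member-sound v zs m

  reduce-Apart : ∀ {bs} → ZRows bs → ∀ {ap} → Apart ap → Apart (map (reduce bs) ap)
  reduce-Apart zs []       = []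
  reduce-Apart zs (p ∷ ps) = (p ∘ proj₂ (reduce-~ zs _)) ∷ reduce-Apart zs ps

  χ-yes : ∀ {v} → Z v → χ v ≡ + 1
  χ-yes p = ind-yes (unZ p)

  χ-no : ∀ {v} → ¬ Z v → χ v ≡ + 0
  χ-no ¬p = ind-no (¬p ∘ vanishes)

  χ-~ : ∀ {v w} → v ~ w → χ v ≡ χ w
  χ-~ (f , g) = ind-cong (unZ ∘ f ∘ vanishes) (unZ ∘ g ∘ vanishes)

  value : Sums → ℕ → ℤ
  value (c , es) q = nth q c + evT χ q es

  module _ (q : ℕ) where

    addEntry-evT : ∀ v c es → evT χ q (addEntry v c es) ≡ nth q c * χ v + evT χ q es
    addEntry-evT v c []             = refl
    addEntry-evT v c ((w , d) ∷ es) with same v w in e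
    ... | false = trans (cong (λ z → nth q d * χ w + z) (addEntry-evT v c es)) (lem (nth q d * χ w) (nth q c * χ v) _)
      where
      lem : ∀ x y z → x + (y + z) ≡ y + (x + z)
      lem = solve-∀
    ... | true with refl ← same-sound v w e =
      trans (cong (λ z → z * χ v + evT χ q es) (nth-addᶜ q c d)) (lem (nth q c) (nth q d) (χ v) _)
      where
      lem : ∀ x y z s → (x + y) * z + s ≡ x * z + (y * z + s)
      lem = solve-∀

    absorb-value : ∀ {ap} → Apart ap → ∀ es s → value (absorb ap es s) q ≡ value s q + evT χ q es
    absorb-value zs []             s         = sym (ℤ.+-identityʳ _)
    absorb-value {ap} zs ((v , c) ∷ es) (c₀ , ds) with isZeroᵛ v in e
    ... | true = trans (absorb-value zs es (addᶜ c c₀ , ds))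
          (trans (cong (λ z → z + evT χ q ds + evT χ q es) (nth-addᶜ q c c₀))
          (trans (lem (nth q c) (nth q c₀) (evT χ q ds) (evT χ q es))
                 (cong (λ z → nth q c₀ + evT χ q ds + (nth q c * z + evT χ q es))
                   (sym (χ-yes {v} (subst Z (sym (isZeroᵛ-sound v e)) Z-0))))))
      where
      lem : ∀ x y z s → x + y + z + s ≡ y + z + (x * + 1 + s)
      lem = solve-∀
    ... | false with member v ap in m
    ...   | true = trans (absorb-value zs es (c₀ , ds))
            (trans (lem (value (c₀ , ds) q) (evT χ q es) (nth q c))
                   (cong (λ z → value (c₀ , ds) q + (nth q c * z + evT χ q es)) (sym (χ-no {v} (member-sound v zs m)))))
      where
      lem : ∀ x y z → x + y ≡ x + (z * + 0 + y)
      lem = solve-∀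
    ...   | false = trans (absorb-value zs es (c₀ , addEntry v c ds))
            (trans (cong (λ z → nth q c₀ + z + evT χ q es) (addEntry-evT v c ds))
                   (lem (nth q c₀) (nth q c * χ v) (evT χ q ds) (evT χ q es)))
      where
      lem : ∀ x y z s → x + (y + z) + s ≡ x + z + (y + s)
      lem = solve-∀

    prune-evT : ∀ es → evT χ q (prune es) ≡ evT χ q es
    prune-evT []             = refl
    prune-evT ((v , c) ∷ es) with isZeroᶜ c in e
    ... | false = cong (λ z → nth q c * χ v + z) (prune-evT es)
    ... | true  = trans (prune-evT es) (trans (sym (ℤ.+-identityˡ _))
                    (cong (λ z → z * χ v + evT χ q es) (sym (isZeroᶜ-sound q c e))))

    reduceT-evT : ∀ {bs} → ZRows bs → ∀ t → evT χ q (reduceT bs t) ≡ evT χ q t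
    reduceT-evT zs []            = refl
    reduceT-evT zs ((v , c) ∷ t) =
      cong₂ (λ y z → nth q c * y + z) (sym (χ-~ {v} (reduce-~ zs v))) (reduceT-evT zs t)

    load-value : ∀ {bs ap} → ZRows bs → Apart ap → ∀ t s → value (load bs ap t s) q ≡ value s q + evT χ q t
    load-value {bs} {ap} zs ps t s =
      trans (cong (λ z → nth q (proj₁ (absorb ap (reduceT bs t) s)) + z) (prune-evT (proj₂ (absorb ap (reduceT bs t) s))))
        (trans (absorb-value ps (reduceT bs t) s) (cong (λ z → value s q + z) (reduceT-evT zs t)))

    private
      neg≤ : ∀ x v → negPart x ℤ.≤ x * χ v
      neg≤ x v with Z? v
      ... | yes z rewrite χ-yes {v} z | ℤ.*-identityʳ x = h x
        where
        h : ∀ x → negPart x ℤ.≤ x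
        h (+ _)    = ℤ.+≤+ ℕ.z≤n
        h -[1+ _ ] = ℤ.≤-refl
      ... | no ¬z rewrite χ-no {v} ¬z | ℤ.*-zeroʳ x = h x
        where
        h : ∀ x → negPart x ℤ.≤ + 0
        h (+ _)    = ℤ.≤-refl
        h -[1+ _ ] = ℤ.-≤+

      ≤pos : ∀ x v → x * χ v ℤ.≤ posPart x
      ≤pos x v with Z? v
      ... | yes z rewrite χ-yes {v} z | ℤ.*-identityʳ x = h x
        where
        h : ∀ x → x ℤ.≤ posPart x
        h (+ _)    = ℤ.≤-refl
        h -[1+ _ ] = ℤ.-≤+
      ... | no ¬z rewrite χ-no {v} ¬z | ℤ.*-zeroʳ x = h x
        where
        h : ∀ x → + 0 ℤ.≤ posPart x
        h (+ _)    = ℤ.+≤+ ℕ.z≤n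
        h -[1+ _ ] = ℤ.≤-refl

      rearrange : ∀ x c e → x + (c + e) ≡ c + (x + e)
      rearrange = solve-∀

    bound-neg : ∀ c es → nth q (bound negPart (c , es)) ℤ.≤ value (c , es) q
    bound-neg c []             = ℤ.≤-reflexive (sym (ℤ.+-identityʳ _))
    bound-neg c ((v , d) ∷ es) = subst₂ ℤ._≤_
      (sym (trans (nth-addᶜ q (map negPart d) _) (cong (λ z → z + _) (nth-map negPart refl q d))))
      (rearrange (nth q d * χ v) (nth q c) (evT χ q es))
      (ℤ.+-mono-≤ (neg≤ (nth q d) v) (bound-neg c es))

    bound-pos : ∀ c es → value (c , es) q ℤ.≤ nth q (bound posPart (c , es))
    bound-pos c []             = ℤ.≤-reflexive (ℤ.+-identityʳ _)
    bound-pos c ((v , d) ∷ es) = subst₂ ℤ._≤_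
      (rearrange (nth q d * χ v) (nth q c) (evT χ q es))
      (sym (trans (nth-addᶜ q (map posPart d) _) (cong (λ z → z + _) (nth-map posPart refl q d))))
      (ℤ.+-mono-≤ (≤pos (nth q d) v) (bound-pos c es))

  module _ (Goal : Set) where

    Meets : Template → Set
    Meets (ys , ns) = All Z ys → Apart ns → Goal

    -- What the true parameters satisfy at every state on their path through the tree.
    record Inv (st : State) : Set where
      field
        inv-basis     : ZRows (State.basis st)
        inv-apart     : Apart (State.apart st)
        inv-sums      : ∀ q → value (State.sums st) q ≡ + 0
        inv-phases    : All (λ t → ∀ q → evT χ q t ≡ + 0) (State.phases st)
        inv-templates : All Meets (State.templates st)
    open Inv

    nonzero-Z : ∀ {vs} → All Z (nonzero vs) → All Z vs
    nonzero-Z {[]}     zs = []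
    nonzero-Z {v ∷ vs} zs with isZeroᵛ v in e
    ... | true  = subst Z (sym (isZeroᵛ-sound v e)) Z-0 ∷ nonzero-Z zs
    nonzero-Z {v ∷ vs} (z ∷ zs) | false = z ∷ nonzero-Z zs

    without-Apart : ∀ {ap} → Apart ap → ∀ {vs} → Apart (without ap vs) → Apart vs
    without-Apart         ps {[]}     zs = []
    without-Apart {ap} ps {v ∷ vs} zs with member v ap in e
    ... | true  = member-sound v ps e ∷ without-Apart ps zs
    without-Apart {ap} ps {v ∷ vs} (z ∷ zs) | false = z ∷ without-Apart ps zs

    unmap-Z : ∀ {bs} → ZRows bs → ∀ {vs} → All Z (map (reduce bs) vs) → All Z vs
    unmap-Z zs {[]}     []       = []
    unmap-Z zs {v ∷ vs} (p ∷ ps) = proj₂ (reduce-~ zs v) p ∷ unmap-Z zs ps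

    unmap-Apart : ∀ {bs} → ZRows bs → ∀ {vs} → Apart (map (reduce bs) vs) → Apart vs
    unmap-Apart zs {[]}     []       = []
    unmap-Apart zs {v ∷ vs} (p ∷ ps) = (p ∘ proj₁ (reduce-~ zs v)) ∷ unmap-Apart zs ps

    templatesYes-sound : ∀ {bs ap} → ZRows bs → Apart ap → ∀ {ts} → All Meets ts → All Meets (templatesYes bs ap ts)
    templatesYes-sound zs ps [] = []
    templatesYes-sound {bs} {ap} zs ps {(ys , ns) ∷ ts} (m ∷ ms)
      with any (λ v → member v ap) (nonzero (map (reduce bs) ys)) ∨ any isZeroᵛ (map (reduce bs) ns)
    ... | true  = templatesYes-sound zs ps ms
    ... | false = (λ y z → m (unmap-Z zs (nonzero-Z y)) (unmap-Apart zs (without-Apart ps z))) ∷ templatesYes-sound zs ps ms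

    templatesNo-sound : ∀ {v} → ¬ Z v → ∀ {ts} → All Meets ts → All Meets (templatesNo v ts)
    templatesNo-sound ¬z [] = []
    templatesNo-sound {v} ¬z {(ys , ns) ∷ ts} (m ∷ ms) with member v ys
    ... | true  = templatesNo-sound ¬z ms
    ... | false = (λ y z → m y (without-Apart (¬z ∷ []) z)) ∷ templatesNo-sound ¬z ms

    assume′-Inv : ∀ {bs st} → ZRows bs → Inv st → Inv (assume′ bs st)
    assume′-Inv {bs} {state _ ap (c , es) ps ts} zs inv = record
      { inv-basis     = zs
      ; inv-apart     = reduce-Apart zs (inv-apart inv)
      ; inv-sums      = λ q → trans (load-value q zs (reduce-Apart zs (inv-apart inv)) es (c , []))
                                (trans (cong (λ z → z + evT χ q es) (ℤ.+-identityʳ (nth q c))) (inv-sums inv q))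
      ; inv-phases    = inv-phases inv
      ; inv-templates = templatesYes-sound zs (reduce-Apart zs (inv-apart inv)) (inv-templates inv) }

    deny-Inv : ∀ {v st} → ¬ Z v → Inv st → Inv (deny v st)
    deny-Inv {v} {state _ ap (c , es) ps ts} ¬z inv = record
      { inv-basis     = inv-basis inv
      ; inv-apart     = ¬z ∷ inv-apart inv
      ; inv-sums      = λ q → trans (absorb-value q (¬z ∷ []) es (c , []))
                                (trans (cong (λ z → z + evT χ q es) (ℤ.+-identityʳ (nth q c))) (inv-sums inv q))
      ; inv-phases    = inv-phases inv
      ; inv-templates = templatesNo-sound ¬z (inv-templates inv) }

    refuted-sound : ∀ {st} → Inv st → refuted st ≡ true → ⊥
    refuted-sound {state _ ap (c , es) _ _} inv e with ∨-true {any isZeroᵛ ap} e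
    ... | inj₁ z = h (inv-apart inv) (any-true isZeroᵛ ap z)
      where
      h : ∀ {ap} → Apart ap → Any (λ v → isZeroᵛ v ≡ true) ap → ⊥
      h (p ∷ _)  (here z)  = p (subst Z (sym (isZeroᵛ-sound _ z)) Z-0)
      h (_ ∷ ps) (there m) = h ps m
    ... | inj₂ f with ∨-true {any positive (bound negPart (c , es))} f
    ...   | inj₁ p with positive-nth (bound negPart (c , es)) p
    ...     | q , l = ℤ.<-irrefl refl (ℤ.<-≤-trans l (subst (nth q (bound negPart (c , es)) ℤ.≤_) (inv-sums inv q) (bound-neg q c es)))
    refuted-sound {state _ ap (c , es) _ _} inv e | inj₂ f | inj₂ p with negative-nth (bound posPart (c , es)) p
    ...     | q , l = ℤ.<-irrefl refl (ℤ.≤-<-trans (subst (ℤ._≤ nth q (bound posPart (c , es))) (inv-sums inv q) (bound-pos q c es)) l)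

    accepted-sound : ∀ {ts} → All Meets ts → accepted ts ≡ true → Goal
    accepted-sound {([] , []) ∷ ts}           (m ∷ ms) e = m [] []
    accepted-sound {([] , _ ∷ _) ∷ ts}        (m ∷ ms) e = accepted-sound ms e
    accepted-sound {(_ ∷ _ , _) ∷ ts}         (m ∷ ms) e = accepted-sound ms e

    unmap-vector : ∀ {bs} → ZRows bs → All Z (map vector bs)
    unmap-vector []       = []
    unmap-vector (z ∷ zs) = z ∷ unmap-vector zs

    -- At each split `Z?` decides which branch the true parameters follow, and only that branch has
    -- to be examined. The path ends at an accepted template or at a leaf of `R`, since a refuted
    -- state contradicts the invariant.
    search-sound : ∀ f st {R} → Inv st → search f st ≡ just R → Goal ⊎ Any (All Z) R
    search-sound (suc f) st inv e with refuted st in r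
    ... | true = ⊥-elim (refuted-sound inv r)
    ... | false with accepted (State.templates st) in acc
    ...   | true = inj₁ (accepted-sound (inv-templates inv) acc)
    ...   | false with choose st
    search-sound (suc f) st inv e | false | false | just v with both-just (search f (assume v st)) (search f (deny v st)) e
    ... | xs , ys , e₁ , e₂ , refl with Z? v
    ...   | yes z = Sum.map₂ ++⁺ˡ (search-sound f (assume v st) (assume′-Inv (insert-Z fuel v z (inv-basis inv)) inv) e₁)
    ...   | no ¬z = Sum.map₂ (++⁺ʳ xs) (search-sound f (deny v st) (deny-Inv ¬z inv) e₂)
    search-sound (suc f) (state bs ap s [] ts) inv refl | false | false | nothing = inj₂ (here (unmap-vector (inv-basis inv)))
    search-sound (suc f) (state bs ap s (p ∷ ps) ts) inv e | false | false | nothing with exhausted ps bs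
    search-sound (suc f) (state bs ap s (p ∷ ps) ts) inv refl | false | false | nothing | true = inj₂ (here (unmap-vector (inv-basis inv)))
    ... | false with inv-phases inv
    ...   | h ∷ hs = search-sound f _ (record
            { inv-basis = inv-basis inv ; inv-apart = inv-apart inv
            ; inv-sums = λ q → trans (load-value q (inv-basis inv) (inv-apart inv) p ([] , [])) (trans (ℤ.+-identityˡ _) (h q))
            ; inv-phases = hs ; inv-templates = inv-templates inv }) e

-- Equations forced by edge-transitivity.

∑-swap : ∀ {A B : Set} (xs : List A) (ys : List B) (f : A → B → ℤ) → ∑ xs (λ x → ∑ ys (f x)) ≡ ∑ ys (λ y → ∑ xs (λ x → f x y))
∑-swap [] ys f = sym (h ys)
  where
  h : ∀ ys → ∑ ys (λ _ → + 0) ≡ + 0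
  h []       = refl
  h (_ ∷ ys) = trans (ℤ.+-identityˡ _) (h ys)
∑-swap {A} {B} (x ∷ xs) ys f = trans (cong (λ z → ∑ ys (f x) + z) (∑-swap xs ys f)) (h ys)
  where
  lem : ∀ a b c d → (a + b) + (c + d) ≡ (a + c) + (b + d)
  lem = solve-∀
  h : ∀ ys → ∑ ys (f x) + ∑ ys (λ y → ∑ xs (λ x → f x y)) ≡ ∑ ys (λ y → f x y + ∑ xs (λ x → f x y))
  h []       = refl
  h (y ∷ ys) = trans (lem (f x y) (∑ ys (f x)) _ _) (cong (λ z → f x y + ∑ xs (λ x → f x y) + z) (h ys))

∑-back : ∀ f → ∑ dirs (f ∘ back) ≡ ∑ dirs f
∑-back f = lem (f fwd) (f bwd) _
  where
  lem : ∀ x y z → y + (x + z) ≡ x + (y + z)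
  lem = solve-∀

module Symmetric (n : ℕ) .{{nz : NonZero n}} (k : ℤ) (s : Fin 4 → ℤ) where
  open Walks n k s

  private
    unit : ∀ {P Q : Set} (d : Dec P) (e : Dec Q) → (P → Q) → (Q → P) →
           (if does d then + 1 else + 0) ≡ (if does e then + 1 else + 0)
    unit (yes _) (yes _) f g = refl
    unit (no _)  (no _)  f g = refl
    unit (yes p) (no ¬q) f g = contradiction (f p) ¬q
    unit (no ¬p) (yes q) f g = contradiction (g q) ¬p

    flipᵈ : ∀ {x y} d → ⟦ lift x ▹ d ⟧ ≡ y → x ≡ ⟦ lift y ▹ back d ⟧
    flipᵈ {x} d refl = sym (trans (≋⇒≡ (≋-trans (move-≋ k s (back d) (lift-⟦⟧ (lift x ▹ d))) (move-back k s (lift x) d))) (⟦lift⟧ x))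

    back-back : ∀ d → back (back d) ≡ d
    back-back fwd     = refl
    back-back bwd     = refl
    back-back (spk _) = refl

    cnt-1 : ∀ x y → cnt 1 x y ≡ ∑ (nb y) (λ z → cnt 0 x z)
    cnt-1 x y = begin
      ∑ (nb x) (λ z → cnt 0 z y)                        ≡⟨ ∑-map (λ d → ⟦ lift x ▹ d ⟧) dirs (λ z → cnt 0 z y) ⟩
      ∑ dirs (λ d → cnt 0 ⟦ lift x ▹ d ⟧ y)             ≡⟨ ∑-cong dirs (λ d → unit (⟦ lift x ▹ d ⟧ ≟ᵛ y) (x ≟ᵛ ⟦ lift y ▹ back d ⟧)
        (flipᵈ d) (λ e → sym (subst (λ d′ → y ≡ ⟦ lift x ▹ d′ ⟧) (back-back d) (flipᵈ (back d) (sym e))))) ⟩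
      ∑ dirs (λ d → cnt 0 x ⟦ lift y ▹ back d ⟧)        ≡⟨ ∑-back (λ d → cnt 0 x ⟦ lift y ▹ d ⟧) ⟩
      ∑ dirs (λ d → cnt 0 x ⟦ lift y ▹ d ⟧)             ≡⟨ ∑-map (λ d → ⟦ lift y ▹ d ⟧) dirs (cnt 0 x) ⟨
      ∑ (nb y) (λ z → cnt 0 x z) ∎
      where open ≡-Reasoning

  cnt-last : ∀ L x y → cnt (suc L) x y ≡ ∑ (nb y) (λ z → cnt L x z)
  cnt-last zero    x y = cnt-1 x y
  cnt-last (suc L) x y = trans (∑-cong (nb x) (λ z → cnt-last L z y)) (∑-swap (nb x) (nb y) (cnt L))

  -- Needed because edge-transitivity may carry an edge to another one with the ends exchanged. A
  -- walk split at its first step is compared with the reversed walk split at its last step.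
  cnt-sym : ∀ L x y → cnt L x y ≡ cnt L y x
  cnt-sym zero    x y = unit (x ≟ᵛ y) (y ≟ᵛ x) sym sym
  cnt-sym (suc L) x y = trans (∑-cong (nb x) (λ z → cnt-sym L z y)) (sym (cnt-last L y x))

sameDir : Dir → Dir → Bool
sameDir fwd     fwd     = true
sameDir bwd     bwd     = true
sameDir (spk i) (spk j) = does (i Fin.≟ j)
sameDir _       _       = false

sameDir-sound : ∀ d d′ → sameDir d d′ ≡ true → d ≡ d′
sameDir-sound fwd     fwd     e = refl
sameDir-sound bwd     bwd     e = refl
sameDir-sound (spk i) (spk j) e with i Fin.≟ j
... | yes refl = refl

-- Two different directions from `x` to the same side differ, up to sign, by a vector of `distinct`.
-- The finitely many pairs are checked by evaluation, which yields 6-valency.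
separated : Side → Dir → Dir → Bool
separated x d d′ = not (does (turn x d ≟ˢ turn x d′)) ∨ sameDir d d′ ∨ member (normalise (shiftᵛ x d ⊖ shiftᵛ x d′)) distinct

all-∈ : ∀ {A : Set} (f : A → Bool) {xs x} → all f xs ≡ true → x ∈ xs → f x ≡ true
all-∈ f {y ∷ _} e (here refl) = proj₁ (∧-true {f y} e)
all-∈ f {y ∷ _} e (there m)   = all-∈ f (proj₂ (∧-true {f y} e)) m

separated-all : ∀ x d d′ → separated x d d′ ≡ true
separated-all U d d′ = all-∈ (separated U d) (all-∈ (λ d → all (separated U d) dirs) {dirs} refl (dir∈ d)) (dir∈ d′)
separated-all W d d′ = all-∈ (separated W d) (all-∈ (λ d → all (separated W d) dirs) {dirs} refl (dir∈ d)) (dir∈ d′)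

module Analysis (n : ℕ) .{{nz : NonZero n}} (k a b : ℤ) where
  open SymbolicWalks n k a b public
  open Sound n k a b public
  open Symmetric n k (spokes (+ 0) (+ 1) a b) public

  distinct⇒Simple : Apart distinct → Simple
  distinct⇒Simple ap x {d} {d′} (e ⨾ f) with ∨-true {not (does (turn x d ≟ˢ turn x d′))} (separated-all x d d′)
  ... | inj₁ p with turn x d ≟ˢ turn x d′
  ...   | no ¬e = contradiction e ¬e
  distinct⇒Simple ap x {d} {d′} (e ⨾ f) | inj₂ p with ∨-true {sameDir d d′} p
  ...   | inj₁ q = sameDir-sound d d′ q
  ...   | inj₂ q = ⊥-elim (member-sound (normalise (shiftᵛ x d ⊖ shiftᵛ x d′)) ap q (proj₁ (normalise-~ (shiftᵛ x d ⊖ shiftᵛ x d′)) (vanishes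
            (lin₁ (+ 1) f (trans (ev-⊖ k a b (shiftᵛ x d) (shiftᵛ x d′))
              (trans (cong₂ _-_ (ev-shift k a b x d) (ev-shift k a b x d′)) (lem (sh d) (sh d′))))))))
    where
    sh = shift k (spokes (+ 0) (+ 1) a b) x
    lem : ∀ y z → y - z ≡ + 1 * ((+ 0 + y) - (+ 0 + z))
    lem = solve-∀

  cnt-table : ∀ L x y (w : V4) i j → ev k a b w ≡ j - i →
    cnt L ⟦ x , i ⟧ ⟦ y , j ⟧ ≡ evT χ 0 (shiftT ((- + 1) · w) (select (walks y L) x))
  cnt-table L x y w i j e = trans (cnt-walks L x i y j)
    (trans (evT-cong 0 (select (walks y L) x) (λ v → cong (ind n)
        (sym (trans (ev-⊖ k a b v w) (cong (λ z → ev k a b v - z) e)))))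
      (sym (evT-shift χ 0 ((- + 1) · w) (select (walks y L) x))))

  module _ (simple : Simple) (et : EdgeTransitive Γ) where

    private
      base : Edge → Pt
      base e = source e , + 0

      tip : Edge → Pt
      tip e = base e ▹ along e

    cnt-edge : ∀ L e → cnt L ⟦ base e ⟧ ⟦ tip e ⟧ ≡ cnt L ⟦ base rimᵉ ⟧ ⟦ tip rimᵉ ⟧
    cnt-edge L e with et _ _ _ _ (edge k _ (base rimᵉ) fwd) (edge k _ (base e) (along e))
    ... | σ , inj₁ (p , q) = trans (sym (cong₂ (cnt L) p q)) (cnt-app simple σ L _ _)
    ... | σ , inj₂ (p , q) = trans (cnt-sym L _ _) (trans (sym (cong₂ (cnt L) p q)) (cnt-app simple σ L _ _))

    edgeTable-cnt : ∀ L ws → ws U ≡ walks U L → ws W ≡ walks W L → ∀ e →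
      evT χ 0 (edgeTable ws e) ≡ cnt L ⟦ base rimᵉ ⟧ ⟦ tip rimᵉ ⟧
    edgeTable-cnt L ws eu ew e = trans (cong (λ t → evT χ 0 (shiftT ((- + 1) · shiftᵛ (source e) (along e)) (select t (source e)))) (h (turn (source e) (along e))))
      (trans (sym (cnt-table L (source e) (turn (source e) (along e)) (shiftᵛ (source e) (along e)) (+ 0) _
        (trans (ev-shift k a b (source e) (along e)) (lem _)))) (cnt-edge L e))
      where
      h : ∀ y → ws y ≡ walks y L
      h U = eu
      h W = ew
      lem : ∀ z → z ≡ (+ 0 + z) - + 0
      lem = solve-∀

    -- All six edges have the same count `c`, which factors out, and the coefficients of each
    -- equation sum to zero.
    imbalance-0 : ∀ L ws → ws U ≡ walks U L → ws W ≡ walks W L → ∀ q → evT χ q (imbalance ws) ≡ + 0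
    imbalance-0 L ws eu ew q = begin
      evT χ q (imbalance ws)
        ≡⟨ evT-merges χ q (λ e → scaleT (columnᵉ e) (edgeTable ws e)) edges ⟩
      ∑ edges (λ e → evT χ q (scaleT (columnᵉ e) (edgeTable ws e)))
        ≡⟨ ∑-cong edges (λ e → trans (evT-scale χ q (columnᵉ e) (edgeTable ws e)) (cong (λ z → nth q (columnᵉ e) * z) (edgeTable-cnt L ws eu ew e))) ⟩
      ∑ edges (λ e → nth q (columnᵉ e) * c)
        ≡⟨ total edges c ⟩
      nth q (foldr addᶜ [] (map columnᵉ edges)) * c
        ≡⟨ cong (_* c) (isZeroᶜ-sound q (foldr addᶜ [] (map columnᵉ edges)) refl) ⟩
      + 0 * c
        ≡⟨ ℤ.*-zeroˡ c ⟩
      + 0 ∎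
      where
      open ≡-Reasoning
      c = cnt L ⟦ base rimᵉ ⟧ ⟦ tip rimᵉ ⟧
      total : ∀ es c → ∑ es (λ e → nth q (columnᵉ e) * c) ≡ nth q (foldr addᶜ [] (map columnᵉ es)) * c
      total []       c = refl
      total (e ∷ es) c = trans (cong (λ z → nth q (columnᵉ e) * c + z) (total es c))
        (trans (sym (ℤ.*-distribʳ-+ c (nth q (columnᵉ e)) _)) (cong (_* c) (sym (nth-addᶜ q (columnᵉ e) _))))

    imbalances-0 : ∀ m L {u w} → u ≡ walks U L → w ≡ walks W L → All (λ t → ∀ q → evT χ q t ≡ + 0) (imbalances m u w)
    imbalances-0 zero    L eu ew = []
    imbalances-0 (suc m) L eu ew = imbalance-0 L (ends _ _) eu ew ∷ imbalances-0 m (suc L) (cong step eu) (cong step ew)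

    module _ (Goal : Set) where

      search-initial : ∀ f rels ap L ts {R} → All Z rels → Apart ap → All (Meets Goal) ts →
        search f (initial rels ap L ts) ≡ just R → Goal ⊎ Any (All Z) R
      search-initial f rels ap L ts zs ps ms = search-sound Goal f _ (assume′-Inv Goal {st = state [] ap ([] , []) (imbalances L (step (step (start U))) (step (step (start W)))) ts} (rows zs) (record
        { inv-basis = [] ; inv-apart = ps ; inv-sums = λ { zero → refl ; (suc _) → refl }
        ; inv-phases = imbalances-0 L 2 refl refl ; inv-templates = ms }))
        where
        rows : ∀ {rels} → All Z rels → ZRows (foldr (insert fuel) [] rels)
        rows []       = []
        rows (z ∷ zs) = insert-Z fuel _ z (rows zs)

-- Affine isomorphisms and the inspection of small orders.

-- false and true stand for the signs + and -.
sg : Bool → ℤ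
sg false = + 1
sg true  = - + 1

flip : Bool → Dir → Dir
flip false d       = d
flip true  fwd     = bwd
flip true  bwd     = fwd
flip true  (spk j) = spk j

_xor_ : Bool → Bool → Bool
false xor y = y
true  xor y = not y

module Affinity (n : ℕ) .{{nz : NonZero n}} where
  open Residue n

  -- The map sends u_i to u_(±i) and v_i to v_(±i + t), with sign `e`. The sign `h` is independent
  -- of `e`, as hub edges have no orientation. Spokes are matched in both directions, which gives
  -- adjacency for the map and for its inverse.
  record Affine (k : ℤ) (s : Fin 4 → ℤ) (k′ : ℤ) (s′ : Fin 4 → ℤ) : Set where
    field
      e h  : Bool
      t    : ℤ
      π π⁻ : Fin 4 → Fin 4
      k-eq : + n ∣ k′ - sg h * k
      π-eq : ∀ j → + n ∣ s′ (π j) - (sg e * s j + t)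
      π⁻-eq : ∀ j → + n ∣ s′ j - (sg e * s (π⁻ j) + t)

  affine : Bool → ℤ → Pt → Pt
  affine e t (U , i) = U , sg e * i
  affine e t (W , i) = W , sg e * i + t

  affine-≋ : ∀ e t {p q} → p ≋ q → affine e t p ≋ affine e t q
  affine-≋ e t {U , i} {U , j} (refl ⨾ d) = refl ⨾ lin₁ (sg e) d (lem (sg e) i j)
    where
    lem : ∀ e i j → e * i - e * j ≡ e * (i - j)
    lem = solve-∀
  affine-≋ e t {W , i} {W , j} (refl ⨾ d) = refl ⨾ lin₁ (sg e) d (lem (sg e) t i j)
    where
    lem : ∀ e t i j → (e * i + t) - (e * j + t) ≡ e * (i - j)
    lem = solve-∀

  affine-inv : ∀ e t p → affine e (- (sg e * t)) (affine e t p) ≋ p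
  affine-inv false t (U , i) = refl ⨾ ≡⇒∣ (lem i)
    where
    lem : ∀ i → + 1 * (+ 1 * i) ≡ i
    lem = solve-∀
  affine-inv true t (U , i) = refl ⨾ ≡⇒∣ (lem i)
    where
    lem : ∀ i → - + 1 * (- + 1 * i) ≡ i
    lem = solve-∀
  affine-inv false t (W , i) = refl ⨾ ≡⇒∣ (lem i t)
    where
    lem : ∀ i t → + 1 * (+ 1 * i + t) + - (+ 1 * t) ≡ i
    lem = solve-∀
  affine-inv true t (W , i) = refl ⨾ ≡⇒∣ (lem i t)
    where
    lem : ∀ i t → - + 1 * (- + 1 * i + t) + - (- + 1 * t) ≡ i
    lem = solve-∀

  affine-inv′ : ∀ e t p → affine e t (affine e (- (sg e * t)) p) ≋ p
  affine-inv′ e t p = subst (λ z → affine e z (affine e (- (sg e * t)) p) ≋ p) (lem e) (affine-inv e (- (sg e * t)) p)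
    where
    lem⁺ : ∀ t → - (+ 1 * - (+ 1 * t)) ≡ t
    lem⁺ = solve-∀
    lem⁻ : ∀ t → - (- + 1 * - (- + 1 * t)) ≡ t
    lem⁻ = solve-∀
    lem : ∀ e → - (sg e * - (sg e * t)) ≡ t
    lem false = lem⁺ t
    lem true  = lem⁻ t

  module _ {k k′ : ℤ} {s s′ : Fin 4 → ℤ} where

    affine-adj : (A : Affine k s k′ s′) → ∀ p d → Adj k′ s′ (affine (Affine.e A) (Affine.t A) p) (affine (Affine.e A) (Affine.t A) (move k s p d))
    affine-adj A p d = go p d
      where
      open Affine A
      u⁺ : ∀ i → + 1 * (i + + 1) ≡ + 1 * i + + 1
      u⁺ = solve-∀
      u⁻ : ∀ i → - + 1 * (i + + 1) ≡ - + 1 * i + - + 1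
      u⁻ = solve-∀
      b⁺ : ∀ i → + 1 * (i + - + 1) ≡ + 1 * i + - + 1
      b⁺ = solve-∀
      b⁻ : ∀ i → - + 1 * (i + - + 1) ≡ - + 1 * i + + 1
      b⁻ = solve-∀
      us : ∀ e i s t s′ → (e * (i + s) + t) - (e * i + s′) ≡ - + 1 * (s′ - (e * s + t))
      us = solve-∀
      ws : ∀ e i s t s′ → e * (i + - s) - (e * i + t + - s′) ≡ + 1 * (s′ - (e * s + t))
      ws = solve-∀
      wf⁺⁺ : ∀ i t k k′ → (+ 1 * (i + k) + t) - (+ 1 * i + t + k′) ≡ - + 1 * (k′ - + 1 * k)
      wf⁺⁺ = solve-∀
      wf⁺⁻ : ∀ i t k k′ → (+ 1 * (i + k) + t) - (+ 1 * i + t + - k′) ≡ + 1 * (k′ - - + 1 * k)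
      wf⁺⁻ = solve-∀
      wf⁻⁺ : ∀ i t k k′ → (- + 1 * (i + k) + t) - (- + 1 * i + t + - k′) ≡ + 1 * (k′ - + 1 * k)
      wf⁻⁺ = solve-∀
      wf⁻⁻ : ∀ i t k k′ → (- + 1 * (i + k) + t) - (- + 1 * i + t + k′) ≡ - + 1 * (k′ - - + 1 * k)
      wf⁻⁻ = solve-∀
      wb⁺⁺ : ∀ i t k k′ → (+ 1 * (i + - k) + t) - (+ 1 * i + t + - k′) ≡ + 1 * (k′ - + 1 * k)
      wb⁺⁺ = solve-∀
      wb⁺⁻ : ∀ i t k k′ → (+ 1 * (i + - k) + t) - (+ 1 * i + t + k′) ≡ - + 1 * (k′ - - + 1 * k)
      wb⁺⁻ = solve-∀
      wb⁻⁺ : ∀ i t k k′ → (- + 1 * (i + - k) + t) - (- + 1 * i + t + k′) ≡ - + 1 * (k′ - + 1 * k)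
      wb⁻⁺ = solve-∀
      wb⁻⁻ : ∀ i t k k′ → (- + 1 * (i + - k) + t) - (- + 1 * i + t + - k′) ≡ + 1 * (k′ - - + 1 * k)
      wb⁻⁻ = solve-∀
      rims : ∀ e i → Adj k′ s′ (U , sg e * i) (U , sg e * (i + + 1)) × Adj k′ s′ (U , sg e * i) (U , sg e * (i + - + 1))
      rims false i = via fwd (refl ⨾ ≡⇒∣ (u⁺ i)) , via bwd (refl ⨾ ≡⇒∣ (b⁺ i))
      rims true  i = via bwd (refl ⨾ ≡⇒∣ (u⁻ i)) , via fwd (refl ⨾ ≡⇒∣ (b⁻ i))
      hubs : ∀ e h i → + n ∣ k′ - sg h * k →
        Adj k′ s′ (W , sg e * i + t) (W , sg e * (i + k) + t) × Adj k′ s′ (W , sg e * i + t) (W , sg e * (i + - k) + t)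
      hubs false false i q = via fwd (refl ⨾ lin₁ (- + 1) q (wf⁺⁺ i t k k′)) , via bwd (refl ⨾ lin₁ (+ 1) q (wb⁺⁺ i t k k′))
      hubs false true  i q = via bwd (refl ⨾ lin₁ (+ 1) q (wf⁺⁻ i t k k′)) , via fwd (refl ⨾ lin₁ (- + 1) q (wb⁺⁻ i t k k′))
      hubs true  false i q = via bwd (refl ⨾ lin₁ (+ 1) q (wf⁻⁺ i t k k′)) , via fwd (refl ⨾ lin₁ (- + 1) q (wb⁻⁺ i t k k′))
      hubs true  true  i q = via fwd (refl ⨾ lin₁ (- + 1) q (wf⁻⁻ i t k k′)) , via bwd (refl ⨾ lin₁ (+ 1) q (wb⁻⁻ i t k k′))
      go : ∀ p d → Adj k′ s′ (affine e t p) (affine e t (move k s p d))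
      go (U , i) fwd     = proj₁ (rims e i)
      go (U , i) bwd     = proj₂ (rims e i)
      go (U , i) (spk j) = via (spk (π j)) (refl ⨾ lin₁ (- + 1) (π-eq j) (us (sg e) i (s j) t (s′ (π j))))
      go (W , i) fwd     = proj₁ (hubs e h i k-eq)
      go (W , i) bwd     = proj₂ (hubs e h i k-eq)
      go (W , i) (spk j) = via (spk (π j)) (refl ⨾ lin₁ (+ 1) (π-eq j) (ws (sg e) i (s j) t (s′ (π j))))

    affine-sym : Affine k s k′ s′ → Affine k′ s′ k s
    affine-sym A = record
      { e = e ; h = h ; t = - (sg e * t) ; π = π⁻ ; π⁻ = π
      ; k-eq = hk h k-eq ; π-eq = λ j → inv e {s (π⁻ j)} {s′ j} (π⁻-eq j) ; π⁻-eq = λ j → inv e {s j} {s′ (π j)} (π-eq j) }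
      where
      open Affine A
      k⁺ : ∀ k k′ → k - + 1 * k′ ≡ - + 1 * (k′ - + 1 * k)
      k⁺ = solve-∀
      k⁻ : ∀ k k′ → k - - + 1 * k′ ≡ + 1 * (k′ - - + 1 * k)
      k⁻ = solve-∀
      hk : ∀ h → + n ∣ k′ - sg h * k → + n ∣ k - sg h * k′
      hk false q = lin₁ (- + 1) q (k⁺ k k′)
      hk true  q = lin₁ (+ 1) q (k⁻ k k′)
      i⁺ : ∀ x y t → x - (+ 1 * y + - (+ 1 * t)) ≡ - + 1 * (y - (+ 1 * x + t))
      i⁺ = solve-∀
      i⁻ : ∀ x y t → x - (- + 1 * y + - (- + 1 * t)) ≡ + 1 * (y - (- + 1 * x + t))
      i⁻ = solve-∀
      inv : ∀ e {x y} → + n ∣ y - (sg e * x + t) → + n ∣ x - (sg e * y + - (sg e * t))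
      inv false {x} {y} q = lin₁ (- + 1) q (i⁺ x y t)
      inv true  {x} {y} q = lin₁ (+ 1) q (i⁻ x y t)

  affineIso : ∀ {k k′ s s′} → Affine k s k′ s′ → Bicirc k s ≅ Bicirc k′ s′
  affineIso A = mkIso (affine e t) (affine e (- (sg e * t))) (affine-≋ e t) (affine-≋ e (- (sg e * t)))
      (affine-inv′ e t) (affine-inv e t) (affine-adj A) (affine-adj (affine-sym A))
    where open Affine A

divᵇ : ℕ → ℤ → Bool
divᵇ n z = does (+ n ∣? z)

divᵇ-true : ∀ {n z} → divᵇ n z ≡ true → + n ∣ z
divᵇ-true {n} {z} = true-does (+ n ∣? z)
  where
  true-does : ∀ {P : Set} (d : Dec P) → does d ≡ true → P
  true-does (yes p) _ = p

true-divᵇ : ∀ {n z} → + n ∣ z → divᵇ n z ≡ true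
true-divᵇ {n} {z} = dec-true (+ n ∣? z)

false-divᵇ : ∀ {n z} → ¬ (+ n ∣ z) → divᵇ n z ≡ false
false-divᵇ {n} {z} = dec-false (+ n ∣? z)

signs : List Bool
signs = false ∷ true ∷ []

fins : List (Fin 4)
fins = i₀ ∷ i₁ ∷ i₂ ∷ i₃ ∷ []

fin∈ : ∀ j → j ∈ fins
fin∈ i₀ = here refl
fin∈ i₁ = there (here refl)
fin∈ i₂ = there (there (here refl))
fin∈ i₃ = there (there (there (here refl)))

module _ (n : ℕ) .{{nz : NonZero n}} (k : ℤ) (s : Fin 4 → ℤ) (k′ : ℤ) (s′ : Fin 4 → ℤ) where
  open Affinity n

  isAffine : Bool → Bool → ℕ → Bool
  isAffine e h t = divᵇ n (k′ - sg h * k)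
    ∧ all (λ j → any (λ j′ → divᵇ n (s′ j′ - (sg e * s j + + t))) fins) fins
    ∧ all (λ j → any (λ j′ → divᵇ n (s′ j - (sg e * s j′ + + t))) fins) fins

  isAffine-sound : ∀ e h t → isAffine e h t ≡ true → Affine k s k′ s′
  isAffine-sound e h t p with ∧-true {divᵇ n (k′ - sg h * k)} p
  ... | p₁ , q with ∧-true {all (λ j → any (λ j′ → divᵇ n (s′ j′ - (sg e * s j + + t))) fins) fins} q
  ... | p₂ , p₃ = record
    { e = e ; h = h ; t = + t
    ; π = λ j → proj₁ (there⁺ j) ; π⁻ = λ j → proj₁ (back⁺ j)
    ; k-eq = divᵇ-true p₁
    ; π-eq = λ j → divᵇ-true (proj₂ (there⁺ j)) ; π⁻-eq = λ j → divᵇ-true (proj₂ (back⁺ j)) }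
    where
    there⁺ : ∀ j → ∃[ j′ ] divᵇ n (s′ j′ - (sg e * s j + + t)) ≡ true
    there⁺ j = satisfied (any-true _ fins (all-∈ (λ j → any (λ j′ → divᵇ n (s′ j′ - (sg e * s j + + t))) fins) {fins} p₂ (fin∈ j)))
    back⁺ : ∀ j → ∃[ j′ ] divᵇ n (s′ j - (sg e * s j′ + + t)) ≡ true
    back⁺ j = satisfied (any-true _ fins (all-∈ (λ j → any (λ j′ → divᵇ n (s′ j - (sg e * s j′ + + t))) fins) {fins} p₃ (fin∈ j)))

  affineSearch : Bool
  affineSearch = any (λ e → any (λ h → any (λ t → isAffine e h t) (upTo n)) signs) signs

  affineSearch-sound : affineSearch ≡ true → Residue.Bicirc n k s ≅ Residue.Bicirc n k′ s′
  affineSearch-sound p with satisfied (any-true _ signs p)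
  ... | e , p₁ with satisfied (any-true _ signs p₁)
  ... | h , p₂ with satisfied (any-true _ (upTo n) p₂)
  ... | t , p₃ = affineIso (isAffine-sound e h t p₃)

all³ : ∀ n (f : ℕ → ℕ → ℕ → Bool) → all (λ k → all (λ a → all (f k a) (upTo n)) (upTo n)) (upTo n) ≡ true →
       ∀ {k a b} → k ℕ.< n → a ℕ.< n → b ℕ.< n → f k a b ≡ true
all³ n f e {k} {a} k< a< b< = all-∈ (f k a) (all-∈ (λ a → all (f k a) (upTo n))
  (all-∈ (λ k → all (λ a → all (f k a) (upTo n)) (upTo n)) e (∈-upTo⁺ k<)) (∈-upTo⁺ a<)) (∈-upTo⁺ b<)

record Target : Set where
  constructor target
  field
    n₋₁ a b c k : ℕ

nestOf : Target → Graph
nestOf (target n₋₁ a b c k) = Nest (suc n₋₁) a b c k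

-- The six graphs of (i), followed by the member m = 1, n = 6 of (ii), in which the inspection of
-- small orders may end as well.
targets : List Target
targets = target 3 1 2 3 1 ∷ target 4 1 2 3 2 ∷ target 7 1 2 5 3 ∷ target 7 1 3 4 3
        ∷ target 9 1 3 4 3 ∷ target 11 1 3 10 5 ∷ target 5 1 3 4 1 ∷ []

matches : ℕ → ℤ → (Fin 4 → ℤ) → Target → Bool
matches n₋₁ k s (target m₋₁ a b c k′) =
  (n₋₁ ℕ.≡ᵇ m₋₁) ∧ affineSearch (suc n₋₁) k s (+ k′) (spokes (+ 0) (+ a) (+ b) (+ c))

matches-sound : ∀ n₋₁ k s t → matches n₋₁ k s t ≡ true → n₋₁ ≡ Target.n₋₁ t × (Residue.Bicirc (suc n₋₁) k s ≅ nestOf t)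
matches-sound n₋₁ k s (target m₋₁ a b c k′) e with ∧-true {n₋₁ ℕ.≡ᵇ m₋₁} e
... | e₁ , e₂ with refl ← ℕ.≡ᵇ⇒≡ n₋₁ m₋₁ (subst T (sym e₁) _) =
  refl , ≅-trans (affineSearch-sound (suc n₋₁) k s (+ k′) _ e₂) (≅-sym (nest≅bicirc n₋₁ a b c k′))

order : V4 → ℕ
order (vec (+ m) (+ zero) (+ zero) (+ zero)) = m
order _                                      = 0

inspect₁ : List V4 → ℕ → List V4 → ℕ → ℕ → ℕ → Bool
inspect₁ ap n₋₁ bs k a b =
  not (all (λ v → divᵇ (suc n₋₁) (ev (+ k) (+ a) (+ b) v)) bs) ∨
  any (λ v → divᵇ (suc n₋₁) (ev (+ k) (+ a) (+ b) v)) ap ∨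
  any (matches n₋₁ (+ k) (spokes (+ 0) (+ 1) (+ a) (+ b))) targets

inspect₂ : List V4 → List V4 → ℕ → Bool
inspect₂ ap bs n₋₁ =
  not (all (λ v → divᵇ (suc n₋₁) (+ order v)) bs) ∨
  all (λ k → all (λ a → all (λ b → inspect₁ ap n₋₁ bs k a b) (upTo (suc n₋₁))) (upTo (suc n₋₁))) (upTo (suc n₋₁))

smallOrder : V4 → Bool
smallOrder v = (0 ℕ.<ᵇ order v) ∧ (order v ℕ.<ᵇ 13)

-- A relation m = 0 with m from 1 to 12 among `bs` forces n to divide m. Since n is at least 4, the
-- values 3 to 11 of n - 1 remain, whence the offset 3 and the nine checks.
boundedBy : (ℕ → Bool) → List V4 → Bool
boundedBy f bs = any smallOrder bs ∧ all (λ m → f (3 ℕ.+ m)) (upTo 9)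

boundedBy-sound : ∀ f bs → boundedBy f bs ≡ true → Any (λ v → smallOrder v ≡ true) bs × (∀ {m} → m ℕ.< 9 → f (3 ℕ.+ m) ≡ true)
boundedBy-sound f bs e with ∧-true {any smallOrder bs} e
... | p , q = any-true smallOrder bs p , λ m< → all-∈ (λ m → f (3 ℕ.+ m)) q (∈-upTo⁺ m<)

settledBy : (List V4 → Bool) → Maybe (List (List V4)) → Bool
settledBy f nothing  = false
settledBy f (just R) = all f R

settledBy-sound : ∀ {P : List V4 → Set} {Goal : Set} f R → settledBy f R ≡ true →
  (∀ {Bs} → R ≡ just Bs → Goal ⊎ Any P Bs) → Goal ⊎ (∃[ bs ] P bs × f bs ≡ true)
settledBy-sound f (just Bs) e h with h refl
... | inj₁ g = inj₁ g
... | inj₂ m with find m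
...   | bs , bs∈ , p = inj₂ (bs , p , all-∈ f {Bs} e bs∈)

settled : List V4 → Maybe (List (List V4)) → Bool
settled ap = settledBy (λ bs → boundedBy (inspect₂ ap bs) bs)

module _ (n₋₁ k a b : ℕ) (4≤n : 4 ℕ.≤ suc n₋₁) (k< : k ℕ.< suc n₋₁) (a< : a ℕ.< suc n₋₁) (b< : b ℕ.< suc n₋₁) where
  private
    n = suc n₋₁
    Γ′ = Residue.Bicirc n (+ k) (spokes (+ 0) (+ 1) (+ a) (+ b))
  open Sound n (+ k) (+ a) (+ b)

  Listed : Set
  Listed = ∃[ t ] t ∈ targets × n₋₁ ≡ Target.n₋₁ t × (Γ′ ≅ nestOf t)

  private
    order-Z : ∀ v → Z v → + n ∣ + order v
    order-Z (vec (+ m) (+ zero) (+ zero) (+ zero)) (vanishes z) =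
      subst (+ n ∣_) (trans (ℤ.+-identityʳ _) (trans (ℤ.+-identityʳ _) (ℤ.+-identityʳ _))) z
    order-Z (vec (+ m) (+ zero) (+ zero) (+ suc _)) z = divides (+ 0) refl
    order-Z (vec (+ m) (+ zero) (+ zero) -[1+ _ ]) z = divides (+ 0) refl
    order-Z (vec (+ m) (+ zero) (+ suc _) _) z = divides (+ 0) refl
    order-Z (vec (+ m) (+ zero) -[1+ _ ] _) z = divides (+ 0) refl
    order-Z (vec (+ m) (+ suc _) _ _) z = divides (+ 0) refl
    order-Z (vec (+ m) -[1+ _ ] _ _) z = divides (+ 0) refl
    order-Z (vec -[1+ _ ] _ _ _) z = divides (+ 0) refl

    all-true : ∀ {A : Set} {P : A → Set} (f : A → Bool) → (∀ {x} → P x → f x ≡ true) → ∀ {xs} → All P xs → all f xs ≡ true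
    all-true f h []       = refl
    all-true f h (p ∷ ps) rewrite h p = all-true f h ps

    any-Apart : ∀ {vs} → Apart vs → any (λ v → divᵇ n (ev (+ k) (+ a) (+ b) v)) vs ≡ false
    any-Apart []       = refl
    any-Apart {v ∷ _} (p ∷ ps) rewrite false-divᵇ {n} {ev (+ k) (+ a) (+ b) v} (p ∘ vanishes) = any-Apart ps

    ∨-right : ∀ {x y} → x ≡ false → x ∨ y ≡ true → y ≡ true
    ∨-right refl e = e

  inspect₁-sound : ∀ ap bs → All Z bs → Apart ap → inspect₁ ap n₋₁ bs k a b ≡ true → Listed
  inspect₁-sound ap bs zs ps e = listed (find (any-true (matches n₋₁ (+ k) (spokes (+ 0) (+ 1) (+ a) (+ b))) targets
      (∨-right (any-Apart ps) (∨-right (cong not (all-true (λ v → divᵇ n (ev (+ k) (+ a) (+ b) v)) (true-divᵇ ∘ unZ) zs)) e))))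
    where
    listed : (∃[ t ] t ∈ targets × matches n₋₁ (+ k) (spokes (+ 0) (+ 1) (+ a) (+ b)) t ≡ true) → Listed
    listed (t , m , q) = t , m , matches-sound n₋₁ (+ k) (spokes (+ 0) (+ 1) (+ a) (+ b)) t q

  inspect₂-sound : ∀ ap bs → All Z bs → Apart ap → inspect₂ ap bs n₋₁ ≡ true → Listed
  inspect₂-sound ap bs zs ps e = inspect₁-sound ap bs zs ps (all³ n (inspect₁ ap n₋₁ bs)
    (∨-right (cong not (all-true (λ v → divᵇ n (+ order v)) (λ {v} z → true-divᵇ (order-Z v z)) zs)) e) k< a< b<)

  bounded-sound : ∀ ap bs → All Z bs → Apart ap → boundedBy (inspect₂ ap bs) bs ≡ true → Listed
  bounded-sound ap bs zs ps e = inspect₂-sound ap bs zs ps (at-n (inspect₂ ap bs) (proj₂ parts))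
    where
    parts = boundedBy-sound (inspect₂ ap bs) bs e
    n≤12 : (∃[ v ] v ∈ bs × smallOrder v ≡ true) → n ℕ.≤ 12
    n≤12 (v , m , r) = ℕ.≤-trans (n≤ (order v) (ℕ.<ᵇ⇒< 0 (order v) (subst T (sym (proj₁ (∧-true {0 ℕ.<ᵇ order v} r))) _)) (order-Z v (All.lookup zs m)))
        (ℕ.s≤s⁻¹ (ℕ.<ᵇ⇒< (order v) 13 (subst T (sym (proj₂ (∧-true {0 ℕ.<ᵇ order v} r))) _)))
      where
      n≤ : ∀ o → 0 ℕ.< o → + n ∣ + o → n ℕ.≤ o
      n≤ (suc o) _ d = ℕ∣.∣⇒≤ (∣⇒∣ᵤ d)
    n-3<9 : n₋₁ ℕ.∸ 3 ℕ.< 9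
    n-3<9 = subst (ℕ._≤ 9) (ℕ.+-∸-assoc 1 (ℕ.s≤s⁻¹ 4≤n)) (ℕ.∸-monoˡ-≤ 3 (n≤12 (find (proj₁ parts))))
    at-n : ∀ f → (∀ {m} → m ℕ.< 9 → f (3 ℕ.+ m) ≡ true) → f n₋₁ ≡ true
    at-n f h = subst (λ i → f i ≡ true) (ℕ.m+[n∸m]≡n (ℕ.s≤s⁻¹ 4≤n)) (h n-3<9)

  settled-sound : ∀ {Goal} ap R → settled ap R ≡ true → Apart ap →
    (∀ {Bs} → R ≡ just Bs → Goal ⊎ Any (All Z) Bs) → Goal ⊎ Listed
  settled-sound ap R e ps h = Sum.map₂ (λ { (bs , zs , f) → bounded-sound ap bs zs ps f })
    (settledBy-sound {All Z} (λ bs → boundedBy (inspect₂ ap bs) bs) R e h)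

-- Six directions at a vertex and the rigidity of automorphisms.

-- The six directions at a vertex, numbered in cyclic order around it:
-- r, r + g, g, -r, -r - g, -g for the generators r and g of the triangular lattice.
pattern d₀ = zero
pattern d₁ = suc zero
pattern d₂ = suc (suc zero)
pattern d₃ = suc (suc (suc zero))
pattern d₄ = suc (suc (suc (suc zero)))
pattern d₅ = suc (suc (suc (suc (suc zero))))

-- From u_i, the step g leads to v_i and r + g to v_(i + 1); from v_i, they lead to u_(i - b) and
-- u_(i - a). At both sides r followed by g is r + g, because b = a + k; in the other order this
-- holds only for k = 1.
hex : Side → Fin 6 → Dir
hex U d₀ = fwd
hex U d₁ = spk i₁
hex U d₂ = spk i₀
hex U d₃ = bwd
hex U d₄ = spk i₂
hex U d₅ = spk i₃
hex W d₀ = fwd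
hex W d₁ = spk i₂
hex W d₂ = spk i₃
hex W d₃ = bwd
hex W d₄ = spk i₁
hex W d₅ = spk i₀

sixth : List (Fin 6)
sixth = d₀ ∷ d₁ ∷ d₂ ∷ d₃ ∷ d₄ ∷ d₅ ∷ []

sixth∈ : ∀ d → d ∈ sixth
sixth∈ d₀ = here refl
sixth∈ d₁ = there (here refl)
sixth∈ d₂ = there (there (here refl))
sixth∈ d₃ = there (there (there (here refl)))
sixth∈ d₄ = there (there (there (there (here refl))))
sixth∈ d₅ = there (there (there (there (there (here refl)))))

pairTable : (Side → Table × Table) → Side → Fin 6 → Fin 6 → Table
pairTable ws x d d′ =
  shiftT ((- + 1) · (shiftᵛ x (hex x d′) ⊖ shiftᵛ x (hex x d))) (select (ws (turn x (hex x d′))) (turn x (hex x d)))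

walks₃ : Side → Table × Table
walks₃ = ends (walks U 3) (walks W 3)

addNew : List Row → Table → List V4 → List V4
addNew bs []            acc = acc
addNew bs ((v , _) ∷ t) acc = keepNew (reduce bs v) (addNew bs t acc)
  where
  keepNew : V4 → List V4 → List V4
  keepNew v acc = if isZeroᵛ v ∨ member v acc then acc else v ∷ acc

rowsOf : List V4 → List Row
rowsOf = foldr (insert fuel) []

-- The vectors that must not vanish for the walks of length 3 between neighbours to be those of the universal case.
coincidences : (Side → Table × Table) → List Row → List V4
coincidences ws bs = foldr (λ x acc → foldr (λ d acc → foldr (λ d′ acc → addNew bs (pairTable ws x d d′) acc) acc sixth) acc sixth) [] (U ∷ W ∷ [])

relsA relsC apartC : List V4
relsA  = vec (- + 1) (+ 1) (+ 0) (+ 0) ∷ vec (+ 0) (- + 1) (- + 1) (+ 1) ∷ []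
relsC  = vec (- + 2) (+ 2) (+ 0) (+ 0) ∷ vec (+ 0) (- + 1) (- + 1) (+ 1) ∷ []
apartC = vec (- + 1) (+ 1) (+ 0) (+ 0) ∷ distinct

genericA genericC : List V4
genericA = coincidences walks₃ (rowsOf relsA)
genericC = coincidences walks₃ (rowsOf relsC)

accumulate : Bool → Bool → ℤ → Maybe ℤ → Maybe ℤ
accumulate true  _    c (just z) = just (c + z)
accumulate false true c (just z) = just z
accumulate _     _    c _        = nothing

-- A count is known only if each of its vectors is settled: zero modulo the relations, or reduced to
-- a listed nonzero vector.
known : List Row → List V4 → Table → Maybe ℤ
known bs ap []            = just (+ 0)
known bs ap ((v , c) ∷ t) = accumulate (isZeroᵛ (reduce bs v)) (member (reduce bs v) ap) (nth 0 c) (known bs ap t)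

Matrix : Set
Matrix = Fin 6 → Fin 6 → ℤ

diff : Fin 6 → Fin 6 → ℕ
diff d d′ = (toℕ d′ ℕ.+ 6 ℕ.∸ toℕ d) ℕ.% 6

-- Walks of length 3 between the neighbours in directions `d` and `d′`. In the triangular lattice
-- six triangles meet at a vertex, giving 12 closed walks. If r and g do not commute, three
-- triangles remain, giving 6, and consecutive neighbours are adjacent only when the first of the
-- two directions is even, which separates 11 from 4.
matrixA matrixC : Matrix
matrixA d d′ = entry (diff d d′)
  where
  entry : ℕ → ℤ
  entry 0 = + 12
  entry 1 = + 15
  entry 5 = + 15
  entry _ = + 6
matrixC d d′ = entry (diff d d′) (toℕ d ℕ.% 2)
  where
  entry : ℕ → ℕ → ℤ
  entry 0 _ = + 6
  entry 1 0 = + 11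
  entry 5 1 = + 11
  entry 1 _ = + 4
  entry 5 _ = + 4
  entry _ _ = + 3

isJust≡ : Maybe ℤ → ℤ → Bool
isJust≡ nothing  _ = false
isJust≡ (just x) y = does (x ℤ.≟ y)

pairCheck : (Side → Table × Table) → List Row → List V4 → Matrix → Side → Fin 6 → Fin 6 → Bool
pairCheck ws bs ap M x d d′ = isJust≡ (known bs ap (pairTable ws x d d′)) (M d d′)

localCheck : (Side → Table × Table) → List Row → List V4 → Matrix → Bool
localCheck ws bs ap M = all (λ x → all (λ d → all (pairCheck ws bs ap M x d) sixth) sixth) (U ∷ W ∷ [])

side∈ : ∀ x → x ∈ U ∷ W ∷ []
side∈ U = here refl
side∈ W = there (here refl)

localCheck-at : ∀ ws bs ap M → localCheck ws bs ap M ≡ true → ∀ x d d′ → pairCheck ws bs ap M x d d′ ≡ true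
localCheck-at ws bs ap M e x d d′ = all-∈ (pairCheck ws bs ap M x d) (all-∈ (λ d → all (pairCheck ws bs ap M x d) sixth)
  (all-∈ (λ x → all (λ d → all (pairCheck ws bs ap M x d) sixth) sixth) e (side∈ x)) (sixth∈ d)) (sixth∈ d′)

-- The dihedral group acting on the six directions; true stands for reflections.
act : Bool → Fin 6 → Fin 6 → Fin 6
act false e d = (toℕ e ℕ.+ toℕ d) mod 6
act true  e d = (toℕ e ℕ.+ 6 ℕ.∸ toℕ d) mod 6

op : Fin 6 → Fin 6
op d = act false d d₃

infixr 2 _⇒_
_⇒_ : Bool → Bool → Bool
x ⇒ y = not x ∨ y

⇒-true : ∀ {x y} → (x ⇒ y) ≡ true → x ≡ true → y ≡ true
⇒-true e refl = e

all₆ : (Fin 6 → Bool) → Bool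
all₆ f = all f sixth

all₆-true : ∀ f → all₆ f ≡ true → ∀ d → f d ≡ true
all₆-true f e d = all-∈ f e (sixth∈ d)

sign∈ : ∀ b → b ∈ signs
sign∈ false = here refl
sign∈ true  = there (here refl)

all± : (Bool → Bool) → Bool
all± f = all f signs

all±-true : ∀ f → all± f ≡ true → ∀ b → f b ≡ true
all±-true f e b = all-∈ f e (sign∈ b)

_==_ : Fin 6 → Fin 6 → Bool
d == e = does (d Fin.≟ e)

==-sound : ∀ d e → d == e ≡ true → d ≡ e
==-sound d e p with d Fin.≟ e
... | yes q = q

==-complete : ∀ {d e} → d ≡ e → d == e ≡ true
==-complete {d} refl with d Fin.≟ d
... | yes _ = refl
... | no ¬p = contradiction refl ¬p

act-op : ∀ s e d → op (act s e d) ≡ act s e (op d)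
act-op s e d = ==-sound _ _ (all₆-true (λ d → op (act s e d) == act s e (op d)) (all₆-true (λ e → all₆ λ d → op (act s e d) == act s e (op d))
  (all±-true (λ s → all₆ λ e → all₆ λ d → op (act s e d) == act s e (op d)) refl s) e) d)

even : Fin 6 → Bool
even d = (toℕ d ℕ.% 2) ℕ.≡ᵇ 0

-- Two consecutive values determine a dihedral map.
act-determined : ∀ s e s′ e′ d → even d ≡ true → act s′ e′ (op d) ≡ act s e (op d) →
                 act s′ e′ (act false d d₂) ≡ act s e (act false d d₂) → s′ ≡ s × e′ ≡ e
act-determined s e s′ e′ d ev p q = xnor s′ s (proj₁ (∧-true both-eq)) , ==-sound e′ e (proj₂ (∧-true {not (s′ xor s)} both-eq))
  where
  t₅ : Bool → Fin 6 → Bool → Fin 6 → Fin 6 → Bool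
  t₅ s e s′ e′ d = even d ⇒ (act s′ e′ (op d) == act s e (op d)) ⇒ (act s′ e′ (act false d d₂) == act s e (act false d d₂)) ⇒
    not (s′ xor s) ∧ (e′ == e)
  t₄ : Bool → Fin 6 → Bool → Fin 6 → Bool
  t₄ s e s′ e′ = all₆ (t₅ s e s′ e′)
  t₃ : Bool → Fin 6 → Bool → Bool
  t₃ s e s′ = all₆ (t₄ s e s′)
  t₂ : Bool → Fin 6 → Bool
  t₂ s e = all± (t₃ s e)
  t₁ : Bool → Bool
  t₁ s = all₆ (t₂ s)
  checked : t₅ s e s′ e′ d ≡ true
  checked = all₆-true (t₅ s e s′ e′) (all₆-true (t₄ s e s′) (all±-true (t₃ s e) (all₆-true (t₂ s) (all±-true t₁ refl s) e) s′) e′) d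
  both-eq : not (s′ xor s) ∧ (e′ == e) ≡ true
  both-eq = ⇒-true (⇒-true (⇒-true checked ev) (==-complete p)) (==-complete q)
  xnor : ∀ x y → not (x xor y) ≡ true → x ≡ y
  xnor false false _ = refl
  xnor true  true  _ = refl

eqᵇ : ℤ → ℤ → Bool
eqᵇ x y = does (x ℤ.≟ y)

eqᵇ-complete : ∀ {x y} → x ≡ y → eqᵇ x y ≡ true
eqᵇ-complete {x} refl with x ℤ.≟ x
... | yes _ = refl
... | no ¬p = contradiction refl ¬p

-- Any map of directions preserving the matrix is dihedral, being determined by three consecutive values.
module _ (M : Matrix) (allowed : Bool → Fin 6 → Bool) where

  private
    valueAt : (e f g : Fin 6) → Bool → Fin 6 → Fin 6 → Bool
    valueAt e f g s d x = eqᵇ (M e x) (M d₀ d) ⇒ eqᵇ (M f x) (M d₁ d) ⇒ eqᵇ (M g x) (M d₂ d) ⇒ (x == act s e d)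

    isAct : (e f g : Fin 6) → Bool → Bool
    isAct e f g s = allowed s e ∧ all₆ (λ d → all₆ (valueAt e f g s d))

    startsAs : (e f g : Fin 6) → Bool
    startsAs e f g = eqᵇ (M e f) (M d₀ d₁) ⇒ eqᵇ (M e g) (M d₀ d₂) ⇒ eqᵇ (M f g) (M d₁ d₂) ⇒ any (isAct e f g) signs

  dihedralCheck : Bool
  dihedralCheck = all₆ λ e → all₆ λ f → all₆ (startsAs e f)

  dihedral : dihedralCheck ≡ true → (π : Fin 6 → Fin 6) → (∀ d d′ → M (π d) (π d′) ≡ M d d′) →
    ∃[ s ] ∃[ e ] allowed s e ≡ true × (∀ d → π d ≡ act s e d)
  dihedral ok π h = found (satisfied (any-true (isAct (π d₀) (π d₁) (π d₂)) signs (⇒-true (⇒-true (⇒-true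
      (all₆-true (startsAs (π d₀) (π d₁)) (all₆-true (λ f → all₆ (startsAs (π d₀) f)) (all₆-true (λ e → all₆ λ f → all₆ (startsAs e f)) ok (π d₀)) (π d₁)) (π d₂))
      (eqᵇ-complete (h d₀ d₁))) (eqᵇ-complete (h d₀ d₂))) (eqᵇ-complete (h d₁ d₂)))))
    where
    found : ∃[ s ] isAct (π d₀) (π d₁) (π d₂) s ≡ true → ∃[ s ] ∃[ e ] allowed s e ≡ true × (∀ d → π d ≡ act s e d)
    found (s , p) = s , π d₀ , proj₁ (∧-true {allowed s (π d₀)} p) , λ d → ==-sound (π d) (act s (π d₀) d) (⇒-true (⇒-true (⇒-true
      (all₆-true (valueAt (π d₀) (π d₁) (π d₂) s d) (all₆-true (λ d → all₆ (valueAt (π d₀) (π d₁) (π d₂) s d)) (proj₂ (∧-true {allowed s (π d₀)} p)) d) (π d))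
      (eqᵇ-complete (h d₀ d))) (eqᵇ-complete (h d₁ d))) (eqᵇ-complete (h d₂ d)))

-- If r and g do not commute, the triangles at a vertex lie on the pairs of directions 2j, 2j + 1.
-- Rotations with even index and reflections with odd index are the dihedral maps preserving these
-- pairs.
anyDihedral evenDihedral : Bool → Fin 6 → Bool
anyDihedral  s e = true
evenDihedral s e = even e xor s

-- The triangle on p, its neighbour in direction D and the next neighbour in the sense of s.
triangleᵛ : Side → Fin 6 → Bool → V4
triangleᵛ x D s = (shiftᵛ x (hex x D) ⊕ shiftᵛ y (hex y (act s D d₂))) ⊖ shiftᵛ x (hex x (act s D d₁))
  where
  y = turn x (hex x D)

isTriangle : List Row → (Bool → Fin 6 → Bool) → Side → Fin 6 → Bool → Bool
isTriangle bs allowed x D s = allowed s D ⇒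
  does (turn (turn x (hex x D)) (hex (turn x (hex x D)) (act s D d₂)) ≟ˢ turn x (hex x (act s D d₁))) ∧
  isZeroᵛ (reduce bs (triangleᵛ x D s))

triangleCheck : List Row → (Bool → Fin 6 → Bool) → Bool
triangleCheck bs allowed = all (λ x → all₆ λ D → all± (isTriangle bs allowed x D)) (U ∷ W ∷ [])

triangleCheck-at : ∀ bs allowed → triangleCheck bs allowed ≡ true → ∀ x D s → isTriangle bs allowed x D s ≡ true
triangleCheck-at bs allowed e x D s = all±-true (isTriangle bs allowed x D) (all₆-true (λ D → all± (isTriangle bs allowed x D))
  (all-∈ (λ x → all₆ λ D → all± (isTriangle bs allowed x D)) e (side∈ x)) D) s

isClosed : (Bool → Fin 6 → Bool) → Bool → Fin 6 → Fin 6 → Bool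
isClosed allowed s e d = even d ⇒ allowed s e ⇒ allowed s (act s e d)

closedCheck : (Bool → Fin 6 → Bool) → Bool
closedCheck allowed = all± λ s → all₆ λ e → all₆ (isClosed allowed s e)

closedCheck-at : ∀ allowed → closedCheck allowed ≡ true → ∀ s e d → even d ≡ true → allowed s e ≡ true → allowed s (act s e d) ≡ true
closedCheck-at allowed ok s e d ev al = ⇒-true (⇒-true (all₆-true (isClosed allowed s e) (all₆-true (λ e → all₆ (isClosed allowed s e))
  (all±-true (λ s → all₆ λ e → all₆ (isClosed allowed s e)) ok s) e) d) ev) al

Dihedral : Matrix → (Bool → Fin 6 → Bool) → Set
Dihedral M allowed = (π : Fin 6 → Fin 6) → (∀ d d′ → M (π d) (π d′) ≡ M d d′) →
    ∃[ s ] ∃[ e ] allowed s e ≡ true × (∀ d → π d ≡ act s e d)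

act-assoc : ∀ s e d m → act s e (act false d m) ≡ act s (act s e d) m
act-assoc s e d m = ==-sound _ _ (all₆-true (t₄ s e d) (all₆-true (t₃ s e) (all₆-true (t₂ s) (all±-true t₁ refl s) e) d) m)
  where
  t₄ : Bool → Fin 6 → Fin 6 → Fin 6 → Bool
  t₄ s e d m = act s e (act false d m) == act s (act s e d) m
  t₃ : Bool → Fin 6 → Fin 6 → Bool
  t₃ s e d = all₆ (t₄ s e d)
  t₂ : Bool → Fin 6 → Bool
  t₂ s e = all₆ (t₃ s e)
  t₁ : Bool → Bool
  t₁ s = all₆ (t₂ s)

module Hexagon (n : ℕ) .{{nz : NonZero n}} (k a b : ℤ) where
  open Analysis n k a b public

  N : Pt → Fin 6 → Pt
  N p d = p ▹ hex (side p) d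

  N-≋ : ∀ {p q} d → p ≋ q → N p d ≋ N q d
  N-≋ {x , _} {.x , _} d e@(refl ⨾ _) = move-≋ k _ (hex x d) e

  hex-op : ∀ x d → hex (turn x (hex x d)) (op d) ≡ back (hex x d)
  hex-op U d₀ = refl
  hex-op U d₁ = refl
  hex-op U d₂ = refl
  hex-op U d₃ = refl
  hex-op U d₄ = refl
  hex-op U d₅ = refl
  hex-op W d₀ = refl
  hex-op W d₁ = refl
  hex-op W d₂ = refl
  hex-op W d₃ = refl
  hex-op W d₄ = refl
  hex-op W d₅ = refl

  N-op : ∀ p d → N (N p d) (op d) ≋ p
  N-op p@(x , _) d = subst (λ z → (p ▹ hex x d) ▹ z ≋ p) (sym (hex-op x d)) (move-back k _ p (hex x d))

  hexOf : ∀ x d → ∃[ h ] hex x h ≡ d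
  hexOf U fwd      = d₀ , refl
  hexOf U bwd      = d₃ , refl
  hexOf U (spk i₀) = d₂ , refl
  hexOf U (spk i₁) = d₁ , refl
  hexOf U (spk i₂) = d₄ , refl
  hexOf U (spk i₃) = d₅ , refl
  hexOf W fwd      = d₀ , refl
  hexOf W bwd      = d₃ , refl
  hexOf W (spk i₀) = d₅ , refl
  hexOf W (spk i₁) = d₄ , refl
  hexOf W (spk i₂) = d₁ , refl
  hexOf W (spk i₃) = d₂ , refl

  hex-inj : ∀ x {d d′} → hex x d ≡ hex x d′ → d ≡ d′
  hex-inj x {d} {d′} e = trans (sym (inv x d)) (trans (cong (λ z → proj₁ (hexOf x z)) e) (inv x d′))
    where
    inv : ∀ x d → proj₁ (hexOf x (hex x d)) ≡ d
    inv U d₀ = refl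
    inv U d₁ = refl
    inv U d₂ = refl
    inv U d₃ = refl
    inv U d₄ = refl
    inv U d₅ = refl
    inv W d₀ = refl
    inv W d₁ = refl
    inv W d₂ = refl
    inv W d₃ = refl
    inv W d₄ = refl
    inv W d₅ = refl

  module _ (simple : Simple) where

    N-inj : ∀ p {d d′} → ⟦ N p d ⟧ ≡ ⟦ N p d′ ⟧ → d ≡ d′
    N-inj p e = hex-inj (side p) (▹-inj simple p (≡⇒≋ e))

  -- One map `π` of directions serves all vertices. The image of `p` may be given by any
  -- representative `p′`, so that compositions need no normalisation.
  record Equivariant (f : NestV n → NestV n) (π : Fin 6 → Fin 6) : Set where
    constructor equivariant
    field
      equi : ∀ p p′ → f ⟦ p ⟧ ≡ ⟦ p′ ⟧ → ∀ d → f ⟦ N p d ⟧ ≡ ⟦ N p′ (π d) ⟧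
  open Equivariant public

module Rigid (n : ℕ) .{{nz : NonZero n}} (k a b : ℤ) (rels ap : List V4) (M : Matrix) (allowed : Bool → Fin 6 → Bool)
  (L : ℕ) (ws : Side → Table × Table) (ws-walks : ∀ y → ws y ≡ walks y L)
  (local-ok : ∀ x d d′ → pairCheck ws (rowsOf rels) ap M x d d′ ≡ true)
  (triangle-ok : ∀ x D s → isTriangle (rowsOf rels) allowed x D s ≡ true)
  (dihedral-ok : Dihedral M allowed)
  (closed-ok : ∀ s e d → even d ≡ true → allowed s e ≡ true → allowed s (act s e d) ≡ true)
  (even-allowed : ∀ d → even d ≡ true → allowed false d ≡ true) where

  open Hexagon n k a b public

  module _ (simple : Simple) (zs : All Z rels) (ps : Apart ap) where

    private
      bs = rowsOf rels
      rows : ∀ {rels} → All Z rels → ZRows (rowsOf rels)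
      rows []       = []
      rows (z ∷ zs) = insert-Z fuel _ z (rows zs)

    private
      zero⇒χ : ∀ v → isZeroᵛ (reduce bs v) ≡ true → χ v ≡ + 1
      zero⇒χ v z = χ-yes {v} (proj₂ (reduce-~ (rows zs) v) (subst Z (sym (isZeroᵛ-sound (reduce bs v) z)) Z-0))

      apart⇒χ : ∀ v → member (reduce bs v) ap ≡ true → χ v ≡ + 0
      apart⇒χ v m = χ-no {v} (member-sound (reduce bs v) ps m ∘ proj₁ (reduce-~ (rows zs) v))

      accumulate-sound : ∀ x y c {z w r} → accumulate x y c z ≡ just w → (x ≡ true → r ≡ + 1) → (y ≡ true → r ≡ + 0) →
        ∃[ z′ ] z ≡ just z′ × w ≡ c * r + z′
      accumulate-sound true  _    c {just z} refl f g = z , refl , cong (_+ z) (sym (trans (cong (c *_) (f refl)) (ℤ.*-identityʳ c)))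
      accumulate-sound false true c {just z} refl f g = z , refl ,
        trans (sym (ℤ.+-identityˡ z)) (cong (_+ z) (sym (trans (cong (c *_) (g refl)) (ℤ.*-zeroʳ c))))

    known-sound : ∀ t {c} → known bs ap t ≡ just c → evT χ 0 t ≡ c
    known-sound []            refl = refl
    known-sound ((v , c) ∷ t) e =
      let (z , e′ , w) = accumulate-sound (isZeroᵛ (reduce bs v)) (member (reduce bs v) ap) (nth 0 c) e (zero⇒χ v) (apart⇒χ v)
      in trans (cong (λ y → nth 0 c * χ v + y) (known-sound t e′)) (sym w)

    local : ∀ p d d′ → cnt L ⟦ N p d ⟧ ⟦ N p d′ ⟧ ≡ M d d′
    local (x , i) d d′ = trans (cnt-table L (turn x (hex x d)) (turn x (hex x d′)) (shiftᵛ x (hex x d′) ⊖ shiftᵛ x (hex x d)) (i + sh d) (i + sh d′)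
        (trans (ev-⊖ k a b (shiftᵛ x (hex x d′)) (shiftᵛ x (hex x d))) (trans (cong₂ _-_ (ev-shift k a b x (hex x d′)) (ev-shift k a b x (hex x d))) (lem i (sh d′) (sh d)))))
      (trans (cong (λ z → evT χ 0 (shiftT ((- + 1) · (shiftᵛ x (hex x d′) ⊖ shiftᵛ x (hex x d))) (select z (turn x (hex x d))))) (sym (ws-walks (turn x (hex x d′))))) (value-of (known (rowsOf rels) ap (pairTable ws x d d′)) refl
        (local-ok x d d′)))
      where
      sh : Fin 6 → ℤ
      sh d = shift k (spokes (+ 0) (+ 1) a b) x (hex x d)
      lem : ∀ i y z → y - z ≡ (i + y) - (i + z)
      lem = solve-∀
      value-of : ∀ m → known (rowsOf rels) ap (pairTable ws x d d′) ≡ m → isJust≡ m (M d d′) ≡ true →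
        evT χ 0 (pairTable ws x d d′) ≡ M d d′
      value-of (just c) e q with c ℤ.≟ M d d′
      ... | yes r = trans (known-sound (pairTable ws x d d′) e) r

    triangle : ∀ p D s → allowed s D ≡ true → N (N p D) (act s D d₂) ≋ N p (act s D d₁)
    triangle (x , i) D s al with ∧-true {does (turn (turn x (hex x D)) (hex (turn x (hex x D)) (act s D d₂)) ≟ˢ turn x (hex x (act s D d₁)))} (⇒-true (triangle-ok x D s) al)
    ... | sides , vanish = sides≡ ⨾ lin₁ (+ 1) (unZ (proj₂ (reduce-~ (rows zs) (triangleᵛ x D s)) (subst Z (sym (isZeroᵛ-sound (reduce bs (triangleᵛ x D s)) vanish)) Z-0)))
          (trans (lem i (sh x D) (sh (turn x (hex x D)) (act s D d₂)) (sh x (act s D d₁))) (cong (λ z → + 1 * z) (sym (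
            trans (ev-⊖ k a b (shiftᵛ x (hex x D) ⊕ shiftᵛ (turn x (hex x D)) (hex (turn x (hex x D)) (act s D d₂))) (shiftᵛ x (hex x (act s D d₁))))
              (cong₂ _-_ (trans (ev-⊕ k a b (shiftᵛ x (hex x D)) (shiftᵛ (turn x (hex x D)) (hex (turn x (hex x D)) (act s D d₂)))) (cong₂ _+_ (ev-shift k a b x (hex x D)) (ev-shift k a b (turn x (hex x D)) (hex (turn x (hex x D)) (act s D d₂))))) (ev-shift k a b x (hex x (act s D d₁))))))))
      where
      sh : Side → Fin 6 → ℤ
      sh x d = shift k (spokes (+ 0) (+ 1) a b) x (hex x d)
      lem : ∀ i y z w → ((i + y) + z) - (i + w) ≡ + 1 * (y + z - w)
      lem = solve-∀
      sides≡ : turn (turn x (hex x D)) (hex (turn x (hex x D)) (act s D d₂)) ≡ turn x (hex x (act s D d₁))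
      sides≡ with turn (turn x (hex x D)) (hex (turn x (hex x D)) (act s D d₂)) ≟ˢ turn x (hex x (act s D d₁))
      ... | yes e = e

    triangle-≡ : ∀ p D s → allowed s D ≡ true → ⟦ N (N p D) (act s D d₂) ⟧ ≡ ⟦ N p (act s D d₁) ⟧
    triangle-≡ p D s al = ≋⇒≡ {N (N p D) (act s D d₂)} {N p (act s D d₁)} (triangle p D s al)

    module _ (σ : Aut Γ) where
      private
        f = app {Γ} {Γ} σ

      -- Around p, the automorphism acts on directions as the dihedral map (s , e).
      Acts : Bool → Fin 6 → Pt → Set
      Acts s e p = ∀ p′ → f ⟦ p ⟧ ≡ ⟦ p′ ⟧ → ∀ d → f ⟦ N p d ⟧ ≡ ⟦ N p′ (act s e d) ⟧

      Acts-≋ : ∀ {s e p q} → p ≋ q → Acts s e p → Acts s e q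
      Acts-≋ p≋q h p′ e d = trans (cong f (≋⇒≡ (N-≋ d (≋-sym p≋q)))) (h p′ (trans (cong f (≋⇒≡ p≋q)) e) d)

      private
        image : ∀ p d → ∃[ d′ ] f ⟦ N p d ⟧ ≡ ⟦ N (lift (f ⟦ p ⟧)) d′ ⟧
        image p d with app-E σ (edge k _ p (hex (side p) d))
        ... | via d′ e with hexOf (side (lift (f ⟦ p ⟧))) d′
        ...   | h , refl = h , trans (sym (⟦lift⟧ _)) (≋⇒≡ e)

        image-matrix : ∀ p d d′ → M (proj₁ (image p d)) (proj₁ (image p d′)) ≡ M d d′
        image-matrix p d d′ = trans (sym (local (lift (f ⟦ p ⟧)) (proj₁ (image p d)) (proj₁ (image p d′))))
          (trans (sym (cong₂ (cnt L) (proj₂ (image p d)) (proj₂ (image p d′)))) (trans (cnt-app simple σ L _ _) (local p d d′)))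

      -- Neighbours go to neighbours and walk counts between them are invariant, so the induced map
      -- of directions preserves `M`; such maps are dihedral.
      acts : ∀ p → ∃[ s ] ∃[ e ] allowed s e ≡ true × Acts s e p
      acts p = from-dihedral (dihedral-ok (λ d → proj₁ (image p d)) (image-matrix p))
        where
        from-dihedral : (∃[ s ] ∃[ e ] allowed s e ≡ true × (∀ d → proj₁ (image p d) ≡ act s e d)) →
          ∃[ s ] ∃[ e ] allowed s e ≡ true × Acts s e p
        from-dihedral (s , e , al , h) = s , e , al , λ p′ eq d → trans (proj₂ (image p d))
          (≋⇒≡ (subst (λ z → N (lift (f ⟦ p ⟧)) z ≋ N p′ (act s e d)) (sym (h d)) (N-≋ (act s e d) (≡⇒≋ (trans (⟦lift⟧ _) eq)))))

      private
        -- The dihedral maps at `p` and at its neighbour are compared on two directions at the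
        -- neighbour: back to `p`, and along the side opposite `p` of a common triangle. Agreement
        -- there makes them equal.
        module Step (s : Bool) (e d : Fin 6) (p p′ : Pt) (fp : f ⟦ p ⟧ ≡ ⟦ p′ ⟧) (ev : even d ≡ true) (al : allowed s e ≡ true) (h : Acts s e p)
          (s′ : Bool) (e′ : Fin 6) (h′ : Acts s′ e′ (N p d)) where

          D : Fin 6
          D = act s e d

          q′ : Pt
          q′ = N p′ D

          fq : f ⟦ N p d ⟧ ≡ ⟦ q′ ⟧
          fq = h p′ fp d

          b₁ : f ⟦ N (N p d) (op d) ⟧ ≡ ⟦ p′ ⟧
          b₁ = trans (cong f (≋⇒≡ (N-op p d))) fp

          b₂ : ⟦ N q′ (act s e (op d)) ⟧ ≡ ⟦ p′ ⟧
          b₂ = subst (λ z → ⟦ N q′ z ⟧ ≡ ⟦ p′ ⟧) (act-op s e d) (≋⇒≡ (N-op p′ D))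

          backwards : act s′ e′ (op d) ≡ act s e (op d)
          backwards = N-inj simple q′ (trans (sym (h′ q′ fq (op d))) (trans b₁ (sym b₂)))

          c₁ : f ⟦ N (N p d) (act false d d₂) ⟧ ≡ ⟦ N p′ (act s e (act false d d₁)) ⟧
          c₁ = trans (cong f (triangle-≡ p d false (even-allowed d ev))) (h p′ fp (act false d d₁))

          c₂ : ⟦ N q′ (act s D d₂) ⟧ ≡ ⟦ N p′ (act s D d₁) ⟧
          c₂ = triangle-≡ p′ D s (closed-ok s e d ev al)

          c₃ : ⟦ N q′ (act s e (act false d d₂)) ⟧ ≡ ⟦ N p′ (act s e (act false d d₁)) ⟧
          c₃ = subst₂ (λ y z → ⟦ N q′ y ⟧ ≡ ⟦ N p′ z ⟧) (sym (act-assoc s e d d₂)) (sym (act-assoc s e d d₁)) c₂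

          onwards : act s′ e′ (act false d d₂) ≡ act s e (act false d d₂)
          onwards = N-inj simple q′ (trans (sym (h′ q′ fq (act false d d₂))) (trans c₁ (sym c₃)))

          same-act : s′ ≡ s × e′ ≡ e
          same-act = act-determined s e s′ e′ d ev backwards onwards

          conclusion : Acts s e (N p d)
          conclusion = subst₂ (λ s e → Acts s e (N p d)) (proj₁ same-act) (proj₂ same-act) h′

      Acts-step : ∀ s e p d → even d ≡ true → allowed s e ≡ true → Acts s e p → Acts s e (N p d)
      Acts-step s e p d ev al h =
        let (s′ , e′ , _ , h′) = acts (N p d)
        in Step.conclusion s e d p (lift (f ⟦ p ⟧)) (sym (⟦lift⟧ _)) ev al h s′ e′ h′

      private
        Acts-U : ∀ s e → allowed s e ≡ true → Acts s e (U , + 0) → ∀ m → Acts s e (U , + m)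
        Acts-U s e al h zero    = h
        Acts-U s e al h (suc m) = subst (λ z → Acts s e (U , z)) (cong +_ (ℕ.+-comm m 1)) (Acts-step s e (U , + m) d₀ refl al (Acts-U s e al h m))

        Acts-W : ∀ s e → allowed s e ≡ true → Acts s e (U , + 0) → ∀ m → Acts s e (W , + m)
        Acts-W s e al h m = subst (λ z → Acts s e (W , z)) (ℤ.+-identityʳ (+ m)) (Acts-step s e (U , + m) d₂ refl al (Acts-U s e al h m))

        Acts-lift : ∀ s e → allowed s e ≡ true → Acts s e (U , + 0) → ∀ x → Acts s e (lift x)
        Acts-lift s e al h (inj₁ i) = Acts-U s e al h (toℕ i)
        Acts-lift s e al h (inj₂ i) = Acts-W s e al h (toℕ i)

      -- Steps r along the rim and one step g reach every vertex from u_0. Both directions are even,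
      -- where the triangle used for propagation exists in either model.
      rigid : ∃[ s ] ∃[ e ] allowed s e ≡ true × Equivariant f (act s e)
      rigid = let (s , e , al , h) = acts (U , + 0)
              in s , e , al , equivariant λ p → Acts-≋ {s} {e} (lift-⟦⟧ p) (Acts-lift s e al h ⟦ p ⟧)

-- The rotation by 120° and the relations it forces.

halve : ∀ m → (∃[ j ] m ≡ j ℕ.+ j) ⊎ (∃[ j ] m ≡ suc (j ℕ.+ j))
halve zero = inj₁ (0 , refl)
halve (suc m) with halve m
... | inj₁ (j , refl) = inj₂ (j , refl)
... | inj₂ (j , refl) = inj₁ (suc j , cong suc (sym (ℕ.+-suc j j)))

act-0 : ∀ s e → act s e d₀ ≡ e
act-0 s e = ==-sound _ _ (all₆-true (λ e → act s e d₀ == e) (all±-true (λ s → all₆ λ e → act s e d₀ == e) refl s) e)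

ρ : Fin 6 → Fin 6
ρ = act false d₂

pointwise : ∀ (f g : Fin 6 → Fin 6) → all₆ (λ d → f d == g d) ≡ true → ∀ d → f d ≡ g d
pointwise f g e d = ==-sound _ _ (all₆-true (λ d → f d == g d) e d)

module Rotation (n : ℕ) .{{nz : NonZero n}} (k a b : ℤ) where
  open Hexagon n k a b public

  Equivariant-≗ : ∀ {f π π′} → (∀ d → π d ≡ π′ d) → Equivariant f π → Equivariant f π′
  Equivariant-≗ e h = equivariant λ p p′ q d → trans (equi h p p′ q d) (cong (λ z → ⟦ N p′ z ⟧) (e d))

  Equivariant-∘ : ∀ {f g π ϕ} → Equivariant g ϕ → Equivariant f π → Equivariant (g ∘ f) (ϕ ∘ π)
  Equivariant-∘ {f} {g} {π} h′ h = equivariant λ p p″ q d → trans (cong g (equi h p (lift (f ⟦ p ⟧)) (sym (⟦lift⟧ _)) d))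
    (equi h′ (lift (f ⟦ p ⟧)) p″ (trans (cong g (⟦lift⟧ _)) q) (π d))

  Rotating : Set
  Rotating = ∃[ f ] Equivariant f ρ

  private
    twice : ∀ {f π} → Equivariant f π → (∀ d → π (π d) ≡ ρ d) → Rotating
    twice h e = _ , Equivariant-≗ e (Equivariant-∘ h h)

    fourfold : ∀ {f π} → Equivariant f π → (∀ d → π (π (π (π d))) ≡ ρ d) → Rotating
    fourfold h e = _ , Equivariant-≗ e (Equivariant-∘ (Equivariant-∘ h h) (Equivariant-∘ h h))

  -- Some rotation with index not divisible by 3 is available: one of the two maps, or the
  -- composition of two reflections, whose index is `e′ - e`. Index 2 is the goal, the square of
  -- index 1 or 4 has index 2, and so has the fourth power of index 5.
  rotating : ∀ {f g s s′ e e′} → Equivariant f (act s e) → e ≡ d₂ ⊎ e ≡ d₅ → Equivariant g (act s′ e′) → e′ ≡ d₁ ⊎ e′ ≡ d₄ → Rotating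
  rotating {f} {s = false} h (inj₁ refl) h′ _ = f , h
  rotating {s = false} h (inj₂ refl) h′ _ = fourfold h (pointwise _ ρ refl)
  rotating {s = true} {false} h _ h′ (inj₁ refl) = twice h′ (pointwise _ ρ refl)
  rotating {s = true} {false} h _ h′ (inj₂ refl) = twice h′ (pointwise _ ρ refl)
  rotating {s = true} {true} h (inj₁ refl) h′ (inj₁ refl) = fourfold (Equivariant-∘ h′ h) (pointwise _ ρ refl)
  rotating {s = true} {true} h (inj₂ refl) h′ (inj₁ refl) = _ , Equivariant-≗ (pointwise _ ρ refl) (Equivariant-∘ h′ h)
  rotating {s = true} {true} h (inj₁ refl) h′ (inj₂ refl) = _ , Equivariant-≗ (pointwise _ ρ refl) (Equivariant-∘ h′ h)
  rotating {s = true} {true} h (inj₂ refl) h′ (inj₂ refl) = fourfold (Equivariant-∘ h′ h) (pointwise _ ρ refl)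

  module _ (simple : Simple) (et : EdgeTransitive Γ)
    (rigid : (σ : Aut Γ) → ∃[ s ] ∃[ e ] Equivariant (app {Γ} {Γ} σ) (act s e)) where

    private
      o : Pt
      o = U , + 0

      to : ∀ d → ∃[ σ ] ∃[ s ] ∃[ e ] Equivariant (app {Γ} {Γ} σ) (act s e) × (e ≡ d ⊎ ⟦ N (N o d) e ⟧ ≡ ⟦ o ⟧)
      to d with et _ _ _ _ (edge k _ o (hex U d₀)) (edge k _ o (hex U d))
      ... | σ , moved with rigid σ
      ...   | s , e , h with moved
      ...     | inj₁ (p , q) = σ , s , e , h , inj₁ (trans (sym (act-0 s e)) (N-inj simple o (trans (sym (equi h o o p d₀)) q)))
      ...     | inj₂ (p , q) = σ , s , e , h , inj₂ (trans (cong (λ z → ⟦ N (N o d) z ⟧) (sym (act-0 s e))) (trans (sym (equi h o (N o d) p d₀)) q))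

      Sends : Fin 6 → Set
      Sends d = ∃[ σ ] ∃[ s ] ∃[ e ] Equivariant (app {Γ} {Γ} σ) (act s e) × (e ≡ d ⊎ ⟦ N (N o d) e ⟧ ≡ ⟦ o ⟧)

      from-two : Sends d₂ → Sends d₁ → Rotating
      from-two (σ , s , e , h , m) (σ′ , s′ , e′ , h′ , m′) = rotating {s = s} {s′} h (Sum.map₂ back₂ m) h′ (Sum.map₂ back₁ m′)
        where
        back₂ : ∀ {e} → ⟦ N (N o d₂) e ⟧ ≡ ⟦ o ⟧ → e ≡ d₅
        back₂ {e} p = N-inj simple (W , + 0) {e} {d₅} p
        back₁ : ∀ {e} → ⟦ N (N o d₁) e ⟧ ≡ ⟦ o ⟧ → e ≡ d₄
        back₁ {e} p = N-inj simple (W , + 1) {e} {d₄} p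

    -- The rim edge at u_0 is moved to the edges in directions g and r + g. The image may be
    -- reversed, which adds 3 to the index: it is 2 or 5 for the first edge and 1 or 4 for the
    -- second.
    rotates : Rotating
    rotates = from-two (to d₂) (to d₁)

  pow : ℕ → Fin 6 → Pt → Pt
  pow zero    d p = p
  pow (suc m) d p = pow m d (N p d)

  pow-equivariant : ∀ {f π} → Equivariant f π → ∀ m d p p′ → f ⟦ p ⟧ ≡ ⟦ p′ ⟧ → f ⟦ pow m d p ⟧ ≡ ⟦ pow m (π d) p′ ⟧
  pow-equivariant h zero    d p p′ e = e
  pow-equivariant {π = π} h (suc m) d p p′ e = pow-equivariant h m d (N p d) (N p′ (π d)) (equi h p p′ e d)

  pow-≋ : ∀ m d {p q} → p ≋ q → pow m d p ≋ pow m d q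
  pow-≋ zero    d e = e
  pow-≋ (suc m) d e = pow-≋ m d (N-≋ d e)

  pow-r : ∀ m i → pow m d₀ (U , i) ≋ (U , i + + m)
  pow-r zero    i = refl ⨾ ≡⇒∣ (sym (ℤ.+-identityʳ i))
  pow-r (suc m) i = ≋-trans (pow-r m (i + + 1)) (refl ⨾ ≡⇒∣ (ℤ.+-assoc i (+ 1) (+ m)))

  pow-bwd : ∀ m i → pow m d₃ (U , i) ≋ (U , i - + m)
  pow-bwd zero    i = refl ⨾ ≡⇒∣ (sym (ℤ.+-identityʳ i))
  pow-bwd (suc m) i = ≋-trans (pow-bwd m (i + - + 1)) (refl ⨾ ≡⇒∣ (trans (lem i (+ m)) (cong (λ z → i - z) refl)))
    where
    lem : ∀ i m → (i + - + 1) - m ≡ i - (+ 1 + m)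
    lem = solve-∀

  pow-g : ∀ j x i → pow (j ℕ.+ j) d₂ (x , i) ≋ (x , i - + j * b)
  pow-g zero    x i = refl ⨾ ≡⇒∣ (lem i b)
    where
    lem : ∀ i b → i ≡ i - + 0 * b
    lem = solve-∀
  pow-g (suc j) x i rewrite ℕ.+-suc j j = ≋-trans (pow-≋ (j ℕ.+ j) d₂ (two x)) (≋-trans (pow-g j x (i - b)) (refl ⨾ ≡⇒∣ (lem i (+ j) b)))
    where
    lem : ∀ i j b → (i - b) - j * b ≡ i - (+ 1 + j) * b
    lem = solve-∀
    l₁ : ∀ i b → (i + + 0) + - b ≡ i - b
    l₁ = solve-∀
    l₂ : ∀ i b → (i + - b) + + 0 ≡ i - b
    l₂ = solve-∀
    two : ∀ x → N (N (x , i) d₂) d₂ ≋ (x , i - b)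
    two U = refl ⨾ ≡⇒∣ (l₁ i b)
    two W = refl ⨾ ≡⇒∣ (l₂ i b)

  other : Side → Side
  other U = W
  other W = U

  pow-g-odd : ∀ j x i → side (pow (suc (j ℕ.+ j)) d₂ (x , i)) ≡ other x
  pow-g-odd j x i = trans (side-≡ (pow-g j (turn x (hex x d₂)) _)) (flipped x)
    where
    flipped : ∀ x → turn x (hex x d₂) ≡ other x
    flipped U = refl
    flipped W = refl

  other-≢ : ∀ {x} → other x ≢ x
  other-≢ {U} ()
  other-≢ {W} ()

  module _ {f} (h : Equivariant f ρ) where

    private
      o : Pt
      o = U , + 0

      x : Side
      x = side (lift (f ⟦ o ⟧))

      i : ℤ
      i = proj₂ (lift (f ⟦ o ⟧))

      p : Pt
      p = x , i

      fo : f ⟦ o ⟧ ≡ ⟦ p ⟧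
      fo = sym (⟦lift⟧ _)

    -- r^c g^2 = 1 for c = b, applied to the image of u_0.
    relation-b : ∀ e → b ≡ + (e ℕ.+ e) → + n ∣ a - + 1 - + e * b
    relation-b e b≡ = conclude x (≋-trans (≋-sym (N-≋ d₄ (N-≋ d₄ (pow-g e x i)))) (≡⇒≋ (trans (sym image) (trans (cong f (≋⇒≡ closed)) fo))))
      where
      c = e ℕ.+ e
      closed : N (N (pow c d₀ o) d₂) d₂ ≋ o
      closed = ≋-trans (N-≋ d₂ (N-≋ d₂ (pow-r c (+ 0)))) (refl ⨾ ≡⇒∣ (trans (cong (λ z → + 0 + + c + + 0 + - z) b≡) (lem (+ c))))
        where
        lem : ∀ c → + 0 + c + + 0 + - c ≡ + 0
        lem = solve-∀
      -- The turn makes g^c out of r^c, a shift by `- e * b`, and two steps -r - g out of g^2; these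
      -- pass through both sides and add `a - 1`.
      image : f ⟦ N (N (pow c d₀ o) d₂) d₂ ⟧ ≡ ⟦ N (N (pow c d₂ p) d₄) d₄ ⟧
      image = equi h _ _ (equi h _ _ (pow-equivariant h c d₀ o p fo) d₂) d₂
      l₁ : ∀ i e b a → a - + 1 - e * b ≡ + 1 * ((i - e * b) + a + - + 1 - i)
      l₁ = solve-∀
      l₂ : ∀ i e b a → a - + 1 - e * b ≡ + 1 * ((i - e * b) + - + 1 + a - i)
      l₂ = solve-∀
      conclude : ∀ x → N (N (x , i - + e * b) d₄) d₄ ≋ (x , i) → + n ∣ a - + 1 - + e * b
      conclude U (_ ⨾ d) = lin₁ (+ 1) d (l₁ i (+ e) b a)
      conclude W (_ ⨾ d) = lin₁ (+ 1) d (l₂ i (+ e) b a)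

    -- r^n = 1.
    relation-n : ∃[ j ] n ≡ j ℕ.+ j × + n ∣ + j * b
    relation-n = conclude (halve n)
      where
      closed : pow n d₀ o ≋ o
      closed = ≋-trans (pow-r n (+ 0)) (refl ⨾ divides (+ 1) (lem (+ n)))
        where
        lem : ∀ n → + 0 + n - + 0 ≡ + 1 * n
        lem = solve-∀
      rotated : pow n d₂ p ≋ p
      rotated = ≡⇒≋ (trans (sym (pow-equivariant h n d₀ o p fo)) (trans (cong f (≋⇒≡ closed)) fo))
      lem : ∀ i j b → j * b ≡ - + 1 * (i - j * b - i)
      lem = solve-∀
      conclude : (∃[ j ] n ≡ j ℕ.+ j) ⊎ (∃[ j ] n ≡ suc (j ℕ.+ j)) → ∃[ j ] n ≡ j ℕ.+ j × + n ∣ + j * b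
      conclude (inj₁ (j , e)) = j , e , lin₁ (- + 1) (index-∣ (≋-trans (≋-sym (pow-g j x i)) (subst (λ m → pow m d₂ p ≋ p) e rotated))) (lem i (+ j) b)
      -- An odd number of steps g ends on the other side, so g^n = 1 forces n to be even.
      conclude (inj₂ (j , e)) = ⊥-elim (other-≢ (trans (sym (pow-g-odd j x i)) (side-≡ (subst (λ m → pow m d₂ p ≋ p) e rotated))))

    -- r^m g r = r g for n = 2m and k = m + 1.
    relation-commutator : ∀ m → n ≡ m ℕ.+ m → k ≡ + 1 + + m → + n ∣ b - a - k → ∃[ j ] m ≡ j ℕ.+ j × + n ∣ + j * b + + m
    relation-commutator m n≡ k≡ hab = conclude (halve m)
      where
      closed : N (N (pow m d₀ o) d₂) d₀ ≋ N (N o d₀) d₂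
      closed = ≋-trans (N-≋ d₀ (N-≋ d₂ (pow-r m (+ 0)))) (refl ⨾ divides (+ 1)
          (trans (cong (λ z → + 0 + + m + + 0 + z - (+ 0 + + 1 + + 0)) k≡) (trans (lem (+ m)) (cong (λ z → + 1 * + z) (sym n≡)))))
        where
        lem : ∀ m → + 0 + m + + 0 + (+ 1 + m) - (+ 0 + + 1 + + 0) ≡ + 1 * (m + m)
        lem = solve-∀
      rotated : N (N (pow m d₂ p) d₄) d₂ ≋ N (N p d₂) d₄
      rotated = ≡⇒≋ (trans (sym (equi h _ _ (equi h _ _ (pow-equivariant h m d₀ o p fo) d₂) d₀))
        (trans (cong f (≋⇒≡ closed)) (equi h (N o d₀) (N p d₂) (equi h o p fo d₀) d₂)))
      l₁ : ∀ i j b a k m → j * b + m ≡ - + 1 * ((i - j * b) + a + - b - (i + + 0 + - + 1)) + - + 1 * (b - a - k) + - + 1 * (k - (+ 1 + m))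
      l₁ = solve-∀
      l₂ : ∀ i j b a k m → j * b + m ≡ - + 1 * ((i - j * b) + - + 1 + + 0 - (i + - b + a)) + + 1 * (b - a - k) + + 1 * (k - (+ 1 + m)) + + 1 * (m + m)
      l₂ = solve-∀
      k-m : + n ∣ k - (+ 1 + + m)
      k-m = ≡⇒∣ k≡
      ends′ : ∀ x j → N (N (x , i - + j * b) d₄) d₂ ≋ N (N (x , i) d₂) d₄ → + n ∣ + j * b + + m
      ends′ U j (_ ⨾ d) = lin₃ (- + 1) (- + 1) (- + 1) d hab k-m (l₁ i (+ j) b a k (+ m))
      ends′ W j (_ ⨾ d) = subst (+ n ∣_) (sym (l₂ i (+ j) b a k (+ m)))
        (∣m∣n⇒∣m+n (lin₃ (- + 1) (+ 1) (+ 1) d hab k-m refl) (divides (+ 1) (cong (λ z → + 1 * + z) (sym n≡))))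
      sides : ∀ x q → side q ≡ other x → side (N (N q d₄) d₂) ≡ side (N (N (x , i) d₂) d₄) → ⊥
      sides U (.W , _) refl ()
      sides W (.U , _) refl ()
      conclude : (∃[ j ] m ≡ j ℕ.+ j) ⊎ (∃[ j ] m ≡ suc (j ℕ.+ j)) → ∃[ j ] m ≡ j ℕ.+ j × + n ∣ + j * b + + m
      conclude (inj₁ (j , e)) = j , e , ends′ x j (≋-trans (≋-sym (N-≋ d₂ (N-≋ d₄ (pow-g j x i))))
        (subst (λ m → N (N (pow m d₂ p) d₄) d₂ ≋ N (N p d₂) d₄) e rotated))
      conclude (inj₂ (j , e)) = ⊥-elim (sides x (pow m d₂ p) (subst (λ m → side (pow m d₂ p) ≡ other x) (sym e) (pow-g-odd j x i)) (side-≡ rotated))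

  -- r^c g^2 = 1 under the map r ↦ -r, g ↦ r + g.
  reflected : ∀ {f} → Equivariant f (act true d₃) → f ⟦ U , + 0 ⟧ ≡ ⟦ U , + 0 ⟧ → ∀ c → b ≡ + c → + n ∣ a + b - + 1
  reflected {f} h fo c b≡ = lin₁ (- + 1) (index-∣ (≋-trans (≋-sym (N-≋ d₁ (N-≋ d₁ (pow-bwd c (+ 0)))))
      (≡⇒≋ {N (N (pow c d₃ o) d₁) d₁} {o} (trans (sym (equi h (N (pow c d₀ o) d₂) (N (pow c d₃ o) d₁) (equi h (pow c d₀ o) (pow c d₃ o) (pow-equivariant h c d₀ o o fo) d₂) d₂)) (trans (cong f (≋⇒≡ closed)) fo)))))
      (trans (cong (λ z → a + z - + 1) b≡) (lem (+ c) a))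
    where
    o : Pt
    o = U , + 0
    closed : N (N (pow c d₀ o) d₂) d₂ ≋ o
    closed = ≋-trans (N-≋ d₂ (N-≋ d₂ (pow-r c (+ 0)))) (refl ⨾ ≡⇒∣ (trans (cong (λ z → + 0 + + c + + 0 + - z) b≡) (l (+ c))))
      where
      l : ∀ c → + 0 + c + + 0 + - c ≡ + 0
      l = solve-∀
    lem : ∀ c a → a + c - + 1 ≡ - + 1 * (+ 0 - c + + 1 + - a - + 0)
    lem = solve-∀

-- Transitivity from explicit automorphisms.

data Parity (i : ℤ) : Set where
  isEven : ∀ j → i ≡ + 2 * j → Parity i
  isOdd  : ∀ j → i ≡ + 2 * j + + 1 → Parity i

parity : ∀ i → Parity i
parity i = go (i ℤ.%ℕ 2) (n%ℕd<d i 2) (a≡a%ℕn+[a/ℕn]*n i 2)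
  where
  l₀ : ∀ q → + 0 + q * + 2 ≡ + 2 * q
  l₀ = solve-∀
  l₁ : ∀ q → + 1 + q * + 2 ≡ + 2 * q + + 1
  l₁ = solve-∀
  go : ∀ r → r ℕ.< 2 → i ≡ + r + (i ℤ./ℕ 2) * + 2 → Parity i
  go 0 _ e = isEven (i ℤ./ℕ 2) (trans e (l₀ (i ℤ./ℕ 2)))
  go 1 _ e = isOdd (i ℤ./ℕ 2) (trans e (l₁ (i ℤ./ℕ 2)))
  go (suc (suc _)) (ℕ.s≤s (ℕ.s≤s ())) _

even≢odd : ∀ x → ¬ (+ 2 ∣ + 2 * x + + 1)
even≢odd x d = ℕ∣.>⇒∤ (ℕ.s≤s (ℕ.s≤s ℕ.z≤n)) (∣⇒∣ᵤ (lin₂ {+ 2} {+ 2 * x + + 1} {+ 2} {+ 1} (+ 1) (- x) d ∣-refl (lem x)))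
  where
  lem : ∀ x → + 1 ≡ + 1 * (+ 2 * x + + 1) + - x * + 2
  lem = solve-∀

module Transitivity (n : ℕ) .{{nz : NonZero n}} (k : ℤ) (s : Fin 4 → ℤ) where
  open Walks n k s

  private
    ap = app {Γ} {Γ}
    u₀ u₁ : Pt
    u₀ = U , + 0
    u₁ = U , + 1

  module _ (reach : ∀ x → ∃[ σ ] ap σ ⟦ u₀ ⟧ ≡ x) where

    private
      between : ∀ σ σ′ {x y z} → ap σ x ≡ y → ap σ′ x ≡ z → ap (≅-trans (≅-sym σ) σ′) y ≡ z
      between σ σ′ {x} e e′ = trans (cong (λ y → ap σ′ (from σ y)) (sym e)) (trans (cong (ap σ′) (from-app σ x)) e′)

    vertex-transitive : VertexTransitive Γ
    vertex-transitive x y = join (reach x) (reach y)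
      where
      join : ∃[ σ ] ap σ ⟦ u₀ ⟧ ≡ x → ∃[ σ ] ap σ ⟦ u₀ ⟧ ≡ y → ∃[ σ ] ap σ x ≡ y
      join (σ , p) (σ′ , p′) = ≅-trans (≅-sym σ) σ′ , between σ σ′ p p′

    private
      -- Pulling an edge at `x` back to u_0 reduces transitivity on edges or arcs to the six
      -- directions at u_0.
      neighbour : ∀ x y → E Γ x y → ∃[ σ ] ap σ ⟦ u₀ ⟧ ≡ x × ∃[ d ] ap σ ⟦ u₀ ▹ d ⟧ ≡ y
      neighbour x y e = at (reach x)
        where
        at : ∃[ σ ] ap σ ⟦ u₀ ⟧ ≡ x → ∃[ σ ] ap σ ⟦ u₀ ⟧ ≡ x × ∃[ d ] ap σ ⟦ u₀ ▹ d ⟧ ≡ y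
        at (σ , p) = σ , p , along′ (E-app σ (subst₂ (E Γ) (sym p) (sym (app-from σ y)) e))
          where
          along′ : E Γ ⟦ u₀ ⟧ (from σ y) → ∃[ d ] ap σ ⟦ u₀ ▹ d ⟧ ≡ y
          along′ (via d f) = d , trans (cong (ap σ) (trans (≋⇒≡ (move-≋ k s {u₀} {lift ⟦ u₀ ⟧} d (≋-sym (lift-⟦⟧ u₀)))) (trans (≋⇒≡ (≋-sym f)) (⟦lift⟧ (from σ y))))) (app-from σ y)

    module _ (arcs : ∀ d → ∃[ σ ] (ap σ ⟦ u₀ ⟧ ≡ ⟦ u₀ ⟧ × ap σ ⟦ u₁ ⟧ ≡ ⟦ u₀ ▹ d ⟧)) where
      private
        Reached : NestV n → NestV n → Set
        Reached x y = ∃[ σ ] (ap σ ⟦ u₀ ⟧ ≡ x × ap σ ⟦ u₁ ⟧ ≡ y)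

        compose : ∀ {x y d} σ → ap σ ⟦ u₀ ⟧ ≡ x → ap σ ⟦ u₀ ▹ d ⟧ ≡ y →
          ∃[ τ ] (ap τ ⟦ u₀ ⟧ ≡ ⟦ u₀ ⟧ × ap τ ⟦ u₁ ⟧ ≡ ⟦ u₀ ▹ d ⟧) → Reached x y
        compose σ p p′ (τ , q , r) = ≅-trans τ σ , trans (cong (ap σ) q) p , trans (cong (ap σ) r) p′

        reached : ∀ x y → E Γ x y → Reached x y
        reached x y e = let (σ , p , d , p′) = neighbour x y e in compose σ p p′ (arcs d)

      arc-transitive : ArcTransitive Γ
      arc-transitive x y x′ y′ e e′ = join (reached x y e) (reached x′ y′ e′)
        where
        join : Reached x y → Reached x′ y′ → ∃[ σ ] ((ap σ x ≡ x′) × (ap σ y ≡ y′))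
        join (σ , p , q) (σ′ , p′ , q′) = ≅-trans (≅-sym σ) σ′ , between σ σ′ p p′ , between σ σ′ q q′

    module _ (arcs : ∀ d → ∃[ σ ] ((ap σ ⟦ u₀ ⟧ ≡ ⟦ u₀ ⟧ × ap σ ⟦ u₁ ⟧ ≡ ⟦ u₀ ▹ d ⟧) ⊎ (ap σ ⟦ u₀ ⟧ ≡ ⟦ u₀ ▹ d ⟧ × ap σ ⟦ u₁ ⟧ ≡ ⟦ u₀ ⟧))) where
      private
        Reached : NestV n → NestV n → Set
        Reached x y = ∃[ σ ] ((ap σ ⟦ u₀ ⟧ ≡ x × ap σ ⟦ u₁ ⟧ ≡ y) ⊎ (ap σ ⟦ u₀ ⟧ ≡ y × ap σ ⟦ u₁ ⟧ ≡ x))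

        compose : ∀ {x y d} σ → ap σ ⟦ u₀ ⟧ ≡ x → ap σ ⟦ u₀ ▹ d ⟧ ≡ y →
          ∃[ τ ] ((ap τ ⟦ u₀ ⟧ ≡ ⟦ u₀ ⟧ × ap τ ⟦ u₁ ⟧ ≡ ⟦ u₀ ▹ d ⟧) ⊎ (ap τ ⟦ u₀ ⟧ ≡ ⟦ u₀ ▹ d ⟧ × ap τ ⟦ u₁ ⟧ ≡ ⟦ u₀ ⟧)) → Reached x y
        compose σ p p′ (τ , inj₁ (q , r)) = ≅-trans τ σ , inj₁ (trans (cong (ap σ) q) p , trans (cong (ap σ) r) p′)
        compose σ p p′ (τ , inj₂ (q , r)) = ≅-trans τ σ , inj₂ (trans (cong (ap σ) q) p′ , trans (cong (ap σ) r) p)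

        reached : ∀ x y → E Γ x y → Reached x y
        reached x y e = let (σ , p , d , p′) = neighbour x y e in compose σ p p′ (arcs d)

      edge-transitive : EdgeTransitive Γ
      edge-transitive x y x′ y′ e e′ = join (reached x y e) (reached x′ y′ e′)
        where
        join : Reached x y → Reached x′ y′ → ∃[ σ ] (((ap σ x ≡ x′) × (ap σ y ≡ y′)) ⊎ ((ap σ x ≡ y′) × (ap σ y ≡ x′)))
        join (σ , inj₁ (p , q)) (σ′ , inj₁ (p′ , q′)) = ≅-trans (≅-sym σ) σ′ , inj₁ (between σ σ′ p p′ , between σ σ′ q q′)
        join (σ , inj₁ (p , q)) (σ′ , inj₂ (p′ , q′)) = ≅-trans (≅-sym σ) σ′ , inj₂ (between σ σ′ p p′ , between σ σ′ q q′)
        join (σ , inj₂ (p , q)) (σ′ , inj₁ (p′ , q′)) = ≅-trans (≅-sym σ) σ′ , inj₂ (between σ σ′ q q′ , between σ σ′ p p′)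
        join (σ , inj₂ (p , q)) (σ′ , inj₂ (p′ , q′)) = ≅-trans (≅-sym σ) σ′ , inj₁ (between σ σ′ q q′ , between σ σ′ p p′)

module Translation (n : ℕ) .{{nz : NonZero n}} (k : ℤ) (s : Fin 4 → ℤ) where
  open Walks n k s

  translate : ℤ → Pt → Pt
  translate m (x , i) = x , i + m

  private
    translate-≋ : ∀ m {p q} → p ≋ q → translate m p ≋ translate m q
    translate-≋ m {_ , i} {_ , j} (e ⨾ d) = e ⨾ lin₁ (+ 1) d (lem i j m)
      where
      lem : ∀ i j m → i + m - (j + m) ≡ + 1 * (i - j)
      lem = solve-∀

    undo : ∀ m p → translate (- m) (translate m p) ≋ p
    undo m (x , i) = refl ⨾ ≡⇒∣ (lem i m)
      where
      lem : ∀ i m → i + m + - m ≡ i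
      lem = solve-∀

    redo : ∀ m p → translate m (translate (- m) p) ≋ p
    redo m (x , i) = refl ⨾ ≡⇒∣ (lem i m)
      where
      lem : ∀ i m → i + - m + m ≡ i
      lem = solve-∀

    translate-adj : ∀ m p d → Adj k s (translate m p) (translate m (p ▹ d))
    translate-adj m (x , i) d = via d (refl ⨾ ≡⇒∣ (lem i m (shift k s x d)))
      where
      lem : ∀ i m z → i + z + m ≡ i + m + z
      lem = solve-∀

  translation : ℤ → Aut Γ
  translation m = mkIso (translate m) (translate (- m)) (translate-≋ m) (translate-≋ (- m)) (redo m) (undo m) (translate-adj m) (translate-adj (- m))

  translation-app : ∀ m p → app {Γ} {Γ} (translation m) ⟦ p ⟧ ≡ ⟦ translate m p ⟧
  translation-app m = mkIso-app (translate m) (translate (- m)) (translate-≋ m) (translate-≋ (- m)) (redo m) (undo m) (translate-adj m) (translate-adj (- m))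

-- Common form of (ii), with t = 0, and (iii), with 2t = n/2. `h₁` says 2k = 2. Up to multiples of
-- 4t, `h₃` is the relation that the rotation draws from r^b g^2 = 1, and `h₂` is the one from the
-- commutator relation, so the necessary conditions reappear as hypotheses.
module Homogeneous (n : ℕ) .{{nz : NonZero n}} (e t ν : ℤ) (n≡ : + n ≡ + 2 * ν)
  (h₁ : + n ∣ + 4 * t) (h₂ : + n ∣ + 2 * t * (e + + 1)) (h₃ : + n ∣ + 2 * (e * e - e + + 1) - + 2 * t) where

  k a b : ℤ
  k = + 1 + + 2 * t
  a = + 2 * e - + 1 - + 2 * t
  b = + 2 * e

  open Walks n k (spokes (+ 0) (+ 1) a b) public

  private
    s = spokes (+ 0) (+ 1) a b

  sameSide : ∀ {x i j} → + n ∣ i - j → (x , i) ≋ (x , j)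
  sameSide d = refl ⨾ d

  lin₄ : ∀ {z} α β γ → z ≡ α * (+ 4 * t) + β * (+ 2 * t * (e + + 1)) + γ * (+ 2 * (e * e - e + + 1) - + 2 * t) → + n ∣ z
  lin₄ α β γ = lin₃ α β γ h₁ h₂ h₃

  -- It suffices to look at rim and hub edges in forward direction and at spokes from their u-end.
  module _ (f : Pt → Pt) (f-≋ : ∀ {p q} → p ≋ q → f p ≋ f q)
    (rims : ∀ i → Adj k s (f (U , i)) (f (U , i + + 1)))
    (hubs : ∀ i → Adj k s (f (W , i)) (f (W , i + k)))
    (spks : ∀ i j → Adj k s (f (U , i)) (f (W , i + s j))) where

    from-positive : ∀ p d → Adj k s (f p) (f (p ▹ d))
    from-positive (U , i) fwd     = rims i
    from-positive (W , i) fwd     = hubs i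
    from-positive (U , i) (spk j) = spks i j
    from-positive (U , i) bwd     = Adj-sym k s (Adj-≋ k s ≋-refl (f-≋ (sameSide (≡⇒∣ (lem i (+ 1))))) (rims (i + - + 1)))
      where
      lem : ∀ i x → i + - x + x ≡ i
      lem = solve-∀
    from-positive (W , i) bwd     = Adj-sym k s (Adj-≋ k s ≋-refl (f-≋ (sameSide (≡⇒∣ (lem i k)))) (hubs (i + - k)))
      where
      lem : ∀ i x → i + - x + x ≡ i
      lem = solve-∀
    from-positive (W , i) (spk j) = Adj-sym k s (Adj-≋ k s ≋-refl (f-≋ (sameSide (≡⇒∣ (lem i (s j))))) (spks (i + - s j) j))
      where
      lem : ∀ i x → i + - x + x ≡ i
      lem = solve-∀

  -- The rotation about u_0 taking r to g, g to -r - g.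
  ω-at : ∀ (x : Side) {i} → Parity i → Pt
  ω-at U (isEven j _) = U , - (+ 2 * j * e)
  ω-at U (isOdd j _)  = W , - (+ 2 * j * e)
  ω-at W (isEven j _) = W , a - + 2 * j * e
  ω-at W (isOdd j _)  = U , - (+ 2 * j * e) - + 1

  ω : Pt → Pt
  ω (x , i) = ω-at x (parity i)

  private
    2∣ : ∀ {x} → + n ∣ x → + 2 ∣ x
    2∣ {x} (divides q x≡) = divides (q * ν) (trans x≡ (trans (cong (q *_) n≡) (lem q ν)))
      where
      lem : ∀ q ν → q * (+ 2 * ν) ≡ q * ν * + 2
      lem = solve-∀

    clash : ∀ {i i′} j j′ → + n ∣ i - i′ → i ≡ + 2 * j → i′ ≡ + 2 * j′ + + 1 → ⊥
    clash j j′ d refl refl = even≢odd (j′ - j) (lin₁ (- + 1) (2∣ d) (lem j j′))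
      where
      lem : ∀ j j′ → + 2 * (j′ - j) + + 1 ≡ - + 1 * (+ 2 * j - (+ 2 * j′ + + 1))
      lem = solve-∀

    clash′ : ∀ {i i′} j j′ → + n ∣ i - i′ → i ≡ + 2 * j + + 1 → i′ ≡ + 2 * j′ → ⊥
    clash′ j j′ d refl refl = even≢odd (j - j′) (lin₁ (+ 1) (2∣ d) (lem j j′))
      where
      lem : ∀ j j′ → + 2 * (j - j′) + + 1 ≡ + 1 * (+ 2 * j + + 1 - + 2 * j′)
      lem = solve-∀

    twoE : ∀ {i i′} j j′ → + n ∣ i - i′ → i ≡ + 2 * j → i′ ≡ + 2 * j′ → + n ∣ + 2 * (j - j′)
    twoE j j′ d refl refl = lin₁ (+ 1) d (lem j j′)
      where
      lem : ∀ j j′ → + 2 * (j - j′) ≡ + 1 * (+ 2 * j - + 2 * j′)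
      lem = solve-∀

    twoO : ∀ {i i′} j j′ → + n ∣ i - i′ → i ≡ + 2 * j + + 1 → i′ ≡ + 2 * j′ + + 1 → + n ∣ + 2 * (j - j′)
    twoO j j′ d refl refl = lin₁ (+ 1) d (lem j j′)
      where
      lem : ∀ j j′ → + 2 * (j - j′) ≡ + 1 * (+ 2 * j + + 1 - (+ 2 * j′ + + 1))
      lem = solve-∀

    -- Congruent indices have the same parity because n is even. Their halves agree only modulo n/2,
    -- which suffices as `ω` uses the halves doubled.
    ω-at-≋ : ∀ (x : Side) {i i′} → + n ∣ i - i′ → (P : Parity i) (P′ : Parity i′) → ω-at x P ≋ ω-at x P′
    ω-at-≋ U d (isEven j p) (isEven j′ p′) = refl ⨾ lin₁ (- e) (twoE j j′ d p p′) (lem j j′ e)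
      where
      lem : ∀ j j′ e → - (+ 2 * j * e) - - (+ 2 * j′ * e) ≡ - e * (+ 2 * (j - j′))
      lem = solve-∀
    ω-at-≋ W d (isEven j p) (isEven j′ p′) = refl ⨾ lin₁ (- e) (twoE j j′ d p p′) (lem j j′ e a)
      where
      lem : ∀ j j′ e a → a - + 2 * j * e - (a - + 2 * j′ * e) ≡ - e * (+ 2 * (j - j′))
      lem = solve-∀
    ω-at-≋ U d (isOdd j p) (isOdd j′ p′) = refl ⨾ lin₁ (- e) (twoO j j′ d p p′) (lem j j′ e)
      where
      lem : ∀ j j′ e → - (+ 2 * j * e) - - (+ 2 * j′ * e) ≡ - e * (+ 2 * (j - j′))
      lem = solve-∀
    ω-at-≋ W d (isOdd j p) (isOdd j′ p′) = refl ⨾ lin₁ (- e) (twoO j j′ d p p′) (lem j j′ e)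
      where
      lem : ∀ j j′ e → - (+ 2 * j * e) - + 1 - (- (+ 2 * j′ * e) - + 1) ≡ - e * (+ 2 * (j - j′))
      lem = solve-∀
    ω-at-≋ x d (isEven j p) (isOdd j′ p′) = ⊥-elim (clash j j′ d p p′)
    ω-at-≋ x d (isOdd j p) (isEven j′ p′) = ⊥-elim (clash′ j j′ d p p′)

  ω-≋ : ∀ {p q} → p ≋ q → ω p ≋ ω q
  ω-≋ {x , i} {.x , i′} (refl ⨾ d) = ω-at-≋ x d (parity i) (parity i′)

  ω-even : ∀ (x : Side) {i} j → + n ∣ i - + 2 * j → ω (x , i) ≋ ω-at x {+ 2 * j} (isEven j refl)
  ω-even x {i} j d = ω-at-≋ x d (parity i) (isEven j refl)

  ω-odd : ∀ (x : Side) {i} j → + n ∣ i - (+ 2 * j + + 1) → ω (x , i) ≋ ω-at x {+ 2 * j + + 1} (isOdd j refl)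
  ω-odd x {i} j d = ω-at-≋ x d (parity i) (isOdd j refl)

  private
    link : ∀ {p q p′ q′} d → p ≋ p′ → q ≋ q′ → q′ ≋ p′ ▹ d → Adj k s p q
    link d e f g = Adj-≋ k s (≋-sym e) (≋-sym f) (via d g)

    -- The index differences below depend on j, e and t only.
    ω-rims : ∀ i → Adj k s (ω (U , i)) (ω (U , i + + 1))
    ω-rims i with parity i
    ... | isEven j refl = link (spk i₀) ≋-refl (ω-odd U {+ 2 * j + + 1} j (≡⇒∣ {+ 2 * j + + 1} refl)) (refl ⨾ ≡⇒∣ (lem (- (+ 2 * j * e))))
      where
      lem : ∀ x → x ≡ x + + 0
      lem = solve-∀
    ... | isOdd j refl = link (spk i₃) ≋-refl (ω-even U (j + + 1) (≡⇒∣ (l₁ j))) (refl ⨾ ≡⇒∣ (l₂ j e))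
      where
      l₁ : ∀ j → + 2 * j + + 1 + + 1 ≡ + 2 * (j + + 1)
      l₁ = solve-∀
      l₂ : ∀ j e → - (+ 2 * (j + + 1) * e) ≡ - (+ 2 * j * e) + - (+ 2 * e)
      l₂ = solve-∀

    ω-hubs : ∀ i → Adj k s (ω (W , i)) (ω (W , i + k))
    ω-hubs i with parity i
    ... | isEven j refl = link (spk i₃) ≋-refl (ω-odd W (j + t) (≡⇒∣ (l₁ j t))) (refl ⨾ lin₄ (+ 1) (- + 1) (+ 0) (l₂ j e t))
      where
      l₁ : ∀ j t → + 2 * j + (+ 1 + + 2 * t) ≡ + 2 * (j + t) + + 1
      l₁ = solve-∀
      l₂ : ∀ j e t → - (+ 2 * (j + t) * e) - + 1 - ((+ 2 * e - + 1 - + 2 * t) - + 2 * j * e + - (+ 2 * e)) ≡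
        + 1 * (+ 4 * t) + - + 1 * (+ 2 * t * (e + + 1)) + + 0 * (+ 2 * (e * e - e + + 1) - + 2 * t)
      l₂ = solve-∀
    ... | isOdd j refl = link (spk i₀) ≋-refl (ω-even W (j + + 1 + t) (≡⇒∣ (l₁ j t))) (refl ⨾ lin₄ (+ 0) (- + 1) (+ 0) (l₂ j e t))
      where
      l₁ : ∀ j t → + 2 * j + + 1 + (+ 1 + + 2 * t) ≡ + 2 * (j + + 1 + t)
      l₁ = solve-∀
      l₂ : ∀ j e t → (+ 2 * e - + 1 - + 2 * t) - + 2 * (j + + 1 + t) * e - (- (+ 2 * j * e) - + 1 + + 0) ≡
        + 0 * (+ 4 * t) + - + 1 * (+ 2 * t * (e + + 1)) + + 0 * (+ 2 * (e * e - e + + 1) - + 2 * t)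
      l₂ = solve-∀

    ω-spks : ∀ i j → Adj k s (ω (U , i)) (ω (W , i + s j))
    ω-spks i m with parity i
    ω-spks _ i₀ | isEven j refl = link (spk i₂) ≋-refl (ω-even W {+ 2 * j + + 0} j (≡⇒∣ (ℤ.+-identityʳ (+ 2 * j)))) (refl ⨾ ≡⇒∣ (l a j e))
      where
      l : ∀ a j e → a - + 2 * j * e ≡ - (+ 2 * j * e) + a
      l = solve-∀
    ω-spks _ i₁ | isEven j refl = link bwd ≋-refl (ω-odd W {+ 2 * j + + 1} j (≡⇒∣ {+ 2 * j + + 1} refl)) (refl ⨾ ≡⇒∣ (l j e))
      where
      l : ∀ j e → - (+ 2 * j * e) - + 1 ≡ - (+ 2 * j * e) + - + 1
      l = solve-∀
    ω-spks _ i₂ | isEven j refl = link fwd ≋-refl (ω-odd W (j + e - + 1 - t) (≡⇒∣ (l₁ j e t))) (refl ⨾ lin₄ (- + 1) (+ 1) (- + 1) (l₂ j e t))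
      where
      l₁ : ∀ j e t → + 2 * j + (+ 2 * e - + 1 - + 2 * t) ≡ + 2 * (j + e - + 1 - t) + + 1
      l₁ = solve-∀
      l₂ : ∀ j e t → - (+ 2 * (j + e - + 1 - t) * e) - + 1 - (- (+ 2 * j * e) + + 1) ≡
        - + 1 * (+ 4 * t) + + 1 * (+ 2 * t * (e + + 1)) + - + 1 * (+ 2 * (e * e - e + + 1) - + 2 * t)
      l₂ = solve-∀
    ω-spks _ i₃ | isEven j refl = link (spk i₁) ≋-refl (ω-even W (j + e) (≡⇒∣ (l₁ j e))) (refl ⨾ lin₄ (- + 1) (+ 0) (- + 1) (l₂ j e t))
      where
      l₁ : ∀ j e → + 2 * j + + 2 * e ≡ + 2 * (j + e)
      l₁ = solve-∀
      l₂ : ∀ j e t → (+ 2 * e - + 1 - + 2 * t) - + 2 * (j + e) * e - (- (+ 2 * j * e) + + 1) ≡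
        - + 1 * (+ 4 * t) + + 0 * (+ 2 * t * (e + + 1)) + - + 1 * (+ 2 * (e * e - e + + 1) - + 2 * t)
      l₂ = solve-∀
    ω-spks _ i₀ | isOdd j refl = link (spk i₁) ≋-refl (ω-odd W {+ 2 * j + + 1 + + 0} j (≡⇒∣ (ℤ.+-identityʳ (+ 2 * j + + 1)))) (refl ⨾ ≡⇒∣ { - (+ 2 * j * e) - + 1} refl)
    ω-spks _ i₁ | isOdd j refl = link bwd ≋-refl (ω-even W (j + + 1) (≡⇒∣ (l₁ j))) (refl ⨾ ≡⇒∣ (l₂ j e t))
      where
      l₁ : ∀ j → + 2 * j + + 1 + + 1 ≡ + 2 * (j + + 1)
      l₁ = solve-∀
      l₂ : ∀ j e t → (+ 2 * e - + 1 - + 2 * t) - + 2 * (j + + 1) * e ≡ - (+ 2 * j * e) + - (+ 1 + + 2 * t)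
      l₂ = solve-∀
    ω-spks _ i₂ | isOdd j refl = link fwd ≋-refl (ω-even W (j + e - t) (≡⇒∣ (l₁ j e t))) (refl ⨾ lin₄ (- + 2) (+ 1) (- + 1) (l₂ j e t))
      where
      l₁ : ∀ j e t → + 2 * j + + 1 + (+ 2 * e - + 1 - + 2 * t) ≡ + 2 * (j + e - t)
      l₁ = solve-∀
      l₂ : ∀ j e t → (+ 2 * e - + 1 - + 2 * t) - + 2 * (j + e - t) * e - (- (+ 2 * j * e) + (+ 1 + + 2 * t)) ≡
        - + 2 * (+ 4 * t) + + 1 * (+ 2 * t * (e + + 1)) + - + 1 * (+ 2 * (e * e - e + + 1) - + 2 * t)
      l₂ = solve-∀
    ω-spks _ i₃ | isOdd j refl = link (spk i₂) ≋-refl (ω-odd W (j + e) (≡⇒∣ (l₁ j e))) (refl ⨾ lin₄ (- + 1) (+ 0) (- + 1) (l₂ j e t))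
      where
      l₁ : ∀ j e → + 2 * j + + 1 + + 2 * e ≡ + 2 * (j + e) + + 1
      l₁ = solve-∀
      l₂ : ∀ j e t → - (+ 2 * (j + e) * e) - + 1 - (- (+ 2 * j * e) + - (+ 2 * e - + 1 - + 2 * t)) ≡
        - + 1 * (+ 4 * t) + + 0 * (+ 2 * t * (e + + 1)) + - + 1 * (+ 2 * (e * e - e + + 1) - + 2 * t)
      l₂ = solve-∀

  ω-adj : ∀ p d → Adj k s (ω p) (ω (p ▹ d))
  ω-adj = from-positive ω ω-≋ ω-rims ω-hubs ω-spks

  private
    then : ∀ p q r → ω p ≋ q → ω q ≋ r → ω (ω p) ≋ r
    then p q r f g = ≋-trans (ω-≋ {ω p} {q} f) g

    l-even : ∀ j e → - (+ 2 * j * e) ≡ + 2 * - (j * e)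
    l-even = solve-∀

  private
    ω³-at : ∀ (x : Side) {i} (P : Parity i) → ω (ω (ω-at x P)) ≋ (x , i)
    ω³-at U (isEven j refl) = ≋-trans (then (U , - (+ 2 * j * e)) (U , - (+ 2 * - (j * e) * e)) (U , - (+ 2 * (j * e * e) * e)) (ω-even U (- (j * e)) (≡⇒∣ (l-even j e))) (ω-even U (j * e * e) (≡⇒∣ (l₁ j e)))) (refl ⨾ lin₄ (+ 0) (- j) (- (j * (e + + 1))) (l₂ j e t))
      where
      l₁ : ∀ j e → - (+ 2 * - (j * e) * e) ≡ + 2 * (j * e * e)
      l₁ = solve-∀
      l₂ : ∀ j e t → - (+ 2 * (j * e * e) * e) - + 2 * j ≡
        + 0 * (+ 4 * t) + - j * (+ 2 * t * (e + + 1)) + - (j * (e + + 1)) * (+ 2 * (e * e - e + + 1) - + 2 * t)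
      l₂ = solve-∀
    ω³-at U (isOdd j refl) = ≋-trans (then (W , - (+ 2 * j * e)) (W , a - + 2 * - (j * e) * e) (U , - (+ 2 * (e - + 1 - t + j * e * e) * e) - + 1) (ω-even W (- (j * e)) (≡⇒∣ (l-even j e))) (ω-odd W (e - + 1 - t + j * e * e) (≡⇒∣ (l₁ j e t))))
        (refl ⨾ lin₄ (- + 1) (+ 1 - j) (- + 1 - j * (e + + 1)) (l₂ j e t))
      where
      l₁ : ∀ j e t → (+ 2 * e - + 1 - + 2 * t) - + 2 * - (j * e) * e ≡ + 2 * (e - + 1 - t + j * e * e) + + 1
      l₁ = solve-∀
      l₂ : ∀ j e t → - (+ 2 * (e - + 1 - t + j * e * e) * e) - + 1 - (+ 2 * j + + 1) ≡
        - + 1 * (+ 4 * t) + (+ 1 - j) * (+ 2 * t * (e + + 1)) + (- + 1 - j * (e + + 1)) * (+ 2 * (e * e - e + + 1) - + 2 * t)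
      l₂ = solve-∀
    ω³-at W (isEven j refl) = ≋-trans (then (W , a - + 2 * j * e) (U , - (+ 2 * (e - + 1 - t - j * e) * e) - + 1) (W , - (+ 2 * (- ((e - + 1 - t - j * e) * e) - + 1) * e)) (ω-odd W (e - + 1 - t - j * e) (≡⇒∣ (l₁ j e t))) (ω-odd U (- ((e - + 1 - t - j * e) * e) - + 1) (≡⇒∣ (l₂ j e t))))
        (refl ⨾ lin₄ (- + 1) (+ 2 - e - j) (e - j * (e + + 1)) (l₃ j e t))
      where
      l₁ : ∀ j e t → (+ 2 * e - + 1 - + 2 * t) - + 2 * j * e ≡ + 2 * (e - + 1 - t - j * e) + + 1
      l₁ = solve-∀
      l₂ : ∀ j e t → - (+ 2 * (e - + 1 - t - j * e) * e) - + 1 ≡ + 2 * (- ((e - + 1 - t - j * e) * e) - + 1) + + 1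
      l₂ = solve-∀
      l₃ : ∀ j e t → - (+ 2 * (- ((e - + 1 - t - j * e) * e) - + 1) * e) - + 2 * j ≡
        - + 1 * (+ 4 * t) + (+ 2 - e - j) * (+ 2 * t * (e + + 1)) + (e - j * (e + + 1)) * (+ 2 * (e * e - e + + 1) - + 2 * t)
      l₃ = solve-∀
    ω³-at W (isOdd j refl) = ≋-trans (then (U , - (+ 2 * j * e) - + 1) (W , - (+ 2 * (- (j * e) - + 1) * e)) (W , a - + 2 * ((j * e + + 1) * e) * e) (ω-odd U (- (j * e) - + 1) (≡⇒∣ (l₁ j e))) (ω-even W ((j * e + + 1) * e) (≡⇒∣ (l₂ j e))))
        (refl ⨾ lin₄ (- + 1) (- j) (- + 1 - j * (e + + 1)) (l₃ j e t))
      where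
      l₁ : ∀ j e → - (+ 2 * j * e) - + 1 ≡ + 2 * (- (j * e) - + 1) + + 1
      l₁ = solve-∀
      l₂ : ∀ j e → - (+ 2 * (- (j * e) - + 1) * e) ≡ + 2 * ((j * e + + 1) * e)
      l₂ = solve-∀
      l₃ : ∀ j e t → (+ 2 * e - + 1 - + 2 * t) - + 2 * ((j * e + + 1) * e) * e - (+ 2 * j + + 1) ≡
        - + 1 * (+ 4 * t) + - j * (+ 2 * t * (e + + 1)) + (- + 1 - j * (e + + 1)) * (+ 2 * (e * e - e + + 1) - + 2 * t)
      l₃ = solve-∀

  -- Provides `ω ∘ ω` as the inverse, so that adjacency for the inverse follows from adjacency for
  -- `ω`.
  ω³ : ∀ p → ω (ω (ω p)) ≋ p
  ω³ (x , i) = ω³-at x (parity i)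

  private
    ωω-adj : ∀ p d → Adj k s (ω (ω p)) (ω (ω (p ▹ d)))
    ωω-adj p d with ω-adj p d
    ... | via d′ m = Adj-≋ k s ≋-refl (≋-sym (ω-≋ {ω (p ▹ d)} {ω p ▹ d′} m)) (ω-adj (ω p) d′)

  rotation : Aut Γ
  rotation = mkIso ω (ω ∘ ω) ω-≋ (ω-≋ ∘ ω-≋) ω³ ω³ ω-adj ωω-adj

  rotation-app : ∀ {p q} → ω p ≋ q → app {Γ} {Γ} rotation ⟦ p ⟧ ≡ ⟦ q ⟧
  rotation-app {p} m = trans (mkIso-app ω (ω ∘ ω) ω-≋ (ω-≋ ∘ ω-≋) ω³ ω³ ω-adj ωω-adj p) (≋⇒≡ m)

  -- The translation by g.
  γ γ⁻ : Pt → Pt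
  γ  (U , i) = W , k * i
  γ  (W , i) = U , k * i - b
  γ⁻ (U , i) = W , k * (i + b)
  γ⁻ (W , i) = U , k * i

  private
    scaled : ∀ k i j c → k * i - c - (k * j - c) ≡ k * (i - j)
    scaled = solve-∀

    γ-≋ : ∀ {p q} → p ≋ q → γ p ≋ γ q
    γ-≋ {U , i} {.U , j} (refl ⨾ d) = refl ⨾ lin₁ k d (lem k i j)
      where
      lem : ∀ k i j → k * i - k * j ≡ k * (i - j)
      lem = solve-∀
    γ-≋ {W , i} {.W , j} (refl ⨾ d) = refl ⨾ lin₁ k d (scaled k i j b)

    γ⁻-≋ : ∀ {p q} → p ≋ q → γ⁻ p ≋ γ⁻ q
    γ⁻-≋ {U , i} {.U , j} (refl ⨾ d) = refl ⨾ lin₁ k d (lem k i j b)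
      where
      lem : ∀ k i j c → k * (i + c) - k * (j + c) ≡ k * (i - j)
      lem = solve-∀
    γ⁻-≋ {W , i} {.W , j} (refl ⨾ d) = refl ⨾ lin₁ k d (lem k i j)
      where
      lem : ∀ k i j → k * i - k * j ≡ k * (i - j)
      lem = solve-∀

    -- k^2 - 1 = (1 + t) * 4t. Multiplication by `k`, which turns rim steps into hub steps, is
    -- therefore an involution modulo n.
    square : ∀ i → + n ∣ k * (k * i) - i
    square i = lin₁ ((+ 1 + t) * i) h₁ (lem t i)
      where
      lem : ∀ t i → (+ 1 + + 2 * t) * ((+ 1 + + 2 * t) * i) - i ≡ (+ 1 + t) * i * (+ 4 * t)
      lem = solve-∀

    γγ⁻ : ∀ p → γ (γ⁻ p) ≋ p
    γγ⁻ (U , i) = refl ⨾ lin₁ (+ 1) (square (i + b)) (lem (k * (k * (i + b))) i b)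
      where
      lem : ∀ x i b → x - b - i ≡ + 1 * (x - (i + b))
      lem = solve-∀
    γγ⁻ (W , i) = refl ⨾ square i

    γ⁻γ : ∀ p → γ⁻ (γ p) ≋ p
    γ⁻γ (U , i) = refl ⨾ square i
    γ⁻γ (W , i) = refl ⨾ lin₁ (+ 1) (square i) (lem k i b)
      where
      lem : ∀ k i b → k * (k * i - b + b) - i ≡ + 1 * (k * (k * i) - i)
      lem = solve-∀

    γ-spks : ∀ i j → Adj k s (γ (U , i)) (γ (W , i + s j))
    γ-spks i i₀ = via (spk i₃) (refl ⨾ ≡⇒∣ (lem k i b))
      where
      lem : ∀ k i b → k * (i + + 0) - b ≡ k * i + - b
      lem = solve-∀
    γ-spks i i₁ = via (spk i₂) (refl ⨾ ≡⇒∣ (lem i e t))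
      where
      lem : ∀ i e t → (+ 1 + + 2 * t) * (i + + 1) - + 2 * e ≡ (+ 1 + + 2 * t) * i + - (+ 2 * e - + 1 - + 2 * t)
      lem = solve-∀
    γ-spks i i₂ = via (spk i₁) (refl ⨾ lin₁ (e - + 1 - t) h₁ (lem i e t))
      where
      lem : ∀ i e t → (+ 1 + + 2 * t) * (i + (+ 2 * e - + 1 - + 2 * t)) - + 2 * e - ((+ 1 + + 2 * t) * i + - + 1) ≡ (e - + 1 - t) * (+ 4 * t)
      lem = solve-∀
    γ-spks i i₃ = via (spk i₀) (refl ⨾ lin₁ e h₁ (lem i e t))
      where
      lem : ∀ i e t → (+ 1 + + 2 * t) * (i + + 2 * e) - + 2 * e - ((+ 1 + + 2 * t) * i + + 0) ≡ e * (+ 4 * t)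
      lem = solve-∀

    γ-adj : ∀ p d → Adj k s (γ p) (γ (p ▹ d))
    γ-adj = from-positive γ γ-≋
      (λ i → via fwd (refl ⨾ ≡⇒∣ (l₁ k i)))
      (λ i → via fwd (refl ⨾ lin₁ (+ 1 + t) h₁ (l₂ i e t)))
      γ-spks
      where
      l₁ : ∀ k i → k * (i + + 1) ≡ k * i + k
      l₁ = solve-∀
      l₂ : ∀ i e t → (+ 1 + + 2 * t) * (i + (+ 1 + + 2 * t)) - + 2 * e - ((+ 1 + + 2 * t) * i - + 2 * e + + 1) ≡ (+ 1 + t) * (+ 4 * t)
      l₂ = solve-∀

    γ⁻-spks : ∀ i j → Adj k s (γ⁻ (U , i)) (γ⁻ (W , i + s j))
    γ⁻-spks i i₀ = via (spk i₃) (refl ⨾ lin₁ (- e) h₁ (lem i e t))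
      where
      lem : ∀ i e t → (+ 1 + + 2 * t) * (i + + 0) - ((+ 1 + + 2 * t) * (i + + 2 * e) + - (+ 2 * e)) ≡ - e * (+ 4 * t)
      lem = solve-∀
    γ⁻-spks i i₁ = via (spk i₂) (refl ⨾ lin₁ (- e) h₁ (lem i e t))
      where
      lem : ∀ i e t → (+ 1 + + 2 * t) * (i + + 1) - ((+ 1 + + 2 * t) * (i + + 2 * e) + - (+ 2 * e - + 1 - + 2 * t)) ≡ - e * (+ 4 * t)
      lem = solve-∀
    γ⁻-spks i i₂ = via (spk i₁) (refl ⨾ lin₁ (- (+ 1 + t)) h₁ (lem i e t))
      where
      lem : ∀ i e t → (+ 1 + + 2 * t) * (i + (+ 2 * e - + 1 - + 2 * t)) - ((+ 1 + + 2 * t) * (i + + 2 * e) + - + 1) ≡ - (+ 1 + t) * (+ 4 * t)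
      lem = solve-∀
    γ⁻-spks i i₃ = via (spk i₀) (refl ⨾ ≡⇒∣ (lem (k * (i + b))))
      where
      lem : ∀ x → x ≡ x + + 0
      lem = solve-∀

    γ⁻-adj : ∀ p d → Adj k s (γ⁻ p) (γ⁻ (p ▹ d))
    γ⁻-adj = from-positive γ⁻ γ⁻-≋
      (λ i → via fwd (refl ⨾ ≡⇒∣ (l₁ k i b)))
      (λ i → via fwd (refl ⨾ lin₁ (+ 1 + t) h₁ (l₂ i t)))
      γ⁻-spks
      where
      l₁ : ∀ k i b → k * (i + + 1 + b) ≡ k * (i + b) + k
      l₁ = solve-∀
      l₂ : ∀ i t → (+ 1 + + 2 * t) * (i + (+ 1 + + 2 * t)) - ((+ 1 + + 2 * t) * i + + 1) ≡ (+ 1 + t) * (+ 4 * t)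
      l₂ = solve-∀

  exchange : Aut Γ
  exchange = mkIso γ γ⁻ γ-≋ γ⁻-≋ γγ⁻ γ⁻γ γ-adj γ⁻-adj

  exchange-app : ∀ p → app {Γ} {Γ} exchange ⟦ p ⟧ ≡ ⟦ γ p ⟧
  exchange-app = mkIso-app γ γ⁻ γ-≋ γ⁻-≋ γγ⁻ γ⁻γ γ-adj γ⁻-adj

  open Translation n k s
  open Transitivity n k s

  private
    ap = app {Γ} {Γ}

    reach : ∀ x → ∃[ σ ] ap σ ⟦ U , + 0 ⟧ ≡ x
    reach x = go (lift x) (⟦lift⟧ x)
      where
      go : ∀ p → ⟦ p ⟧ ≡ x → ∃[ σ ] ap σ ⟦ U , + 0 ⟧ ≡ x
      go (U , i) e = translation i , trans (translation-app i (U , + 0)) (trans (≋⇒≡ {U , + 0 + i} {U , i} (refl ⨾ ≡⇒∣ (ℤ.+-identityˡ i))) e)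
      go (W , i) e = ≅-trans exchange (translation i) , trans (cong (ap (translation i)) (exchange-app (U , + 0)))
        (trans (translation-app i (W , k * + 0)) (trans (≋⇒≡ {W , k * + 0 + i} {W , i} (refl ⨾ ≡⇒∣ (lem k i))) e))
        where
        lem : ∀ k i → k * + 0 + i ≡ i
        lem = solve-∀

    u₀ u₁ v₀ : Pt
    u₀ = U , + 0
    u₁ = U , + 1
    v₀ = W , + 0

    ωu₀ : ap rotation ⟦ u₀ ⟧ ≡ ⟦ u₀ ⟧
    ωu₀ = rotation-app {u₀} {u₀} (≋-trans (ω-even U {+ 0} (+ 0) (≡⇒∣ {+ 0} refl)) (refl ⨾ ≡⇒∣ {+ 0} refl))

    ωu₁ : ap rotation ⟦ u₁ ⟧ ≡ ⟦ v₀ ⟧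
    ωu₁ = rotation-app {u₁} {v₀} (≋-trans (ω-odd U {+ 1} (+ 0) (≡⇒∣ {+ 1} refl)) (refl ⨾ ≡⇒∣ {+ 0} refl))

    ωv₀ : ap rotation ⟦ v₀ ⟧ ≡ ⟦ W , a ⟧
    ωv₀ = rotation-app {v₀} {W , a} (≋-trans (ω-even W {+ 0} (+ 0) (≡⇒∣ {+ 0} refl)) (refl ⨾ ≡⇒∣ (ℤ.+-identityʳ a)))

    +0≋ : ∀ (x : Side) i → ⟦ x , i ⟧ ≡ ⟦ x , + 0 + i ⟧
    +0≋ x i = ≋⇒≡ {x , i} {x , + 0 + i} (refl ⨾ ≡⇒∣ (sym (ℤ.+-identityˡ i)))

    ρ₂ : Aut Γ
    ρ₂ = ≅-trans rotation rotation

    ρ₂u₀ : ap ρ₂ ⟦ u₀ ⟧ ≡ ⟦ u₀ ⟧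
    ρ₂u₀ = trans (cong (ap rotation) ωu₀) ωu₀

    ρ₂u₁ : ap ρ₂ ⟦ u₁ ⟧ ≡ ⟦ W , a ⟧
    ρ₂u₁ = trans (cong (ap rotation) ωu₁) ωv₀

    -- After σ, apply g r^m.
    shifted : ∀ σ m {p q} r → ap σ ⟦ p ⟧ ≡ ⟦ q ⟧ → translate m (γ q) ≋ r → ap (≅-trans σ (≅-trans exchange (translation m))) ⟦ p ⟧ ≡ ⟦ r ⟧
    shifted σ m {q = q} r e f = trans (cong (ap (translation m) ∘ ap exchange) e)
      (trans (cong (ap (translation m)) (exchange-app q)) (trans (translation-app m (γ q)) (≋⇒≡ f)))

    -- Rotation takes the rim arc to the directions r, g and -r - g. The other three edges are
    -- reached from these by a translation that brings the far end to u_0, hence with their ends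
    -- exchanged.
    half-arcs : ∀ d → ∃[ σ ] ((ap σ ⟦ u₀ ⟧ ≡ ⟦ u₀ ⟧ × ap σ ⟦ u₁ ⟧ ≡ ⟦ u₀ ▹ d ⟧) ⊎ (ap σ ⟦ u₀ ⟧ ≡ ⟦ u₀ ▹ d ⟧ × ap σ ⟦ u₁ ⟧ ≡ ⟦ u₀ ⟧))
    half-arcs fwd      = translation (+ 0) , inj₁ (translation-app (+ 0) u₀ , translation-app (+ 0) u₁)
    half-arcs bwd      = translation (- + 1) , inj₂ (translation-app (- + 1) u₀ , translation-app (- + 1) u₁)
    half-arcs (spk i₀) = rotation , inj₁ (ωu₀ , ωu₁)
    half-arcs (spk i₂) = ρ₂ , inj₁ (ρ₂u₀ , trans ρ₂u₁ (+0≋ W a))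
    half-arcs (spk i₁) = ≅-trans ρ₂ (≅-trans exchange (translation (+ 1))) , inj₂
      ( shifted ρ₂ (+ 1) {u₀} {u₀} (W , + 0 + + 1) ρ₂u₀ (refl ⨾ ≡⇒∣ (l₁ k))
      , shifted ρ₂ (+ 1) {u₁} {W , a} u₀ ρ₂u₁ (refl ⨾ lin₁ (e - + 1 - t) h₁ (l₂ e t)))
      where
      l₁ : ∀ k → k * + 0 + + 1 ≡ + 0 + + 1
      l₁ = solve-∀
      l₂ : ∀ e t → (+ 1 + + 2 * t) * (+ 2 * e - + 1 - + 2 * t) - + 2 * e + + 1 - + 0 ≡ (e - + 1 - t) * (+ 4 * t)
      l₂ = solve-∀
    half-arcs (spk i₃) = ≅-trans rotation (≅-trans exchange (translation b)) , inj₂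
      ( shifted rotation b {u₀} {u₀} (W , + 0 + b) ωu₀ (refl ⨾ ≡⇒∣ (l₁ k b))
      , shifted rotation b {u₁} {v₀} u₀ ωu₁ (refl ⨾ ≡⇒∣ (l₂ k b)))
      where
      l₁ : ∀ k b → k * + 0 + b ≡ + 0 + b
      l₁ = solve-∀
      l₂ : ∀ k b → k * + 0 - b + b ≡ + 0
      l₂ = solve-∀

  isVertexTransitive : VertexTransitive Γ
  isVertexTransitive = vertex-transitive reach

  isEdgeTransitive : EdgeTransitive Γ
  isEdgeTransitive = edge-transitive reach half-arcs

  -- Rotation alone reaches three of the six arcs at u_0; `ι` supplies -r, and rotating it supplies
  -- the remaining two.
  isArcTransitive : (ι : Aut Γ) → ap ι ⟦ u₀ ⟧ ≡ ⟦ u₀ ⟧ → ap ι ⟦ u₁ ⟧ ≡ ⟦ U , - + 1 ⟧ → ArcTransitive Γ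
  isArcTransitive ι p q = arc-transitive reach arcs
    where
    ωu₋₁ : ap rotation ⟦ U , - + 1 ⟧ ≡ ⟦ W , b ⟧
    ωu₋₁ = rotation-app {U , - + 1} {W , b} (≋-trans (ω-odd U { - + 1} (- + 1) (≡⇒∣ { - + 1} refl)) (refl ⨾ ≡⇒∣ (l e)))
      where
      l : ∀ e → - (+ 2 * - + 1 * e) ≡ + 2 * e
      l = solve-∀
    ωv₋ : ap rotation ⟦ W , b ⟧ ≡ ⟦ W , + 1 ⟧
    ωv₋ = rotation-app {W , b} {W , + 1} (≋-trans (ω-even W {b} e (≡⇒∣ {b} refl)) (refl ⨾ lin₄ (- + 1) (+ 0) (- + 1) (l e t)))
      where
      l : ∀ e t → (+ 2 * e - + 1 - + 2 * t) - + 2 * e * e - + 1 ≡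
        - + 1 * (+ 4 * t) + + 0 * (+ 2 * t * (e + + 1)) + - + 1 * (+ 2 * (e * e - e + + 1) - + 2 * t)
      l = solve-∀
    arcs : ∀ d → ∃[ σ ] (ap σ ⟦ u₀ ⟧ ≡ ⟦ u₀ ⟧ × ap σ ⟦ u₁ ⟧ ≡ ⟦ u₀ ▹ d ⟧)
    arcs fwd      = translation (+ 0) , translation-app (+ 0) u₀ , translation-app (+ 0) u₁
    arcs bwd      = ι , p , q
    arcs (spk i₀) = rotation , ωu₀ , ωu₁
    arcs (spk i₂) = ρ₂ , ρ₂u₀ , trans ρ₂u₁ (+0≋ W a)
    arcs (spk i₃) = ≅-trans ι rotation , trans (cong (ap rotation) p) ωu₀ , trans (cong (ap rotation) q) (trans ωu₋₁ (+0≋ W b))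
    arcs (spk i₁) = ≅-trans ι ρ₂ , trans (cong (ap ρ₂) p) ρ₂u₀ , trans (cong (ap ρ₂) q) (trans (cong (ap rotation) ωu₋₁) ωv₋)

-- Arc-transitivity of the sporadic graphs.

-- Automorphisms given by the list of images of u_0, …, u_{n-1}, v_0, …, v_{n-1}, with v_i encoded as n + i:
-- swap takes u_0 to v_0, and the others fix u_0 and take u_1 to another neighbour of u_0.
record Tables : Set where
  field
    swap bwd′ spk₀ spk₁ spk₂ spk₃ : List ℕ

lookup₀ : List ℕ → ℕ → ℕ
lookup₀ []       _       = 0
lookup₀ (x ∷ _)  zero    = x
lookup₀ (_ ∷ xs) (suc i) = lookup₀ xs i

indexOf : List ℕ → ℕ → ℕ
indexOf []       m = 0
indexOf (x ∷ xs) m = if x ℕ.≡ᵇ m then 0 else suc (indexOf xs m)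

module TableAutomorphisms (n : ℕ) .{{nz : NonZero n}} (k : ℤ) (s : Fin 4 → ℤ) where
  open Walks n k s
  open Transitivity n k s
  open Translation n k s

  private
    Map : Set
    Map = NestV n → NestV n

    code : NestV n → ℕ
    code (inj₁ i) = toℕ i
    code (inj₂ i) = n ℕ.+ toℕ i

    point : ℕ → Pt
    point m = if m ℕ.<ᵇ n then (U , + m) else (W , + m)

    asMap : List ℕ → Map
    asMap t x = ⟦ point (lookup₀ t (code x)) ⟧

    inverse : List ℕ → List ℕ
    inverse t = map (indexOf t) (upTo (n ℕ.+ n))

    dirOf : Fin 6 → Dir
    dirOf zero                               = fwd
    dirOf (suc zero)                         = bwd
    dirOf (suc (suc i))                      = spk i

    ofDir : ∀ d → ∃[ i ] dirOf i ≡ d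
    ofDir fwd     = zero , refl
    ofDir bwd     = suc zero , refl
    ofDir (spk i) = suc (suc i) , refl

    allᵛ? : ∀ {P : NestV n → Set} → (∀ x → Dec (P x)) → Dec (∀ x → P x)
    allᵛ? P? = map′ (λ h → λ { (inj₁ i) → proj₁ h i ; (inj₂ i) → proj₂ h i }) (λ h → h ∘ inj₁ , h ∘ inj₂) (Fin.all? (P? ∘ inj₁) ×-dec Fin.all? (P? ∘ inj₂))

    allᵈ? : ∀ {P : Dir → Set} → (∀ d → Dec (P d)) → Dec (∀ d → P d)
    allᵈ? {P} P? = map′ (λ h d → subst P (proj₂ (ofDir d)) (h (proj₁ (ofDir d)))) (λ h i → h (dirOf i)) (Fin.all? (P? ∘ dirOf))

    anyᵈ? : ∀ {P : Dir → Set} → (∀ d → Dec (P d)) → Dec (∃[ d ] P d)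
    anyᵈ? {P} P? = map′ (λ { (i , p) → dirOf i , p })
      (λ { (d , p) → proj₁ (ofDir d) , subst P (sym (proj₂ (ofDir d))) p }) (Fin.any? (P? ∘ dirOf))

    Keeps : Map → Set
    Keeps f = ∀ x d → ∃[ d′ ] f ⟦ lift x ▹ d ⟧ ≡ ⟦ lift (f x) ▹ d′ ⟧

    keeps? : ∀ f → Dec (Keeps f)
    keeps? f = allᵛ? λ x → allᵈ? λ d → anyᵈ? λ d′ → f ⟦ lift x ▹ d ⟧ ≟ᵛ ⟦ lift (f x) ▹ d′ ⟧

    record IsAutomorphism (f g : Map) : Set where
      constructor isAutomorphism
      field
        fg      : ∀ x → f (g x) ≡ x
        gf      : ∀ x → g (f x) ≡ x
        f-keeps : Keeps f
        g-keeps : Keeps g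

    isAutomorphism? : ∀ f g → Dec (IsAutomorphism f g)
    isAutomorphism? f g = map′ (λ { (a , b , c , d) → isAutomorphism a b c d }) (λ { (isAutomorphism a b c d) → a , b , c , d })
      (allᵛ? (λ x → f (g x) ≟ᵛ x) ×-dec allᵛ? (λ x → g (f x) ≟ᵛ x) ×-dec keeps? f ×-dec keeps? g)

    module _ (f g : Map) (A : IsAutomorphism f g) where
      open IsAutomorphism A

      private
        onPt : Map → Pt → Pt
        onPt h p = lift (h ⟦ p ⟧)

        onPt-≋ : ∀ h {p q} → p ≋ q → onPt h p ≋ onPt h q
        onPt-≋ h {p} {q} e = subst (λ x → lift (h ⟦ p ⟧) ≋ lift (h x)) (≋⇒≡ e) ≋-refl

        inverseTo : ∀ f g → (∀ x → f (g x) ≡ x) → ∀ p → onPt f (onPt g p) ≋ p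
        inverseTo f g u p = subst (λ x → lift x ≋ p) (sym (trans (cong f (⟦lift⟧ (g ⟦ p ⟧))) (u ⟦ p ⟧))) (lift-⟦⟧ p)

        adjacency : ∀ f → Keeps f → ∀ p d → Adj k s (onPt f p) (onPt f (p ▹ d))
        adjacency f u p d = found (u ⟦ p ⟧ d)
          where
          found : ∃[ d′ ] f ⟦ lift ⟦ p ⟧ ▹ d ⟧ ≡ ⟦ lift (f ⟦ p ⟧) ▹ d′ ⟧ → Adj k s (onPt f p) (onPt f (p ▹ d))
          found (d′ , e) = via d′ (subst (λ x → lift x ≋ onPt f p ▹ d′)
            (sym (trans (cong f (≋⇒≡ (move-≋ k s {p} {lift ⟦ p ⟧} d (≋-sym (lift-⟦⟧ p))))) e))
            (lift-⟦⟧ (lift (f ⟦ p ⟧) ▹ d′)))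

      automorphism : Aut Γ
      automorphism = mkIso (onPt f) (onPt g) (onPt-≋ f) (onPt-≋ g) (inverseTo f g fg) (inverseTo g f gf) (adjacency f f-keeps) (adjacency g g-keeps)

      automorphism-app : ∀ p → app {Γ} {Γ} automorphism ⟦ p ⟧ ≡ f ⟦ p ⟧
      automorphism-app p = trans (mkIso-app (onPt f) (onPt g) (onPt-≋ f) (onPt-≋ g) (inverseTo f g fg) (inverseTo g f gf)
        (adjacency f f-keeps) (adjacency g g-keeps) p) (⟦lift⟧ (f ⟦ p ⟧))

    u₀ u₁ v₀ : Pt
    u₀ = U , + 0
    u₁ = U , + 1
    v₀ = W , + 0

    table : Tables → Dir → List ℕ
    table T fwd      = upTo (n ℕ.+ n)
    table T bwd      = Tables.bwd′ T
    table T (spk i₀) = Tables.spk₀ T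
    table T (spk i₁) = Tables.spk₁ T
    table T (spk i₂) = Tables.spk₂ T
    table T (spk i₃) = Tables.spk₃ T

    IsTable : List ℕ → Set
    IsTable t = IsAutomorphism (asMap t) (asMap (inverse t))

    Turns : Tables → Dir → Set
    Turns T d = IsTable (table T d) × asMap (table T d) ⟦ u₀ ⟧ ≡ ⟦ u₀ ⟧ × asMap (table T d) ⟦ u₁ ⟧ ≡ ⟦ u₀ ▹ d ⟧

  AreTables : Tables → Set
  AreTables T = IsTable (Tables.swap T) × asMap (Tables.swap T) ⟦ u₀ ⟧ ≡ ⟦ v₀ ⟧ × (∀ d → Turns T d)

  areTables? : ∀ T → Dec (AreTables T)
  areTables? T = isAutomorphism? _ _ ×-dec (asMap (Tables.swap T) ⟦ u₀ ⟧ ≟ᵛ ⟦ v₀ ⟧) ×-dec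
    allᵈ? λ d → isAutomorphism? _ _ ×-dec (asMap (table T d) ⟦ u₀ ⟧ ≟ᵛ ⟦ u₀ ⟧) ×-dec (asMap (table T d) ⟦ u₁ ⟧ ≟ᵛ ⟦ u₀ ▹ d ⟧)

  module _ (T : Tables) (ok : AreTables T) where
    private
      σ : Aut Γ
      σ = automorphism (asMap (Tables.swap T)) (asMap (inverse (Tables.swap T))) (proj₁ ok)

      σ-app : app {Γ} {Γ} σ ⟦ u₀ ⟧ ≡ ⟦ v₀ ⟧
      σ-app = trans (automorphism-app (asMap (Tables.swap T)) (asMap (inverse (Tables.swap T))) (proj₁ ok) u₀) (proj₁ (proj₂ ok))

      from-0 : ∀ (x : Side) i → ⟦ x , + 0 + i ⟧ ≡ ⟦ x , i ⟧
      from-0 x i = ≋⇒≡ {x , + 0 + i} {x , i} (refl ⨾ ≡⇒∣ (ℤ.+-identityˡ i))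

      reach : ∀ x → ∃[ τ ] app {Γ} {Γ} τ ⟦ u₀ ⟧ ≡ x
      reach x = go (lift x) (⟦lift⟧ x)
        where
        go : ∀ p → ⟦ p ⟧ ≡ x → ∃[ τ ] app {Γ} {Γ} τ ⟦ u₀ ⟧ ≡ x
        go (U , i) e = translation i , trans (translation-app i u₀) (trans (from-0 U i) e)
        go (W , i) e = ≅-trans σ (translation i) , trans (cong (app {Γ} {Γ} (translation i)) σ-app)
          (trans (translation-app i v₀) (trans (from-0 W i) e))

      arcs : ∀ d → ∃[ τ ] (app {Γ} {Γ} τ ⟦ u₀ ⟧ ≡ ⟦ u₀ ⟧ × app {Γ} {Γ} τ ⟦ u₁ ⟧ ≡ ⟦ u₀ ▹ d ⟧)
      arcs d = turning (proj₂ (proj₂ ok) d)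
        where
        f g : Map
        f = asMap (table T d)
        g = asMap (inverse (table T d))
        turning : Turns T d → ∃[ τ ] (app {Γ} {Γ} τ ⟦ u₀ ⟧ ≡ ⟦ u₀ ⟧ × app {Γ} {Γ} τ ⟦ u₁ ⟧ ≡ ⟦ u₀ ▹ d ⟧)
        turning (A , p , q) = automorphism f g A , trans (automorphism-app f g A u₀) p , trans (automorphism-app f g A u₁) q

    tables⇒AT : ArcTransitive Γ
    tables⇒AT = arc-transitive reach arcs

nest-AT : ∀ n₋₁ a b c k T → {True (TableAutomorphisms.areTables? (suc n₋₁) (+ k) (spokes (+ 0) (+ a) (+ b) (+ c)) T)} →
  ArcTransitive (Nest (suc n₋₁) a b c k)
nest-AT n₋₁ a b c k T {ok} = transport-AT (≅-sym (nest≅bicirc n₋₁ a b c k))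
  (TableAutomorphisms.tables⇒AT (suc n₋₁) (+ k) (spokes (+ 0) (+ a) (+ b) (+ c)) T (toWitness ok))

tables41231 : Tables
tables41231 = record
  { swap = 4 ∷ 5 ∷ 6 ∷ 7 ∷ 0 ∷ 1 ∷ 2 ∷ 3 ∷ []
  ; bwd′ = 0 ∷ 3 ∷ 2 ∷ 1 ∷ 4 ∷ 5 ∷ 6 ∷ 7 ∷ []
  ; spk₀ = 0 ∷ 4 ∷ 2 ∷ 6 ∷ 1 ∷ 5 ∷ 3 ∷ 7 ∷ []
  ; spk₁ = 0 ∷ 5 ∷ 2 ∷ 7 ∷ 1 ∷ 4 ∷ 3 ∷ 6 ∷ []
  ; spk₂ = 0 ∷ 6 ∷ 2 ∷ 4 ∷ 1 ∷ 5 ∷ 3 ∷ 7 ∷ []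
  ; spk₃ = 0 ∷ 7 ∷ 2 ∷ 5 ∷ 1 ∷ 4 ∷ 3 ∷ 6 ∷ []
  }

tables51232 : Tables
tables51232 = record
  { swap = 5 ∷ 7 ∷ 1 ∷ 6 ∷ 3 ∷ 8 ∷ 4 ∷ 2 ∷ 0 ∷ 9 ∷ []
  ; bwd′ = 0 ∷ 4 ∷ 3 ∷ 2 ∷ 1 ∷ 8 ∷ 7 ∷ 6 ∷ 5 ∷ 9 ∷ []
  ; spk₀ = 0 ∷ 5 ∷ 3 ∷ 9 ∷ 1 ∷ 6 ∷ 7 ∷ 8 ∷ 4 ∷ 2 ∷ []
  ; spk₁ = 0 ∷ 6 ∷ 9 ∷ 2 ∷ 5 ∷ 7 ∷ 8 ∷ 4 ∷ 1 ∷ 3 ∷ []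
  ; spk₂ = 0 ∷ 7 ∷ 2 ∷ 3 ∷ 6 ∷ 8 ∷ 4 ∷ 1 ∷ 5 ∷ 9 ∷ []
  ; spk₃ = 0 ∷ 8 ∷ 2 ∷ 9 ∷ 4 ∷ 7 ∷ 6 ∷ 5 ∷ 1 ∷ 3 ∷ []
  }

tables81253 : Tables
tables81253 = record
  { swap = 8 ∷ 11 ∷ 14 ∷ 9 ∷ 12 ∷ 15 ∷ 10 ∷ 13 ∷ 0 ∷ 3 ∷ 6 ∷ 1 ∷ 4 ∷ 7 ∷ 2 ∷ 5 ∷ []
  ; bwd′ = 0 ∷ 7 ∷ 12 ∷ 2 ∷ 11 ∷ 14 ∷ 5 ∷ 13 ∷ 10 ∷ 8 ∷ 9 ∷ 15 ∷ 3 ∷ 1 ∷ 6 ∷ 4 ∷ []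
  ; spk₀ = 0 ∷ 8 ∷ 3 ∷ 2 ∷ 15 ∷ 5 ∷ 14 ∷ 9 ∷ 1 ∷ 7 ∷ 13 ∷ 11 ∷ 12 ∷ 10 ∷ 6 ∷ 4 ∷ []
  ; spk₁ = 0 ∷ 9 ∷ 12 ∷ 3 ∷ 11 ∷ 6 ∷ 5 ∷ 10 ∷ 13 ∷ 1 ∷ 7 ∷ 4 ∷ 2 ∷ 8 ∷ 14 ∷ 15 ∷ []
  ; spk₂ = 0 ∷ 10 ∷ 5 ∷ 6 ∷ 11 ∷ 3 ∷ 12 ∷ 9 ∷ 7 ∷ 1 ∷ 13 ∷ 15 ∷ 14 ∷ 8 ∷ 2 ∷ 4 ∷ []
  ; spk₃ = 0 ∷ 13 ∷ 3 ∷ 12 ∷ 15 ∷ 6 ∷ 14 ∷ 1 ∷ 9 ∷ 10 ∷ 8 ∷ 4 ∷ 2 ∷ 7 ∷ 5 ∷ 11 ∷ []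
  }

tables81343 : Tables
tables81343 = record
  { swap = 8 ∷ 11 ∷ 14 ∷ 6 ∷ 10 ∷ 1 ∷ 12 ∷ 4 ∷ 13 ∷ 0 ∷ 3 ∷ 5 ∷ 7 ∷ 2 ∷ 9 ∷ 15 ∷ []
  ; bwd′ = 0 ∷ 7 ∷ 10 ∷ 2 ∷ 3 ∷ 4 ∷ 5 ∷ 9 ∷ 12 ∷ 8 ∷ 6 ∷ 1 ∷ 11 ∷ 15 ∷ 13 ∷ 14 ∷ []
  ; spk₀ = 0 ∷ 8 ∷ 13 ∷ 2 ∷ 3 ∷ 15 ∷ 6 ∷ 9 ∷ 12 ∷ 7 ∷ 5 ∷ 1 ∷ 11 ∷ 4 ∷ 10 ∷ 14 ∷ []
  ; spk₁ = 0 ∷ 9 ∷ 14 ∷ 3 ∷ 4 ∷ 13 ∷ 10 ∷ 7 ∷ 8 ∷ 1 ∷ 6 ∷ 11 ∷ 12 ∷ 5 ∷ 2 ∷ 15 ∷ []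
  ; spk₂ = 0 ∷ 11 ∷ 3 ∷ 4 ∷ 5 ∷ 6 ∷ 10 ∷ 1 ∷ 9 ∷ 7 ∷ 2 ∷ 12 ∷ 8 ∷ 14 ∷ 15 ∷ 13 ∷ []
  ; spk₃ = 0 ∷ 12 ∷ 4 ∷ 5 ∷ 6 ∷ 10 ∷ 2 ∷ 11 ∷ 7 ∷ 1 ∷ 3 ∷ 8 ∷ 9 ∷ 15 ∷ 13 ∷ 14 ∷ []
  }

tables101343 : Tables
tables101343 = record
  { swap = 10 ∷ 13 ∷ 3 ∷ 14 ∷ 1 ∷ 15 ∷ 18 ∷ 8 ∷ 19 ∷ 6 ∷ 7 ∷ 9 ∷ 16 ∷ 17 ∷ 0 ∷ 2 ∷ 4 ∷ 11 ∷ 12 ∷ 5 ∷ []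
  ; bwd′ = 0 ∷ 9 ∷ 12 ∷ 2 ∷ 16 ∷ 5 ∷ 4 ∷ 17 ∷ 7 ∷ 11 ∷ 14 ∷ 10 ∷ 8 ∷ 1 ∷ 13 ∷ 19 ∷ 15 ∷ 3 ∷ 6 ∷ 18 ∷ []
  ; spk₀ = 0 ∷ 10 ∷ 17 ∷ 3 ∷ 16 ∷ 5 ∷ 15 ∷ 12 ∷ 8 ∷ 11 ∷ 1 ∷ 9 ∷ 7 ∷ 14 ∷ 13 ∷ 6 ∷ 4 ∷ 2 ∷ 19 ∷ 18 ∷ []
  ; spk₁ = 0 ∷ 11 ∷ 7 ∷ 17 ∷ 4 ∷ 5 ∷ 16 ∷ 2 ∷ 12 ∷ 9 ∷ 13 ∷ 1 ∷ 8 ∷ 10 ∷ 14 ∷ 18 ∷ 6 ∷ 3 ∷ 15 ∷ 19 ∷ []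
  ; spk₂ = 0 ∷ 13 ∷ 3 ∷ 17 ∷ 6 ∷ 5 ∷ 18 ∷ 8 ∷ 12 ∷ 1 ∷ 11 ∷ 9 ∷ 2 ∷ 14 ∷ 10 ∷ 16 ∷ 4 ∷ 7 ∷ 19 ∷ 15 ∷ []
  ; spk₃ = 0 ∷ 14 ∷ 17 ∷ 7 ∷ 18 ∷ 5 ∷ 19 ∷ 12 ∷ 2 ∷ 13 ∷ 9 ∷ 1 ∷ 3 ∷ 10 ∷ 11 ∷ 4 ∷ 6 ∷ 8 ∷ 15 ∷ 16 ∷ []
  }

tables1213105 : Tables
tables1213105 = record
  { swap = 12 ∷ 17 ∷ 22 ∷ 15 ∷ 20 ∷ 13 ∷ 18 ∷ 23 ∷ 16 ∷ 21 ∷ 14 ∷ 19 ∷ 9 ∷ 2 ∷ 7 ∷ 0 ∷ 5 ∷ 10 ∷ 3 ∷ 8 ∷ 1 ∷ 6 ∷ 11 ∷ 4 ∷ []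
  ; bwd′ = 0 ∷ 11 ∷ 10 ∷ 9 ∷ 8 ∷ 7 ∷ 6 ∷ 5 ∷ 4 ∷ 3 ∷ 2 ∷ 1 ∷ 13 ∷ 12 ∷ 23 ∷ 22 ∷ 21 ∷ 20 ∷ 19 ∷ 18 ∷ 17 ∷ 16 ∷ 15 ∷ 14 ∷ []
  ; spk₀ = 0 ∷ 12 ∷ 2 ∷ 14 ∷ 4 ∷ 16 ∷ 6 ∷ 18 ∷ 8 ∷ 20 ∷ 10 ∷ 22 ∷ 15 ∷ 11 ∷ 17 ∷ 1 ∷ 19 ∷ 3 ∷ 21 ∷ 5 ∷ 23 ∷ 7 ∷ 13 ∷ 9 ∷ []
  ; spk₁ = 0 ∷ 13 ∷ 10 ∷ 23 ∷ 8 ∷ 21 ∷ 6 ∷ 19 ∷ 4 ∷ 17 ∷ 2 ∷ 15 ∷ 22 ∷ 1 ∷ 20 ∷ 11 ∷ 18 ∷ 9 ∷ 16 ∷ 7 ∷ 14 ∷ 5 ∷ 12 ∷ 3 ∷ []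
  ; spk₂ = 0 ∷ 15 ∷ 2 ∷ 17 ∷ 4 ∷ 19 ∷ 6 ∷ 21 ∷ 8 ∷ 23 ∷ 10 ∷ 13 ∷ 1 ∷ 22 ∷ 3 ∷ 12 ∷ 5 ∷ 14 ∷ 7 ∷ 16 ∷ 9 ∷ 18 ∷ 11 ∷ 20 ∷ []
  ; spk₃ = 0 ∷ 22 ∷ 10 ∷ 20 ∷ 8 ∷ 18 ∷ 6 ∷ 16 ∷ 4 ∷ 14 ∷ 2 ∷ 12 ∷ 11 ∷ 15 ∷ 9 ∷ 13 ∷ 7 ∷ 23 ∷ 5 ∷ 21 ∷ 3 ∷ 19 ∷ 1 ∷ 17 ∷ []
  }

at-41231 : ArcTransitive (Nest 4 1 2 3 1)
at-41231 = nest-AT 3 1 2 3 1 tables41231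

at-51232 : ArcTransitive (Nest 5 1 2 3 2)
at-51232 = nest-AT 4 1 2 3 2 tables51232

at-81253 : ArcTransitive (Nest 8 1 2 5 3)
at-81253 = nest-AT 7 1 2 5 3 tables81253

at-81343 : ArcTransitive (Nest 8 1 3 4 3)
at-81343 = nest-AT 7 1 3 4 3 tables81343

at-101343 : ArcTransitive (Nest 10 1 3 4 3)
at-101343 = nest-AT 9 1 3 4 3 tables101343

at-1213105 : ArcTransitive (Nest 12 1 3 10 5)
at-1213105 = nest-AT 11 1 3 10 5 tables1213105

case1-AT : ∀ {G} → Case1 G → ArcTransitive G
case1-AT (inj₁ φ)                                    = transport-AT (≅-sym φ) at-41231
case1-AT (inj₂ (inj₁ φ))                             = transport-AT (≅-sym φ) at-51232
case1-AT (inj₂ (inj₂ (inj₁ φ)))                      = transport-AT (≅-sym φ) at-81253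
case1-AT (inj₂ (inj₂ (inj₂ (inj₁ φ))))               = transport-AT (≅-sym φ) at-81343
case1-AT (inj₂ (inj₂ (inj₂ (inj₂ (inj₁ φ)))))        = transport-AT (≅-sym φ) at-101343
case1-AT (inj₂ (inj₂ (inj₂ (inj₂ (inj₂ φ)))))        = transport-AT (≅-sym φ) at-1213105

-- From edge-transitivity to the three cases.

-- The counts `M` are exact as soon as all vectors of `ap` are nonzero. `settled-ok` records that,
-- for an edge-transitive graph with these relations, the only alternative is a graph of `targets`.
record LocalModel (rels base : List V4) (allowed : Bool → Fin 6 → Bool) : Set where
  field
    ap           : List V4
    M            : Matrix
    L            : ℕ
    ws           : Side → Table × Table
    ws-walks     : ∀ y → ws y ≡ walks y L
    local-ok     : ∀ x d d′ → pairCheck ws (rowsOf rels) ap M x d d′ ≡ true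
    triangle-ok  : ∀ x D s → isTriangle (rowsOf rels) allowed x D s ≡ true
    dihedral-ok  : Dihedral M allowed
    closed-ok    : ∀ s e d → even d ≡ true → allowed s e ≡ true → allowed s (act s e d) ≡ true
    even-allowed : ∀ d → even d ≡ true → allowed false d ≡ true
    settled-ok   : settled base (search 1000 (initial rels base 5 (([] , ap) ∷ []))) ≡ true

walks₃-walks : ∀ y → walks₃ y ≡ walks y 3
walks₃-walks U = refl
walks₃-walks W = refl

-- The equation a = 3, which the generic conditions rule out; this is the origin of b₀ > 1 in (iii).
3ᵛ : V4
3ᵛ = vec (- + 3) (+ 0) (+ 1) (+ 0)

abstract

  modelA : LocalModel relsA distinct anyDihedral
  modelA = record
    { ap = genericA ; M = matrixA ; L = 3 ; ws = walks₃ ; ws-walks = walks₃-walks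
    ; local-ok = localCheck-at walks₃ (rowsOf relsA) genericA matrixA refl
    ; triangle-ok = triangleCheck-at (rowsOf relsA) anyDihedral refl
    ; dihedral-ok = dihedral matrixA anyDihedral refl
    ; closed-ok = closedCheck-at anyDihedral refl
    ; even-allowed = λ _ _ → refl
    ; settled-ok = refl }

  modelC : ∃[ m ] member 3ᵛ (LocalModel.ap {relsC} {apartC} {evenDihedral} m) ≡ true
  modelC = record
    { ap = genericC ; M = matrixC ; L = 3 ; ws = walks₃ ; ws-walks = walks₃-walks
    ; local-ok = localCheck-at walks₃ (rowsOf relsC) genericC matrixC refl
    ; triangle-ok = triangleCheck-at (rowsOf relsC) evenDihedral refl
    ; dihedral-ok = dihedral matrixC evenDihedral refl
    ; closed-ok = closedCheck-at evenDihedral refl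
    ; even-allowed = λ { d₀ _ → refl ; d₂ _ → refl ; d₄ _ → refl ; d₁ () ; d₃ () ; d₅ () }
    ; settled-ok = refl } , refl

  sporadic : settled distinct (search 1000 (initial [] distinct 5 family)) ≡ true
  sporadic = refl

record Setup (n₋₁ k a b : ℕ) : Set where
  field
    4≤n   : 4 ℕ.≤ suc n₋₁
    k<    : k ℕ.< suc n₋₁
    a<    : a ℕ.< suc n₋₁
    b<    : b ℕ.< suc n₋₁
    independent : Sound.Apart (suc n₋₁) (+ k) (+ a) (+ b) distinct
    et    : EdgeTransitive (Residue.Bicirc (suc n₋₁) (+ k) (spokes (+ 0) (+ 1) (+ a) (+ b)))

B : ℕ → ℕ → ℕ → ℕ → Graph
B n₋₁ k a b = Residue.Bicirc (suc n₋₁) (+ k) (spokes (+ 0) (+ 1) (+ a) (+ b))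

module _ {n₋₁ k a b : ℕ} where
  private
    n = suc n₋₁
  open Affinity n

  -- Together with `negateIso` it reduces the four members of `family` to 2k = 2, b = a + k.
  swapIso : B n₋₁ k a b ≅ B n₋₁ k b a
  swapIso = affineIso record
    { e = false ; h = false ; t = + 0 ; π = π ; π⁻ = π
    ; k-eq = Residue.≡⇒∣ n (sym (ℤ.*-identityˡ (+ k))) ; π-eq = λ j → Residue.≡⇒∣ n (eqs j) ; π⁻-eq = λ j → Residue.≡⇒∣ n (eqs′ j) }
    where
    π : Fin 4 → Fin 4
    π i₀ = i₀
    π i₁ = i₁
    π i₂ = i₃
    π i₃ = i₂
    simp : ∀ x → x ≡ + 1 * x + + 0
    simp x = sym (trans (ℤ.+-identityʳ _) (ℤ.*-identityˡ x))
    eqs : ∀ j → spokes (+ 0) (+ 1) (+ b) (+ a) (π j) ≡ + 1 * spokes (+ 0) (+ 1) (+ a) (+ b) j + + 0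
    eqs i₀ = refl
    eqs i₁ = refl
    eqs i₂ = simp (+ a)
    eqs i₃ = simp (+ b)
    eqs′ : ∀ j → spokes (+ 0) (+ 1) (+ b) (+ a) j ≡ + 1 * spokes (+ 0) (+ 1) (+ a) (+ b) (π j) + + 0
    eqs′ i₀ = refl
    eqs′ i₁ = refl
    eqs′ i₂ = simp (+ b)
    eqs′ i₃ = simp (+ a)

  private
    open Sound n using (unZ; vanishes)

    unswapZ : ∀ p q r t → Sound.Z n (+ k) (+ b) (+ a) (vec p q r t) → Sound.Z n (+ k) (+ a) (+ b) (vec p q t r)
    unswapZ p q r t (vanishes z) = vanishes (subst (+ n ∣_) (lem (p + q * + k) (r * + b) (t * + a)) z)
      where
      lem : ∀ x y z → x + y + z ≡ x + z + y
      lem = solve-∀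

  swapZ : ∀ p q r t → Sound.Z n (+ k) (+ a) (+ b) (vec p q t r) → Sound.Z n (+ k) (+ b) (+ a) (vec p q r t)
  swapZ p q r t (vanishes z) = vanishes (subst (+ n ∣_) (lem (p + q * + k) (r * + b) (t * + a)) z)
    where
    lem : ∀ x y z → x + z + y ≡ x + y + z
    lem = solve-∀

  swapped : Setup n₋₁ k a b → Setup n₋₁ k b a
  swapped S = record
    { 4≤n = 4≤n ; k< = k< ; a< = b< ; b< = a< ; et = transport-ET swapIso et
    ; independent = sw independent }
    where
    open Setup S
    sw : Sound.Apart n (+ k) (+ a) (+ b) distinct → Sound.Apart n (+ k) (+ b) (+ a) distinct
    sw (p₁ ∷ p₂ ∷ p₃ ∷ p₄ ∷ p₅ ∷ pa ∷ pb ∷ pa₁ ∷ pb₁ ∷ pab ∷ []) =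
      (p₁ ∘ unswapZ _ _ _ _) ∷ (p₂ ∘ unswapZ _ _ _ _) ∷ (p₃ ∘ unswapZ _ _ _ _) ∷ (p₄ ∘ unswapZ _ _ _ _) ∷ (p₅ ∘ unswapZ _ _ _ _)
      ∷ (pb ∘ unswapZ _ _ _ _) ∷ (pa ∘ unswapZ _ _ _ _) ∷ (pb₁ ∘ unswapZ _ _ _ _) ∷ (pa₁ ∘ unswapZ _ _ _ _)
      ∷ (pab ∘ Sound.Z-· n (+ k) (+ a) (+ b) (- + 1) {vec (+ 0) (+ 0) (+ 1) (- + 1)} ∘ unswapZ (+ 0) (+ 0) (- + 1) (+ 1)) ∷ []

module _ {n₋₁ k a b : ℕ} (k≤n : k ℕ.≤ suc n₋₁) where
  private
    n = suc n₋₁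
    k′ = n ℕ.∸ k
    k′≡ : + k′ ≡ + n - + k
    k′≡ = sym (trans (ℤ.m-n≡m⊖n n k) (ℤ.⊖-≥ k≤n))
  open Affinity n
  open Sound n using (vanishes)

  negateIso : B n₋₁ k a b ≅ B n₋₁ k′ a b
  negateIso = affineIso record
    { e = false ; h = true ; t = + 0 ; π = id ; π⁻ = id
    ; k-eq = divides (+ 1) (trans (cong (λ z → z - - + 1 * + k) k′≡) (lem (+ n) (+ k)))
    ; π-eq = λ j → Residue.≡⇒∣ n (simp (spokes (+ 0) (+ 1) (+ a) (+ b) j)) ; π⁻-eq = λ j → Residue.≡⇒∣ n (simp (spokes (+ 0) (+ 1) (+ a) (+ b) j)) }
    where
    simp : ∀ x → x ≡ + 1 * x + + 0
    simp x = sym (trans (ℤ.+-identityʳ _) (ℤ.*-identityˡ x))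
    lem : ∀ n k → n - k - - + 1 * k ≡ + 1 * n
    lem = solve-∀

  private
    unnegateZ : ∀ p q r t → Sound.Z n (+ k′) (+ a) (+ b) (vec p q r t) → Sound.Z n (+ k) (+ a) (+ b) (vec p (- q) r t)
    unnegateZ p q r t (vanishes z) = vanishes (lin₂ (+ 1) (- q) z ∣-refl
        (trans (lem p q (+ n) (+ k) (r * + a) (t * + b)) (cong (λ z → + 1 * (p + q * z + r * + a + t * + b) + - q * + n) (sym k′≡))))
      where
      lem : ∀ p q n k x y → p + - q * k + x + y ≡ + 1 * (p + q * (n - k) + x + y) + - q * n
      lem = solve-∀

  negateZ : ∀ p q r t → Sound.Z n (+ k) (+ a) (+ b) (vec p (- q) r t) → Sound.Z n (+ k′) (+ a) (+ b) (vec p q r t)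
  negateZ p q r t (vanishes z) = vanishes (lin₂ (+ 1) q z ∣-refl
      (trans (cong (λ z → p + q * z + r * + a + t * + b) k′≡) (lem p q (+ n) (+ k) (r * + a) (t * + b))))
    where
    lem : ∀ p q n k x y → p + q * (n - k) + x + y ≡ + 1 * (p + - q * k + x + y) + q * n
    lem = solve-∀

  negated : 1 ℕ.≤ k → Setup n₋₁ k a b → Setup n₋₁ k′ a b
  negated 1≤k S = record
    { 4≤n = 4≤n ; k< = ℕ.s≤s (ℕ.∸-monoʳ-≤ n 1≤k) ; a< = a< ; b< = b< ; et = transport-ET negateIso et ; independent = sw independent }
    where
    open Setup S
    sw : Sound.Apart n (+ k) (+ a) (+ b) distinct → Sound.Apart n (+ k′) (+ a) (+ b) distinct
    sw (p₁ ∷ p₂ ∷ p₃ ∷ p₄ ∷ p₅ ∷ pa ∷ pb ∷ pa₁ ∷ pb₁ ∷ pab ∷ []) =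
      (p₁ ∘ unnegateZ _ (+ 0) _ _) ∷ (p₂ ∘ unnegateZ _ (+ 0) _ _) ∷ (p₃ ∘ unnegateZ _ (+ 0) _ _)
      ∷ (p₄ ∘ Sound.Z-· n (+ k) (+ a) (+ b) (- + 1) {vec (+ 0) (- + 1) (+ 0) (+ 0)} ∘ unnegateZ (+ 0) (+ 1) (+ 0) (+ 0))
      ∷ (p₅ ∘ Sound.Z-· n (+ k) (+ a) (+ b) (- + 1) {vec (+ 0) (- + 2) (+ 0) (+ 0)} ∘ unnegateZ (+ 0) (+ 2) (+ 0) (+ 0))
      ∷ (pa ∘ unnegateZ _ (+ 0) _ _) ∷ (pb ∘ unnegateZ _ (+ 0) _ _) ∷ (pa₁ ∘ unnegateZ _ (+ 0) _ _) ∷ (pb₁ ∘ unnegateZ _ (+ 0) _ _)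
      ∷ (pab ∘ unnegateZ _ (+ 0) _ _) ∷ []

module _ {n₋₁ k a b : ℕ} (S : Setup n₋₁ k a b) where
  open Setup S
  private
    n = suc n₋₁
    module A = Analysis n (+ k) (+ a) (+ b)
  open A using (Z; Apart)

  simple : A.Simple
  simple = A.distinct⇒Simple independent

  -- The parameters either lead to the goal or satisfy the relations of an undecided leaf; such a
  -- leaf bounds n by 12, and the inspection of these orders applies.
  run : ∀ Goal rels base ts → settled base (search 1000 (initial rels base 5 ts)) ≡ true →
    All Z rels → Apart base → All (A.Meets Goal) ts → Goal ⊎ Listed n₋₁ k a b 4≤n k< a< b<
  run Goal rels base ts ok zs ps ms = settled-sound n₋₁ k a b 4≤n k< a< b< base (search 1000 (initial rels base 5 ts)) ok ps
    (A.search-initial simple et Goal 1000 rels base 5 ts zs ps ms)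

  -- Edge-transitivity forces a relation of the family, up to the listed graphs.
  family-or-listed : (∃[ f ] f ∈ family × All Z (proj₁ f)) ⊎ Listed n₋₁ k a b 4≤n k< a< b<
  family-or-listed = run (∃[ f ] f ∈ family × All Z (proj₁ f)) [] distinct family sporadic [] independent (meets family id)
    where
    meets : ∀ ts → (∀ {f} → f ∈ ts → f ∈ family) → All (A.Meets (∃[ f ] f ∈ family × All Z (proj₁ f))) ts
    meets []       inc = []
    meets (t ∷ ts) inc = (λ zs _ → t , inc (here refl) , zs) ∷ meets ts (inc ∘ there)

  module _ {rels base allowed} (m : LocalModel rels base allowed) (zs : All Z rels) (ps : Apart base) where
    open LocalModel m

    generic-or-listed : Apart ap ⊎ Listed n₋₁ k a b 4≤n k< a< b<
    generic-or-listed = run (Apart ap) rels base (([] , ap) ∷ []) settled-ok zs ps ((λ _ a → a) ∷ [])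

    rigidity : Apart ap → (σ : Aut A.Γ) → ∃[ s ] ∃[ e ] allowed s e ≡ true × Hexagon.Equivariant n (+ k) (+ a) (+ b) (app {A.Γ} {A.Γ} σ) (act s e)
    rigidity as = Rigid.rigid n (+ k) (+ a) (+ b) rels ap M allowed L ws ws-walks local-ok triangle-ok dihedral-ok closed-ok even-allowed simple zs as

    rotating-map : Apart ap → Rotation.Rotating n (+ k) (+ a) (+ b)
    rotating-map as = Rotation.rotates n (+ k) (+ a) (+ b) simple et λ σ → let (s , e , _ , h) = rigidity as σ in s , e , h

Cases : Graph → Set
Cases G = Case1 G ⊎ Case2 G ⊎ Case3 G

case1-≅ : ∀ {G H} → G ≅ H → Case1 H → Case1 G
case1-≅ φ = Sum.map (≅-trans φ) (Sum.map (≅-trans φ) (Sum.map (≅-trans φ) (Sum.map (≅-trans φ) (Sum.map (≅-trans φ) (≅-trans φ)))))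

case2-≅ : ∀ {G H} → G ≅ H → Case2 H → Case2 G
case2-≅ φ (m , n , p , q , r , s , ψ) = m , n , p , q , r , s , ≅-trans φ ψ

case3-≅ : ∀ {G H} → G ≅ H → Case3 H → Case3 G
case3-≅ φ (m , b , p , q , r , s , ψ) = m , b , p , q , r , s , ≅-trans φ ψ

cases-≅ : ∀ {G H} → G ≅ H → Cases H → Cases G
cases-≅ φ = Sum.map (case1-≅ φ) (Sum.map (case2-≅ φ) (case3-≅ φ))

target-cases : ∀ {G t} → t ∈ targets → G ≅ nestOf t → Cases G
target-cases (here refl) φ = inj₁ (inj₁ φ)
target-cases (there (here refl)) φ = inj₁ (inj₂ (inj₁ φ))
target-cases (there (there (here refl))) φ = inj₁ (inj₂ (inj₂ (inj₁ φ)))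
target-cases (there (there (there (here refl)))) φ = inj₁ (inj₂ (inj₂ (inj₂ (inj₁ φ))))
target-cases (there (there (there (there (here refl))))) φ = inj₁ (inj₂ (inj₂ (inj₂ (inj₂ (inj₁ φ)))))
target-cases (there (there (there (there (there (here refl)))))) φ = inj₁ (inj₂ (inj₂ (inj₂ (inj₂ (inj₂ φ)))))
target-cases (there (there (there (there (there (there (here refl))))))) φ =
  inj₂ (inj₁ (1 , 6 , ℕ.≤-refl , (3 , refl) , (1 , refl) , ℕ.≤-refl , φ))

∣ℤ⇒ℕ : ∀ {d x} → + d ∣ + x → d ℕ∣.∣ x
∣ℤ⇒ℕ = ∣⇒∣ᵤ

∣⇒Divides : ∀ {d x} → + d ∣ + x → Divides d x
∣⇒Divides d with ∣⇒∣ᵤ d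
... | ℕ∣.divides q e = q , e

∣*⇒∣ : ∀ j {x y} .{{_ : NonZero j}} → j ℕ.* x ℕ∣.∣ j ℕ.* y → x ℕ∣.∣ y
∣*⇒∣ j = ℕ∣.*-cancelˡ-∣ j

module _ {n₋₁ : ℕ} where
  private
    n = suc n₋₁
  open Affinity n

  -- The map u_i to u_(-i), v_i to v_(1 - i) exchanges the spokes 0 and 1 and sends a, b to 1 - a, 1
  -- - b.
  case2-reflect : ∀ {a b a′ b′} → + n ∣ + a′ - (+ 1 - + b) → + n ∣ + b′ - (+ 1 - + a) → B n₋₁ 1 a b ≅ B n₋₁ 1 a′ b′
  case2-reflect {a} {b} {a′} {b′} da db = affineIso record
    { e = true ; h = false ; t = + 1 ; π = π ; π⁻ = π ; k-eq = Residue.≡⇒∣ n {+ 1} refl ; π-eq = eqs ; π⁻-eq = eqs′ }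
    where
    π : Fin 4 → Fin 4
    π i₀ = i₁
    π i₁ = i₀
    π i₂ = i₃
    π i₃ = i₂
    lem : ∀ x y → x - (- + 1 * y + + 1) ≡ + 1 * (x - (+ 1 - y))
    lem = solve-∀
    eqs : ∀ j → + n ∣ spokes (+ 0) (+ 1) (+ a′) (+ b′) (π j) - (- + 1 * spokes (+ 0) (+ 1) (+ a) (+ b) j + + 1)
    eqs i₀ = Residue.≡⇒∣ n {+ 1} refl
    eqs i₁ = Residue.≡⇒∣ n {+ 0} refl
    eqs i₂ = lin₁ (+ 1) db (lem (+ b′) (+ a))
    eqs i₃ = lin₁ (+ 1) da (lem (+ a′) (+ b))
    eqs′ : ∀ j → + n ∣ spokes (+ 0) (+ 1) (+ a′) (+ b′) j - (- + 1 * spokes (+ 0) (+ 1) (+ a) (+ b) (π j) + + 1)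
    eqs′ i₀ = Residue.≡⇒∣ n {+ 0} refl
    eqs′ i₁ = Residue.≡⇒∣ n {+ 1} refl
    eqs′ i₂ = lin₁ (+ 1) da (lem (+ a′) (+ b))
    eqs′ i₃ = lin₁ (+ 1) db (lem (+ b′) (+ a))

-- n = 2j, b = 2(m + 1) and a = 2m + 1; replacing m by j - m - 1 if necessary, 2a ≤ n.
case2-from : ∀ n₋₁ j m → suc n₋₁ ≡ j ℕ.+ j → 1 ℕ.≤ m → suc m ℕ.< j → + suc n₋₁ ∣ + (2 ℕ.* (m ℕ.* m ℕ.+ m ℕ.+ 1)) →
  Case2 (B n₋₁ 1 (2 ℕ.* m ℕ.+ 1) (2 ℕ.* m ℕ.+ 2))
case2-from n₋₁ j m n≡ 1≤m m<j d with (4 ℕ.* m ℕ.+ 2) ℕ.≤? suc n₋₁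
... | yes le = m , suc n₋₁ , 1≤m , (j , trans n≡ (lem j)) , ∣⇒Divides d , le , ≅-sym (nest≅bicirc n₋₁ 1 (2 ℕ.* m ℕ.+ 1) (2 ℕ.* m ℕ.+ 2) 1)
  where
  lem : ∀ j → j ℕ.+ j ≡ 2 ℕ.* j
  lem = ℕR.solve-∀
... | no nle with ℕ.m≤n⇒∃[o]m+o≡n m<j
...   | d′ , refl = suc d′ , suc n₋₁ , ℕ.s≤s ℕ.z≤n , (j , trans n≡ (lem j)) , ∣⇒Divides dq , le ,
          ≅-trans (case2-reflect da db) (≅-sym (nest≅bicirc n₋₁ 1 (2 ℕ.* suc d′ ℕ.+ 1) (2 ℕ.* suc d′ ℕ.+ 2) 1))
  where
  lem : ∀ j → j ℕ.+ j ≡ 2 ℕ.* j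
  lem = ℕR.solve-∀
  N : ℤ
  N = + suc n₋₁
  j′ : ℤ
  j′ = + 2 + + m + + d′
  N≡ : N ≡ j′ + j′
  N≡ = cong +_ n≡
  mℤ = + m
  dℤ = + d′
  ev-a : ∀ m → + (2 ℕ.* m ℕ.+ 1) ≡ + 2 * + m + + 1
  ev-a m = cong (_+ + 1) (ℤ.pos-* 2 m)
  ev-b : ∀ m → + (2 ℕ.* m ℕ.+ 2) ≡ + 2 * + m + + 2
  ev-b m = cong (_+ + 2) (ℤ.pos-* 2 m)
  ev-q : ∀ m → + (2 ℕ.* (m ℕ.* m ℕ.+ m ℕ.+ 1)) ≡ + 2 * (+ m * + m + + m + + 1)
  ev-q m = trans (ℤ.pos-* 2 (m ℕ.* m ℕ.+ m ℕ.+ 1)) (cong (λ z → + 2 * (z + + m + + 1)) (ℤ.pos-* m m))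
  N∣N : N ∣ j′ + j′
  N∣N = subst (N ∣_) N≡ ∣-refl
  da : N ∣ + (2 ℕ.* suc d′ ℕ.+ 1) - (+ 1 - + (2 ℕ.* m ℕ.+ 2))
  da = lin₁ (+ 1) N∣N (trans (cong₂ (λ x y → x - (+ 1 - y)) (ev-a (suc d′)) (ev-b m)) (l mℤ dℤ))
    where
    l : ∀ m d → + 2 * (+ 1 + d) + + 1 - (+ 1 - (+ 2 * m + + 2)) ≡ + 1 * ((+ 2 + m + d) + (+ 2 + m + d))
    l = solve-∀
  db : N ∣ + (2 ℕ.* suc d′ ℕ.+ 2) - (+ 1 - + (2 ℕ.* m ℕ.+ 1))
  db = lin₁ (+ 1) N∣N (trans (cong₂ (λ x y → x - (+ 1 - y)) (ev-b (suc d′)) (ev-a m)) (l mℤ dℤ))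
    where
    l : ∀ m d → + 2 * (+ 1 + d) + + 2 - (+ 1 - (+ 2 * m + + 1)) ≡ + 1 * ((+ 2 + m + d) + (+ 2 + m + d))
    l = solve-∀
  dq : N ∣ + (2 ℕ.* (suc d′ ℕ.* suc d′ ℕ.+ suc d′ ℕ.+ 1))
  dq = lin₂ (+ 1 + dℤ - mℤ) (+ 1) N∣N (subst (N ∣_) (ev-q m) d) (trans (ev-q (suc d′)) (l mℤ dℤ))
    where
    l : ∀ m d → + 2 * ((+ 1 + d) * (+ 1 + d) + (+ 1 + d) + + 1) ≡
      (+ 1 + d - m) * ((+ 2 + m + d) + (+ 2 + m + d)) + + 1 * (+ 2 * (m * m + m + + 1))
    l = solve-∀
  le : 4 ℕ.* suc d′ ℕ.+ 2 ℕ.≤ suc n₋₁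
  le = ℕ.+-cancelʳ-≤ (4 ℕ.* m ℕ.+ 2) _ _ (ℕ.≤-trans (ℕ.≤-reflexive (trans (l m d′) (sym (cong₂ ℕ._+_ n≡ n≡)))) (ℕ.+-monoʳ-≤ (suc n₋₁) (ℕ.<⇒≤ (ℕ.≰⇒> nle))))
    where
    l : ∀ m d → 4 ℕ.* suc d ℕ.+ 2 ℕ.+ (4 ℕ.* m ℕ.+ 2) ≡ (2 ℕ.+ m ℕ.+ d ℕ.+ (2 ℕ.+ m ℕ.+ d)) ℕ.+ (2 ℕ.+ m ℕ.+ d ℕ.+ (2 ℕ.+ m ℕ.+ d))
    l = ℕR.solve-∀

module Normal {n₋₁ k a b : ℕ} (S : Setup n₋₁ k a b) where
  open Setup S
  private
    n = suc n₋₁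
  open Rotation n (+ k) (+ a) (+ b) using (Rotating; relation-n; relation-b; relation-commutator)
  open Sound n (+ k) (+ a) (+ b)

  listed-cases : Listed n₋₁ k a b 4≤n k< a< b< → Cases (B n₋₁ k a b)
  listed-cases (t , t∈ , _ , φ) = target-cases t∈ φ

  private
    1<n : 1 ℕ.< n
    1<n = ℕ.≤-trans (ℕ.s≤s (ℕ.s≤s ℕ.z≤n)) 4≤n

    b≢0 : b ≢ 0
    b≢0 refl with independent
    ... | _ ∷ _ ∷ _ ∷ _ ∷ _ ∷ _ ∷ pb ∷ _ = pb (vanishes (divides (+ 0) refl))

    a≢1 : a ≢ 1
    a≢1 refl with independent
    ... | _ ∷ _ ∷ _ ∷ _ ∷ _ ∷ _ ∷ _ ∷ pa₁ ∷ _ = pa₁ (vanishes (divides (+ 0) refl))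

    -- Evaluating the relations.
    k-1 : Z (vec (- + 1) (+ 1) (+ 0) (+ 0)) → + n ∣ + k - + 1
    k-1 (vanishes z) = lin₁ (+ 1) z (lem (+ k) (+ a) (+ b))
      where
      lem : ∀ k a b → k - + 1 ≡ + 1 * (- + 1 + + 1 * k + + 0 * a + + 0 * b)
      lem = solve-∀

    1-k : + n ∣ + k - + 1 → Z (vec (- + 1) (+ 1) (+ 0) (+ 0))
    1-k d = vanishes (lin₁ (+ 1) d (lem (+ k) (+ a) (+ b)))
      where
      lem : ∀ k a b → - + 1 + + 1 * k + + 0 * a + + 0 * b ≡ + 1 * (k - + 1)
      lem = solve-∀

    2k-2 : Z (vec (- + 2) (+ 2) (+ 0) (+ 0)) → + n ∣ + 2 * (+ k - + 1)
    2k-2 (vanishes z) = lin₁ (+ 1) z (lem (+ k) (+ a) (+ b))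
      where
      lem : ∀ k a b → + 2 * (k - + 1) ≡ + 1 * (- + 2 + + 2 * k + + 0 * a + + 0 * b)
      lem = solve-∀

    b-a-k : Z (vec (+ 0) (- + 1) (- + 1) (+ 1)) → + n ∣ + b - + a - + k
    b-a-k (vanishes z) = lin₁ (+ 1) z (lem (+ k) (+ a) (+ b))
      where
      lem : ∀ k a b → b - a - k ≡ + 1 * (+ 0 + - + 1 * k + - + 1 * a + + 1 * b)
      lem = solve-∀

  module _ (z₂ : Z (vec (+ 0) (- + 1) (- + 1) (+ 1))) where

    -- From g^n = 1, n divides (n/2) b, so b is even. With b = 2(m + 1) and a = b - 1, the relation
    -- for r^b g^2 = 1 reads 2(m^2 + m + 1) = 0; m is positive because a differs from 1.
    torus-cases : Z (vec (- + 1) (+ 1) (+ 0) (+ 0)) → Rotating → Case2 (B n₋₁ k a b)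
    torus-cases z (f , h) = conclude k≡1 (relation-n h)
      where
      k≡1 : k ≡ 1
      k≡1 = cong<⇒≡ k< 1<n (k-1 z)
      hab = b-a-k z₂
      conclude : k ≡ 1 → ∃[ j ] n ≡ j ℕ.+ j × + n ∣ + j * + b → Case2 (B n₋₁ k a b)
      conclude refl (zero , () , _)
      conclude refl (j@(suc _) , n≡ , d) = at-b b refl (∣*⇒∣ j (subst₂ ℕ∣._∣_ (trans n≡ (lem j)) refl (∣ℤ⇒ℕ (subst (+ n ∣_) (sym (ℤ.pos-* j b)) d))))
        where
        lem : ∀ j → j ℕ.+ j ≡ j ℕ.* 2
        lem = ℕR.solve-∀
        at-b : ∀ b′ → b ≡ b′ → 2 ℕ∣.∣ b′ → Case2 (B n₋₁ 1 a b)
        at-b b′ b≡ (ℕ∣.divides zero refl)    = ⊥-elim (b≢0 b≡)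
        at-b b′ b≡ (ℕ∣.divides (suc m) b′≡) = subst₂ (λ x y → Case2 (B n₋₁ 1 x y)) (sym a≡) (sym b≡m)
            (case2-from n₋₁ j m n≡ 1≤m m<j (subst (+ n ∣_) (sym ev-q) quadratic))
          where
          l₁ : ∀ m → suc m ℕ.* 2 ≡ 2 ℕ.* m ℕ.+ 2
          l₁ = ℕR.solve-∀
          l₂ : ∀ m → 2 ℕ.* m ℕ.+ 2 ≡ suc m ℕ.+ suc m
          l₂ = ℕR.solve-∀
          l₃ : ∀ m → 2 ℕ.* m ℕ.+ 2 ≡ suc (2 ℕ.* m ℕ.+ 1)
          l₃ = ℕR.solve-∀
          b≡m : b ≡ 2 ℕ.* m ℕ.+ 2
          b≡m = trans b≡ (trans b′≡ (l₁ m))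
          b-1< : 2 ℕ.* m ℕ.+ 1 ℕ.< n
          b-1< = ℕ.≤-trans (ℕ.≤-reflexive (sym (trans b≡m (l₃ m)))) (ℕ.<⇒≤ b<)
          a≡ : a ≡ 2 ℕ.* m ℕ.+ 1
          a≡ = cong<⇒≡ a< b-1< (lin₁ (- + 1) hab (trans (l₄ (+ a) (+ (2 ℕ.* m ℕ.+ 1))) (cong (λ z → - + 1 * (z - + a - + 1)) (sym (trans (cong +_ (trans b≡m (l₃ m))) refl)))))
            where
            l₄ : ∀ a x → a - x ≡ - + 1 * ((+ 1 + x) - a - + 1)
            l₄ = solve-∀
          1≤m : 1 ℕ.≤ m
          1≤m = nonzero-m m a≡
            where
            nonzero-m : ∀ m → a ≡ 2 ℕ.* m ℕ.+ 1 → 1 ℕ.≤ m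
            nonzero-m zero    e = ⊥-elim (a≢1 e)
            nonzero-m (suc _) _ = ℕ.s≤s ℕ.z≤n
          m<j : suc m ℕ.< j
          m<j = ℕ.≰⇒> λ le → ℕ.<⇒≱ b< (ℕ.≤-trans (ℕ.≤-reflexive n≡) (ℕ.≤-trans (ℕ.+-mono-≤ le le) (ℕ.≤-reflexive (sym (trans b≡m (l₂ m))))))
          ev-q : + (2 ℕ.* (m ℕ.* m ℕ.+ m ℕ.+ 1)) ≡ + 2 * (+ m * + m + + m + + 1)
          ev-q = trans (ℤ.pos-* 2 (m ℕ.* m ℕ.+ m ℕ.+ 1)) (cong (λ z → + 2 * (z + + m + + 1)) (ℤ.pos-* m m))
          quadratic : + n ∣ + 2 * (+ m * + m + + m + + 1)
          quadratic = lin₁ (- + 1) (relation-b h (suc m) (cong +_ (trans b≡m (l₂ m))))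
            (trans (l₅ (+ m)) (cong₂ (λ x y → - + 1 * (x - + 1 - (+ 1 + + m) * y)) (sym (trans (cong +_ a≡) (cong (_+ + 1) (ℤ.pos-* 2 m)))) (sym (trans (cong +_ b≡m) (cong (_+ + 2) (ℤ.pos-* 2 m))))))
            where
            l₅ : ∀ m → + 2 * (m * m + m + + 1) ≡ - + 1 * (+ 2 * m + + 1 - + 1 - (+ 1 + m) * (+ 2 * m + + 2))
            l₅ = solve-∀

    -- Here n = 2m and k = m + 1. The commutator relation gives m = 2j and b = 2 modulo 4; adding b
    -- = a + k to the relation for r^b g^2 = 1 makes j odd, whence a = 3 modulo 4. The names shift:
    -- a is the b of (iii), and b is its b + m + 1.
    cover-cases : Z (vec (- + 2) (+ 2) (+ 0) (+ 0)) → ¬ Z (vec (- + 1) (+ 1) (+ 0) (+ 0)) → ¬ Z 3ᵛ → Rotating → Case3 (B n₋₁ k a b)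
    cover-cases z₁ ¬1 ¬3 (f , h) = at-k k refl
      where
      hab = b-a-k z₂
      at-k : ∀ k′ → k ≡ k′ → Case3 (B n₋₁ k a b)
      at-k zero refl = ⊥-elim (k≢0 independent)
        where
        k≢0 : Apart distinct → ⊥
        k≢0 (_ ∷ _ ∷ _ ∷ p ∷ _) = p (vanishes (divides (+ 0) refl))
      at-k (suc zero) refl = ⊥-elim (¬1 (1-k (divides (+ 0) refl)))
      at-k (suc (suc h₀)) refl = half (∣ℤ⇒ℕ (subst (+ n ∣_) (sym (ℤ.pos-* 2 m)) (2k-2 z₁)))
        where
        m = suc h₀
        half : n ℕ∣.∣ 2 ℕ.* m → Case3 (B n₋₁ (suc m) a b)
        -- Since 0 < 2m < 2n, the only possible quotient is 1.
        half (ℕ∣.divides zero ())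
        half (ℕ∣.divides (suc (suc q)) e) = ⊥-elim (ℕ.<⇒≱ (ℕ.*-monoʳ-< 2 (ℕ.<-trans (ℕ.n<1+n m) k<))
          (ℕ.≤-trans (ℕ.*-monoˡ-≤ n {2} {suc (suc q)} (ℕ.s≤s (ℕ.s≤s ℕ.z≤n))) (ℕ.≤-reflexive (sym e))))
        half (ℕ∣.divides 1 e) = quarter (relation-commutator h m n≡ refl hab)
          where
          l₀ : ∀ m → 2 ℕ.* m ≡ m ℕ.+ m
          l₀ = ℕR.solve-∀
          n≡ : n ≡ m ℕ.+ m
          n≡ = trans (sym (ℕ.+-identityʳ n)) (trans (sym e) (l₀ m))
          quarter : ∃[ j ] m ≡ j ℕ.+ j × + n ∣ + j * + b + + m → Case3 (B n₋₁ (suc m) a b)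
          quarter (zero , () , _)
          -- n = 4j divides j (b + 2); cancelling j leaves 4 dividing b + 2.
          quarter (j@(suc _) , m≡ , d) = at-b (∣*⇒∣ j (subst₂ ℕ∣._∣_ n≡4j (trans (cong (j ℕ.* b ℕ.+_) m≡) (l₂ j b)) (∣ℤ⇒ℕ (subst (λ z → + n ∣ z + + m) (sym (ℤ.pos-* j b)) d))))
            where
            l₁ : ∀ j → j ℕ.+ j ℕ.+ (j ℕ.+ j) ≡ j ℕ.* 4
            l₁ = ℕR.solve-∀
            l₂ : ∀ j b → j ℕ.* b ℕ.+ (j ℕ.+ j) ≡ j ℕ.* (b ℕ.+ 2)
            l₂ = ℕR.solve-∀
            n≡4j : n ≡ j ℕ.* 4
            n≡4j = trans n≡ (trans (cong₂ ℕ._+_ m≡ m≡) (l₁ j))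
            at-b : 4 ℕ∣.∣ b ℕ.+ 2 → Case3 (B n₋₁ (suc m) a b)
            at-b (ℕ∣.divides zero e)    = ⊥-elim (ℕ.1+n≢0 (trans (ℕ.+-comm 2 b) e))
            at-b (ℕ∣.divides (suc w) e) = conclude (halve j)
              where
              w+ : ℤ
              w+ = + w
              b≡ : b ≡ w ℕ.* 4 ℕ.+ 2
              b≡ = ℕ.+-cancelʳ-≡ 2 b (w ℕ.* 4 ℕ.+ 2) (trans e (l₃ w))
                where
                l₃ : ∀ w → suc w ℕ.* 4 ≡ w ℕ.* 4 ℕ.+ 2 ℕ.+ 2
                l₃ = ℕR.solve-∀
              ε : ℕ
              ε = w ℕ.+ w ℕ.+ 1
              b≡2ε : b ≡ ε ℕ.+ ε
              b≡2ε = trans b≡ (l₄ w)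
                where
                l₄ : ∀ w → w ℕ.* 4 ℕ.+ 2 ≡ w ℕ.+ w ℕ.+ 1 ℕ.+ (w ℕ.+ w ℕ.+ 1)
                l₄ = ℕR.solve-∀
              b+ : + b ≡ (+ w + + w + + 1) + (+ w + + w + + 1)
              b+ = cong +_ b≡2ε
              m+ : + m ≡ + j + + j
              m+ = cong +_ m≡
              n+ : + n ≡ + j * + 4
              n+ = trans (cong +_ n≡4j) (ℤ.pos-* j 4)
              X₁ : + n ∣ ((+ w + + w + + 1) + (+ w + + w + + 1)) - + a - (+ 1 + (+ j + + j))
              X₁ = subst₂ (λ x y → + n ∣ x - + a - (+ 1 + y)) b+ m+ hab
              X₂ : + n ∣ + a - + 1 - (+ w + + w + + 1) * ((+ w + + w + + 1) + (+ w + + w + + 1))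
              X₂ = subst (λ x → + n ∣ + a - + 1 - + ε * x) b+ (relation-b h ε b≡2ε′)
                where
                b≡2ε′ : + b ≡ + (ε ℕ.+ ε)
                b≡2ε′ = cong +_ b≡2ε
              -- Halving X₁ + X₂ shows that j is odd.
              2∣j+1 : + 2 ∣ + j + + 1
              2∣j+1 = parity-of (lin₂ (+ 1) (+ 1) X₁ X₂ refl)
                where
                parity-of : + n ∣ + 1 * (((+ w + + w + + 1) + (+ w + + w + + 1)) - + a - (+ 1 + (+ j + + j))) +
                    + 1 * (+ a - + 1 - (+ w + + w + + 1) * ((+ w + + w + + 1) + (+ w + + w + + 1))) → + 2 ∣ + j + + 1
                parity-of (divides q q≡) = divides (- (+ j * q) - w+ * (w+ + w+ + + 1)) (ℤ.*-cancelˡ-≡ (+ 2) _ _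
                    (trans (l₅ (+ j) w+ (+ a)) (trans (cong (λ z → - z + - (+ 4 * w+ * (w+ + w+ + + 1))) (trans q≡ (cong (q *_) n+))) (l₆ (+ j) w+ q))))
                  where
                  l₅ : ∀ j w a → + 2 * (j + + 1) ≡ - (+ 1 * (((w + w + + 1) + (w + w + + 1)) - a - (+ 1 + (j + j))) +
                    + 1 * (a - + 1 - (w + w + + 1) * ((w + w + + 1) + (w + w + + 1)))) + - (+ 4 * w * (w + w + + 1))
                  l₅ = solve-∀
                  l₆ : ∀ j w q → - (q * (j * + 4)) + - (+ 4 * w * (w + w + + 1)) ≡ + 2 * ((- (j * q) - w * (w + w + + 1)) * + 2)
                  l₆ = solve-∀
              conclude : (∃[ i ] j ≡ i ℕ.+ i) ⊎ (∃[ i ] j ≡ suc (i ℕ.+ i)) → Case3 (B n₋₁ (suc m) a b)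
              conclude (inj₁ (i , j≡)) = ⊥-elim (even≢odd (+ i) (subst (λ z → + 2 ∣ z + + 1) (trans (cong +_ j≡) (l₇ (+ i))) 2∣j+1))
                where
                l₇ : ∀ i → i + i ≡ + 2 * i
                l₇ = solve-∀
              conclude (inj₂ (i , j≡)) = at-a (∣ℤ⇒ℕ 4∣a+1)
                where
                j+ : + j ≡ + 1 + (+ i + + i)
                j+ = cong +_ j≡
                4∣a+1 : + 4 ∣ + suc a
                4∣a+1 = lin₂ (- + 1) (w+ - + i) (∣-trans (divides (+ j) n+) X₁) ∣-refl
                    (trans (l₈ w+ (+ a) (+ i)) (cong (λ z → - + 1 * (((w+ + w+ + + 1) + (w+ + w+ + + 1)) - + a - (+ 1 + (z + z))) + (w+ - + i) * + 4) (sym j+)))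
                  where
                  l₈ : ∀ w a i → + 1 + a ≡ - + 1 * (((w + w + + 1) + (w + w + + 1)) - a - (+ 1 + ((+ 1 + (i + i)) + (+ 1 + (i + i))))) + (w - i) * + 4
                  l₈ = solve-∀
                m∣n : + m ∣ + n
                m∣n = divides (+ 2) (trans (cong +_ n≡) (l₉ (+ m)))
                  where
                  l₉ : ∀ m → m + m ≡ + 2 * m
                  l₉ = solve-∀
                -- Modulo m, 2ε = b = a + 1 and a - 1 = 2ε^2. Doubling the latter gives 2(a - 1) =
                -- (a + 1)^2, that is a^2 + 3 = 0.
                m∣a²+3 : + m ∣ + (a ℕ.* a ℕ.+ 3)
                m∣a²+3 = lin₃ (- (+ a + + 2 * + ε + + 1)) (- + 2) (- (+ a + + 2 * + ε + + 1)) (∣-trans m∣n hab) (∣-trans m∣n (relation-b h ε (cong +_ b≡2ε))) ∣-refl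
                    (trans (cong (_+ + 3) (ℤ.pos-* a a)) (trans (l₁₀ (+ a) (+ ε) (+ m))
                      (cong (λ z → - (+ a + + 2 * + ε + + 1) * (z - + a - (+ 1 + + m)) + - + 2 * (+ a - + 1 - + ε * z) + - (+ a + + 2 * + ε + + 1) * + m) (sym (cong +_ b≡2ε)))))
                  where
                  l₁₀ : ∀ a ε m → a * a + + 3 ≡ - (a + + 2 * ε + + 1) * ((ε + ε) - a - (+ 1 + m)) + - + 2 * (a - + 1 - ε * (ε + ε)) + - (a + + 2 * ε + + 1) * m
                  l₁₀ = solve-∀
                m%4 : m ℕ.% 4 ≡ 2
                m%4 = trans (cong (ℕ._% 4) (trans m≡ (trans (cong₂ ℕ._+_ j≡ j≡) (l₁₁ i)))) (ℕ.[m+kn]%n≡m%n 2 i 4)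
                  where
                  l₁₁ : ∀ i → suc (i ℕ.+ i) ℕ.+ suc (i ℕ.+ i) ≡ 2 ℕ.+ i ℕ.* 4
                  l₁₁ = ℕR.solve-∀
                2m≡n : 2 ℕ.* m ≡ n
                2m≡n = trans (l₀ m) (sym n≡)
                -- The hub step m + 1 is replaced by its negative, which is m - 1 modulo 2m.
                onto : ∀ N A C K → N ≡ n → A ≡ a → C ≡ b → K ≡ n ℕ.∸ suc m → B n₋₁ (suc m) a b ≅ Nest N 1 A C K
                onto _ _ _ _ refl refl refl refl = ≅-trans (negateIso (ℕ.<⇒≤ k<)) (≅-sym (nest≅bicirc n₋₁ 1 a b (n ℕ.∸ suc m)))
                modN-n : ∀ x N → N ≡ n → modN x N ≡ x ℕ.% n
                modN-n x _ refl = refl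
                last-spoke : (a ℕ.+ m ℕ.+ 1) ℕ.% n ≡ b
                last-spoke = cong<⇒≡ (ℕ.m%n<n (a ℕ.+ m ℕ.+ 1) n) b< (lin₂ (- + 1) (- + (x ℕ./ n)) hab ∣-refl
                    (trans (l₁₂ (+ (x ℕ.% n)) (+ (x ℕ./ n)) (+ n) (+ b)) (trans (cong (λ z → z - + (x ℕ./ n) * + n - + b) (sym x+)) (l₁₃ (+ a) (+ m) (+ b) (+ (x ℕ./ n)) (+ n)))))
                  where
                  x = a ℕ.+ m ℕ.+ 1
                  x+ : + a + + m + + 1 ≡ + (x ℕ.% n) + + (x ℕ./ n) * + n
                  x+ = trans (cong +_ (ℕ.m≡m%n+[m/n]*n x n)) (cong (λ z → + (x ℕ.% n) + z) (ℤ.pos-* (x ℕ./ n) n))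
                  l₁₂ : ∀ r q n b → r - b ≡ (r + q * n) - q * n - b
                  l₁₂ = solve-∀
                  l₁₃ : ∀ a m b q n → a + m + + 1 - q * n - b ≡ - + 1 * (b - a - (+ 1 + m)) + - q * n
                  l₁₃ = solve-∀
                n-k : m ℕ.∸ 1 ≡ n ℕ.∸ suc m
                n-k = sym (trans (cong (ℕ._∸ suc m) n≡) (ℕ.m+n∸n≡m h₀ m))
                at-a : 4 ℕ∣.∣ suc a → Case3 (B n₋₁ (suc m) a b)
                at-a (ℕ∣.divides zero ())
                -- a + 1 = 4 would mean a = 3.
                at-a (ℕ∣.divides 1 refl) = ⊥-elim (¬3 (vanishes (divides (+ 0) refl)))
                at-a (ℕ∣.divides q@(suc (suc _)) e) = m , q , ℕ.s≤s (ℕ.s≤s ℕ.z≤n)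
                  , subst (λ z → Divides m (z ℕ.* z ℕ.+ 3)) (sym b₀) (∣⇒Divides m∣a²+3)
                  , m%4 , subst₂ ℕ._<_ (sym b₀) (sym 2m≡n) a<
                  , onto _ _ _ _ 2m≡n b₀ (trans (cong (λ z → modN (z ℕ.+ m ℕ.+ 1) (2 ℕ.* m)) b₀) (trans (modN-n (a ℕ.+ m ℕ.+ 1) (2 ℕ.* m) 2m≡n) last-spoke)) n-k
                  where
                  b₀ : 4 ℕ.* q ℕ.∸ 1 ≡ a
                  b₀ = cong (ℕ._∸ 1) (trans (ℕ.*-comm 4 q) (sym e))

  cases : Z (vec (- + 2) (+ 2) (+ 0) (+ 0)) → Z (vec (+ 0) (- + 1) (- + 1) (+ 1)) → Cases (B n₋₁ k a b)
  cases z₁ z₂ = decide (Z? (vec (- + 1) (+ 1) (+ 0) (+ 0)))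
    where
    decide : Dec (Z (vec (- + 1) (+ 1) (+ 0) (+ 0))) → Cases (B n₋₁ k a b)
    decide (yes z) = [ (λ as → inj₂ (inj₁ (torus-cases z₂ z (rotating-map S modelA zs independent as)))) , listed-cases ]′
        (generic-or-listed S modelA zs independent)
      where
      zs : All Z relsA
      zs = z ∷ z₂ ∷ []
    decide (no ¬z) = [ (λ as → inj₂ (inj₂ (cover-cases z₂ z₁ ¬z (member-sound 3ᵛ as (proj₂ modelC)) (rotating-map S (proj₁ modelC) zs (¬z ∷ independent) as)))) , listed-cases ]′
        (generic-or-listed S (proj₁ modelC) zs (¬z ∷ independent))
      where
      zs : All Z relsC
      zs = z₁ ∷ z₂ ∷ []

module _ {n₋₁ k a b : ℕ} where
  private
    n = suc n₋₁
  open Sound n (+ k) (+ a) (+ b)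

  torus-or-swapped : Setup n₋₁ k a b → Z (vec (- + 2) (+ 2) (+ 0) (+ 0)) →
    Z (vec (+ 0) (- + 1) (- + 1) (+ 1)) ⊎ Z (vec (+ 0) (+ 1) (- + 1) (+ 1)) → Cases (B n₋₁ k a b)
  torus-or-swapped S z (inj₁ y) = Normal.cases S z y
  torus-or-swapped S z (inj₂ y) = cases-≅ swapIso (Normal.cases (swapped S) (swapZ (- + 2) (+ 2) (+ 0) (+ 0) z)
      (swapZ (+ 0) (- + 1) (- + 1) (+ 1) (Z-· (- + 1) {vec (+ 0) (+ 1) (- + 1) (+ 1)} y)))

module _ {n₋₁ k a b : ℕ} (S : Setup n₋₁ k a b) where
  private
    n = suc n₋₁
  open Setup S
  open Sound n (+ k) (+ a) (+ b)

  private
    1≤k : 1 ℕ.≤ k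
    1≤k = ℕ.n≢0⇒n>0 (k≢0 independent)
      where
      k≢0 : Apart distinct → k ≢ 0
      k≢0 (_ ∷ _ ∷ _ ∷ p ∷ _) refl = p (vanishes (divides (+ 0) refl))

    k≤n : k ℕ.≤ n
    k≤n = ℕ.<⇒≤ k<

    via-negation : Z (vec (+ 2) (+ 2) (+ 0) (+ 0)) →
      Z (vec (+ 0) (+ 1) (- + 1) (+ 1)) ⊎ Z (vec (+ 0) (- + 1) (- + 1) (+ 1)) → Cases (B n₋₁ k a b)
    via-negation z y = cases-≅ (negateIso k≤n) (torus-or-swapped (negated k≤n 1≤k S)
        (negateZ k≤n (- + 2) (+ 2) (+ 0) (+ 0) (Z-· (- + 1) {vec (+ 2) (+ 2) (+ 0) (+ 0)} z))
        (Sum.map (negateZ k≤n (+ 0) (- + 1) (- + 1) (+ 1)) (negateZ k≤n (+ 0) (+ 1) (- + 1) (+ 1)) y))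

  edgeTransitive⇒cases : Cases (B n₋₁ k a b)
  edgeTransitive⇒cases = [ (λ (f , f∈ , zs) → by-family f∈ zs) , Normal.listed-cases S ]′ (family-or-listed S)
    where
    by-family : ∀ {f} → f ∈ family → All Z (proj₁ f) → Cases (B n₋₁ k a b)
    by-family (here refl)                         (z ∷ y ∷ []) = torus-or-swapped S z (inj₁ y)
    by-family (there (here refl))                 (z ∷ y ∷ []) = via-negation z (inj₂ y)
    by-family (there (there (here refl)))         (z ∷ y ∷ []) = torus-or-swapped S z (inj₂ y)
    by-family (there (there (there (here refl)))) (z ∷ y ∷ []) = via-negation z (inj₁ y)

-- Normal form of a Nest graph with a triangle.

module _ {n₋₁ k a b : ℕ} (4≤n : 4 ℕ.≤ suc n₋₁) (1≤k : 1 ℕ.≤ k) (k< : k ℕ.< suc n₋₁) (2k≢n : 2 ℕ.* k ≢ suc n₋₁) where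
  private
    n = suc n₋₁
    s = spokes (+ 0) (+ 1) (+ a) (+ b)
  open Sound n (+ k) (+ a) (+ b)

  distinct-apart : (∀ i j → + n ∣ s i - s j → i ≡ j) → Apart distinct
  distinct-apart inj = small 1 (ℕ.s≤s ℕ.z≤n) (ℕ.s≤s (ℕ.s≤s ℕ.z≤n)) ∷ small 2 (ℕ.s≤s ℕ.z≤n) (ℕ.s≤s (ℕ.s≤s (ℕ.s≤s ℕ.z≤n))) ∷ small 3 (ℕ.s≤s ℕ.z≤n) (ℕ.s≤s (ℕ.s≤s (ℕ.s≤s (ℕ.s≤s ℕ.z≤n))))
    ∷ (λ (vanishes z) → 0<∣<⇒⊥ 1≤k k< (lin₁ (+ 1) z (l₁ (+ k) (+ a) (+ b))))
    ∷ (λ (vanishes z) → no-half (∣ℤ⇒ℕ (lin₁ (+ 1) z (trans (ℤ.pos-* 2 k) (l₂ (+ k) (+ a) (+ b))))))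
    ∷ (λ (vanishes z) → distinct-spokes i₂ i₀ (λ ()) (lin₁ (+ 1) z (l₃ (+ k) (+ a) (+ b))))
    ∷ (λ (vanishes z) → distinct-spokes i₃ i₀ (λ ()) (lin₁ (+ 1) z (l₄ (+ k) (+ a) (+ b))))
    ∷ (λ (vanishes z) → distinct-spokes i₂ i₁ (λ ()) (lin₁ (+ 1) z (l₅ (+ k) (+ a) (+ b))))
    ∷ (λ (vanishes z) → distinct-spokes i₃ i₁ (λ ()) (lin₁ (+ 1) z (l₆ (+ k) (+ a) (+ b))))
    ∷ (λ (vanishes z) → distinct-spokes i₃ i₂ (λ ()) (lin₁ (+ 1) z (l₇ (+ k) (+ a) (+ b)))) ∷ []
    where
    distinct-spokes : ∀ i j → i ≢ j → ¬ (+ n ∣ s i - s j)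
    distinct-spokes i j i≢j d = i≢j (inj i j d)
    small : ∀ m → 0 ℕ.< m → m ℕ.< 4 → ¬ Z (vec (+ m) (+ 0) (+ 0) (+ 0))
    small m 0<m m<4 (vanishes z) = 0<∣<⇒⊥ 0<m (ℕ.<-≤-trans m<4 4≤n) (lin₁ (+ 1) z (l₀ (+ m) (+ k) (+ a) (+ b)))
      where
      l₀ : ∀ m k a b → m ≡ + 1 * (m + + 0 * k + + 0 * a + + 0 * b)
      l₀ = solve-∀
    no-half : n ℕ∣.∣ 2 ℕ.* k → ⊥
    no-half (ℕ∣.divides zero e)          = ℕ.<⇒≢ 1≤k (sym (ℕ.m+n≡0⇒m≡0 k e))
    no-half (ℕ∣.divides 1 e)             = 2k≢n (trans e (ℕ.+-identityʳ n))
    no-half (ℕ∣.divides (suc (suc q)) e) = ℕ.<⇒≱ (ℕ.*-monoʳ-< 2 k<)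
      (ℕ.≤-trans (ℕ.*-monoˡ-≤ n {2} {suc (suc q)} (ℕ.s≤s (ℕ.s≤s ℕ.z≤n))) (ℕ.≤-reflexive (sym e)))
    l₁ : ∀ k a b → k ≡ + 1 * (+ 0 + + 1 * k + + 0 * a + + 0 * b)
    l₁ = solve-∀
    l₂ : ∀ k a b → + 2 * k ≡ + 1 * (+ 0 + + 2 * k + + 0 * a + + 0 * b)
    l₂ = solve-∀
    l₃ : ∀ k a b → a - + 0 ≡ + 1 * (+ 0 + + 0 * k + + 1 * a + + 0 * b)
    l₃ = solve-∀
    l₄ : ∀ k a b → b - + 0 ≡ + 1 * (+ 0 + + 0 * k + + 0 * a + + 1 * b)
    l₄ = solve-∀
    l₅ : ∀ k a b → a - + 1 ≡ + 1 * (- + 1 + + 0 * k + + 1 * a + + 0 * b)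
    l₅ = solve-∀
    l₆ : ∀ k a b → b - + 1 ≡ + 1 * (- + 1 + + 0 * k + + 0 * a + + 1 * b)
    l₆ = solve-∀
    l₇ : ∀ k a b → b - a ≡ + 1 * (+ 0 + + 0 * k + - + 1 * a + + 1 * b)
    l₇ = solve-∀

firstWhere : (Fin 4 → Bool) → Fin 4
firstWhere p = if p i₀ then i₀ else if p i₁ then i₁ else if p i₂ then i₂ else i₃

-- Brings the spokes `i` and `j` to the first two places. For distinct `i` and `j` this is a
-- permutation, which is verified over all pairs.
module Reordering (i j : Fin 4) where

  third fourth : Fin 4
  third  = firstWhere λ l → not (does (l Fin.≟ i) ∨ does (l Fin.≟ j))
  fourth = firstWhere λ l → not (does (l Fin.≟ i) ∨ does (l Fin.≟ j) ∨ does (l Fin.≟ third))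

  ord pos : Fin 4 → Fin 4
  ord i₀ = i
  ord i₁ = j
  ord i₂ = third
  ord i₃ = fourth
  pos l  = firstWhere λ m → does (ord m Fin.≟ l)

ord-pos : ∀ i j → i ≢ j → ∀ l → Reordering.ord i j (Reordering.pos i j l) ≡ l
ord-pos = toWitness {a? = Fin.all? λ i → Fin.all? λ j → ¬? (i Fin.≟ j) →-dec Fin.all? λ l → Reordering.ord i j (Reordering.pos i j l) Fin.≟ l} _

pos-ord : ∀ i j → i ≢ j → ∀ l → Reordering.pos i j (Reordering.ord i j l) ≡ l
pos-ord = toWitness {a? = Fin.all? λ i → Fin.all? λ j → ¬? (i Fin.≟ j) →-dec Fin.all? λ l → Reordering.pos i j (Reordering.ord i j l) Fin.≟ l} _

module Triangle (n₋₁ : ℕ) (4≤n : 4 ℕ.≤ suc n₋₁) (k : ℤ) (s : Fin 4 → ℤ) where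
  private
    n = suc n₋₁
  open Residue n

  private
    ∤small : ∀ m → 0 ℕ.< ∣ m ∣ → ∣ m ∣ ℕ.< 4 → ¬ (+ n ∣ m)
    ∤small m 0<m m<4 d = ℕ.<⇒≱ (ℕ.<-≤-trans m<4 4≤n) (ℕ∣.∣⇒≤ {{ℕ.>-nonZero 0<m}} (∣⇒∣ᵤ d))

    o p : Pt
    o = U , + 0
    p = U , + 1

  -- A common neighbour of u_0 and u_1 on the rim would make n divide 1 or 3, so it lies on the hub,
  -- and two spokes lead to it from consecutive rim vertices.
  common-neighbour : ∀ {q} → Adj k s o q → Adj k s p q → ∃[ j ] ∃[ j′ ] + n ∣ s j - (s j′ + + 1)
  common-neighbour (via d e) (via d′ e′) = go d d′ (≋-trans (≋-sym e) e′)
    where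
    go : ∀ d d′ → move k s o d ≋ move k s p d′ → ∃[ j ] ∃[ j′ ] + n ∣ s j - (s j′ + + 1)
    go fwd     fwd      e = ⊥-elim (∤small (- + 1) (ℕ.s≤s ℕ.z≤n) (ℕ.s≤s (ℕ.s≤s ℕ.z≤n)) (index-∣ e))
    go fwd     bwd      e = ⊥-elim (∤small (+ 1) (ℕ.s≤s ℕ.z≤n) (ℕ.s≤s (ℕ.s≤s ℕ.z≤n)) (index-∣ e))
    go bwd     fwd      e = ⊥-elim (∤small (- + 3) (ℕ.s≤s ℕ.z≤n) (ℕ.s≤s (ℕ.s≤s (ℕ.s≤s (ℕ.s≤s ℕ.z≤n)))) (index-∣ e))
    go bwd     bwd      e = ⊥-elim (∤small (- + 1) (ℕ.s≤s ℕ.z≤n) (ℕ.s≤s (ℕ.s≤s ℕ.z≤n)) (index-∣ e))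
    go fwd     (spk _)  (() ⨾ _)
    go bwd     (spk _)  (() ⨾ _)
    go (spk _) fwd      (() ⨾ _)
    go (spk _) bwd      (() ⨾ _)
    go (spk j) (spk j′) (_ ⨾ d) = j , j′ , lin₁ (+ 1) d (lem (s j) (s j′))
      where
      lem : ∀ x y → x - (y + + 1) ≡ + 1 * ((+ 0 + x) - (+ 1 + y))
      lem = solve-∀

  -- An edge of the triangle is carried to u_0 u_1, in either orientation; its third vertex becomes
  -- a common neighbour.
  consecutive-spokes : EdgeTransitive (Bicirc k s) → HasGirth3 (Bicirc k s) → ∃[ j ] ∃[ j′ ] + n ∣ s j - (s j′ + + 1)
  consecutive-spokes et (x , y , z , _ , _ , _ , xy , yz , zx) = by-image (et x y ⟦ o ⟧ ⟦ p ⟧ xy (edge k s o fwd))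
    where
    G = Bicirc k s
    near : ∀ (q : Pt) {w} → E G w ⟦ q ⟧ → Adj k s q (lift w)
    near q e = Adj-≋ k s (lift-⟦⟧ q) ≋-refl (Adj-sym k s e)
    by-image : ∃[ σ ] (((app {G} {G} σ x ≡ ⟦ o ⟧) × (app {G} {G} σ y ≡ ⟦ p ⟧)) ⊎ ((app {G} {G} σ x ≡ ⟦ p ⟧) × (app {G} {G} σ y ≡ ⟦ o ⟧))) →
      ∃[ j ] ∃[ j′ ] + n ∣ s j - (s j′ + + 1)
    by-image (σ , inj₁ (σx , σy)) = common-neighbour (near o (subst (E G (app {G} {G} σ z)) σx (app-E {G} {G} σ zx)))
        (near p (subst (E G (app {G} {G} σ z)) σy (Adj-sym k s (app-E {G} {G} σ yz))))
    by-image (σ , inj₂ (σx , σy)) = common-neighbour (near o (subst (E G (app {G} {G} σ z)) σy (Adj-sym k s (app-E {G} {G} σ yz))))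
        (near p (subst (E G (app {G} {G} σ z)) σx (app-E {G} {G} σ zx)))

  module Normalise (s-inj : ∀ i i′ → + n ∣ s i - s i′ → i ≡ i′) {j j′ : Fin 4} (d : + n ∣ s j - (s j′ + + 1)) where
    open Reordering j′ j
    open Affinity n

    j′≢j : j′ ≢ j
    j′≢j refl = ∤small (- + 1) (ℕ.s≤s ℕ.z≤n) (ℕ.s≤s (ℕ.s≤s ℕ.z≤n)) (lin₁ (+ 1) d (lem (s j)))
      where
      lem : ∀ x → - + 1 ≡ + 1 * (x - (x + + 1))
      lem = solve-∀

    a b : ℕ
    a = toℕ (residue (s third - s j′))
    b = toℕ (residue (s fourth - s j′))

    private
      s′ = spokes (+ 0) (+ 1) (+ a) (+ b)

    key : ∀ l → + n ∣ s′ l - (s (ord l) - s j′)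
    key i₀ = ≡⇒∣ (sym (ℤ.+-inverseʳ (s j′)))
    key i₁ = lin₁ (- + 1) d (lem (s j) (s j′))
      where
      lem : ∀ x y → + 1 - (x - y) ≡ - + 1 * (x - (y + + 1))
      lem = solve-∀
    key i₂ = residue-≡ (s third - s j′)
    key i₃ = residue-≡ (s fourth - s j′)

    s′-inj : ∀ i i′ → + n ∣ s′ i - s′ i′ → i ≡ i′
    s′-inj i i′ e = trans (sym (pos-ord j′ j j′≢j i)) (trans (cong pos (s-inj (ord i) (ord i′)
        (lin₃ (+ 1) (- + 1) (+ 1) e (key i) (key i′) (lem (s′ i) (s′ i′) (s (ord i)) (s (ord i′)) (s j′))))) (pos-ord j′ j j′≢j i′))
      where
      lem : ∀ x x′ y y′ z → y - y′ ≡ + 1 * (x - x′) + - + 1 * (x - (y - z)) + + 1 * (x′ - (y′ - z))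
      lem = solve-∀

    -- Translating the hub by `- s j′` turns the two consecutive spokes into 0 and 1.
    normalIso : Bicirc k s ≅ Bicirc k s′
    normalIso = affineIso record
      { e = false ; h = false ; t = - s j′ ; π = pos ; π⁻ = ord
      ; k-eq = ≡⇒∣ (sym (ℤ.*-identityˡ k)) ; π-eq = λ l → subst (λ m → + n ∣ s′ (pos l) - (+ 1 * s m + - s j′)) (ord-pos j′ j j′≢j l) (key′ (pos l))
      ; π⁻-eq = key′ }
      where
      key′ : ∀ l → + n ∣ s′ l - (+ 1 * s (ord l) + - s j′)
      key′ l = lin₁ (+ 1) (key l) (lem (s′ l) (s (ord l)) (s j′))
        where
        lem : ∀ x y z → x - (+ 1 * y + - z) ≡ + 1 * (x - (y - z))
        lem = solve-∀

spokes-injective : ∀ {n a b c} → 1 ℕ.≤ a → a ℕ.< n → 1 ℕ.≤ b → b ℕ.< n → 1 ℕ.≤ c → c ℕ.< n → a ≢ b → a ≢ c → b ≢ c →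
  ∀ i j → + n ∣ spokes (+ 0) (+ a) (+ b) (+ c) i - spokes (+ 0) (+ a) (+ b) (+ c) j → i ≡ j
spokes-injective {n} {a} {b} {c} 1≤a a< 1≤b b< 1≤c c< a≢b a≢c b≢c = go
  where
  0< : 0 ℕ.< n
  0< = ℕ.≤-trans 1≤a (ℕ.<⇒≤ a<)
  0≢ : ∀ {x} → 1 ℕ.≤ x → x ≡ 0 → ⊥
  0≢ () refl
  go : ∀ i j → + n ∣ spokes (+ 0) (+ a) (+ b) (+ c) i - spokes (+ 0) (+ a) (+ b) (+ c) j → i ≡ j
  go i₀ i₀ _ = refl
  go i₁ i₁ _ = refl
  go i₂ i₂ _ = refl
  go i₃ i₃ _ = refl
  go i₀ i₁ d = ⊥-elim (0≢ 1≤a (sym (cong<⇒≡ 0< a< d)))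
  go i₀ i₂ d = ⊥-elim (0≢ 1≤b (sym (cong<⇒≡ 0< b< d)))
  go i₀ i₃ d = ⊥-elim (0≢ 1≤c (sym (cong<⇒≡ 0< c< d)))
  go i₁ i₀ d = ⊥-elim (0≢ 1≤a (cong<⇒≡ a< 0< d))
  go i₂ i₀ d = ⊥-elim (0≢ 1≤b (cong<⇒≡ b< 0< d))
  go i₃ i₀ d = ⊥-elim (0≢ 1≤c (cong<⇒≡ c< 0< d))
  go i₁ i₂ d = ⊥-elim (a≢b (cong<⇒≡ a< b< d))
  go i₁ i₃ d = ⊥-elim (a≢c (cong<⇒≡ a< c< d))
  go i₂ i₁ d = ⊥-elim (a≢b (sym (cong<⇒≡ b< a< d)))
  go i₃ i₁ d = ⊥-elim (a≢c (sym (cong<⇒≡ c< a< d)))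
  go i₂ i₃ d = ⊥-elim (b≢c (cong<⇒≡ b< c< d))
  go i₃ i₂ d = ⊥-elim (b≢c (sym (cong<⇒≡ c< b< d)))

nest-cases : ∀ n₋₁ a b c k → ValidNest (suc n₋₁) a b c k → HasGirth3 (Nest (suc n₋₁) a b c k) →
  EdgeTransitive (Nest (suc n₋₁) a b c k) → Cases (Nest (suc n₋₁) a b c k)
nest-cases n₋₁ a b c k (4≤n , 1≤a , a< , 1≤b , b< , 1≤c , c< , 1≤k , k< , 2k≢n , a≢b , a≢c , b≢c) girth et =
  by-spokes (Triangle.consecutive-spokes n₋₁ 4≤n (+ k) s et′ (girth′ girth))
  where
  n = suc n₋₁
  s = spokes (+ 0) (+ a) (+ b) (+ c)
  s-inj = spokes-injective 1≤a a< 1≤b b< 1≤c c< a≢b a≢c b≢c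
  φ : Nest n a b c k ≅ Residue.Bicirc n (+ k) s
  φ = nest≅bicirc n₋₁ a b c k
  et′ : EdgeTransitive (Residue.Bicirc n (+ k) s)
  et′ = transport-ET φ et
  girth′ : HasGirth3 (Nest n a b c k) → HasGirth3 (Residue.Bicirc n (+ k) s)
  girth′ (x , y , z , p , q , r , xy , yz , zx) = x , y , z , p , q , r , app-E φ xy , app-E φ yz , app-E φ zx
  by-spokes : ∃[ j ] ∃[ j′ ] + n ∣ s j - (s j′ + + 1) → Cases (Nest n a b c k)
  by-spokes (j , j′ , d) = cases-≅ (≅-trans φ R.normalIso) (edgeTransitive⇒cases record
    { 4≤n = 4≤n ; k< = k< ; a< = Fin.toℕ<n _ ; b< = Fin.toℕ<n _
    ; independent = distinct-apart 4≤n 1≤k k< 2k≢n R.s′-inj ; et = transport-ET R.normalIso et′ })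
    where
    module R = Triangle.Normalise n₋₁ 4≤n (+ k) s s-inj {j} {j′} d

-- The converse: symmetry of the graphs in (ii) and (iii).

module _ (n : ℕ) .{{nz : NonZero n}} where
  open Residue n
  open Affinity n

  relabelIso : ∀ {k k′ s s′} h → + n ∣ k′ - sg h * k → (∀ j → + n ∣ s′ j - s j) → Bicirc k s ≅ Bicirc k′ s′
  relabelIso {s = s} {s′} h k-eq s-eq = affineIso record
    { e = false ; h = h ; t = + 0 ; π = id ; π⁻ = id ; k-eq = k-eq ; π-eq = s-eq′ ; π⁻-eq = s-eq′ }
    where
    lem : ∀ x y → x - (+ 1 * y + + 0) ≡ + 1 * (x - y)
    lem = solve-∀
    s-eq′ : ∀ j → + n ∣ s′ j - (+ 1 * s j + + 0)
    s-eq′ j = lin₁ (+ 1) (s-eq j) (lem (s′ j) (s j))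

  affineIso-app : ∀ {k k′ s s′} (A : Affine k s k′ s′) p →
    app {Bicirc k s} {Bicirc k′ s′} (affineIso A) ⟦ p ⟧ ≡ ⟦ affine (Affine.e A) (Affine.t A) p ⟧
  affineIso-app A p = ≋⇒≡ (affine-≋ (Affine.e A) (Affine.t A) (lift-⟦⟧ p))

-- This is `Homogeneous` with t = 0 and e = m + 1. Since 1 + a = b, the map u_i to u_(-i), v_i to
-- v_(b - i) exchanges the spokes 0 with b and 1 with a; it reverses the rim at u_0.
case2-AT : ∀ {G} → Case2 G → ArcTransitive G
case2-AT {G} (m , n , 1≤m , (ν , n≡) , (q , d) , le , φ) = at m n 1≤m n≡ d le φ
  where
  at : ∀ m n → 1 ℕ.≤ m → n ≡ 2 ℕ.* ν → 2 ℕ.* (m ℕ.* m ℕ.+ m ℕ.+ 1) ≡ q ℕ.* n → 4 ℕ.* m ℕ.+ 2 ℕ.≤ n →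
    G ≅ Nest n 1 (2 ℕ.* m ℕ.+ 1) (2 ℕ.* m ℕ.+ 2) 1 → ArcTransitive G
  at (suc _) zero       _ _  _ () _
  at m       n@(suc n₋₁) _ n≡ d _  φ = transport-AT (≅-sym (≅-trans φ (≅-trans (nest≅bicirc n₋₁ 1 (2 ℕ.* m ℕ.+ 1) (2 ℕ.* m ℕ.+ 2) 1)
      (relabelIso n false (divides (+ 0) refl) same′-spokes)))) (H.isArcTransitive ι ι-0 ι-1)
    where
    e : ℤ
    e = + m + + 1
    h₃ : + n ∣ + 2 * (e * e - e + + 1) - + 2 * + 0
    h₃ = divides (+ q) (trans (lem (+ m)) (trans (sym (trans (ℤ.pos-* 2 (m ℕ.* m ℕ.+ m ℕ.+ 1)) (cong (λ z → + 2 * (z + + m + + 1)) (ℤ.pos-* m m)))) (trans (cong +_ d) (ℤ.pos-* q n))))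
      where
      lem : ∀ m → + 2 * ((m + + 1) * (m + + 1) - (m + + 1) + + 1) - + 2 * + 0 ≡ + 2 * (m * m + m + + 1)
      lem = solve-∀
    module H = Homogeneous n e (+ 0) (+ ν) (trans (cong +_ n≡) (ℤ.pos-* 2 ν)) (divides (+ 0) refl) (divides (+ 0) refl) h₃
    open Residue n
    same′-spokes : ∀ j → + n ∣ spokes (+ 0) (+ 1) H.a H.b j - spokes (+ 0) (+ 1) (+ (2 ℕ.* m ℕ.+ 1)) (+ (2 ℕ.* m ℕ.+ 2)) j
    same′-spokes i₀ = divides (+ 0) refl
    same′-spokes i₁ = divides (+ 0) refl
    same′-spokes i₂ = ≡⇒∣ (trans (lem (+ m)) (cong (_+ + 1) (sym (ℤ.pos-* 2 m))))
      where
      lem : ∀ m → + 2 * (m + + 1) - + 1 - + 2 * + 0 ≡ + 2 * m + + 1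
      lem = solve-∀
    same′-spokes i₃ = ≡⇒∣ (trans (lem (+ m)) (cong (_+ + 2) (sym (ℤ.pos-* 2 m))))
      where
      lem : ∀ m → + 2 * (m + + 1) ≡ + 2 * m + + 2
      lem = solve-∀
    π : Fin 4 → Fin 4
    π i₀ = i₃
    π i₁ = i₂
    π i₂ = i₁
    π i₃ = i₀
    reversed : ∀ j → + n ∣ spokes (+ 0) (+ 1) H.a H.b (π j) - (- + 1 * spokes (+ 0) (+ 1) H.a H.b j + H.b)
    reversed i₀ = ≡⇒∣ (lem H.b)
      where
      lem : ∀ b → b ≡ - + 1 * + 0 + b
      lem = solve-∀
    reversed i₁ = ≡⇒∣ (lem e)
      where
      lem : ∀ e → + 2 * e - + 1 - + 2 * + 0 ≡ - + 1 * + 1 + + 2 * e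
      lem = solve-∀
    reversed i₂ = ≡⇒∣ (lem e)
      where
      lem : ∀ e → + 1 ≡ - + 1 * (+ 2 * e - + 1 - + 2 * + 0) + + 2 * e
      lem = solve-∀
    reversed i₃ = ≡⇒∣ (lem H.b)
      where
      lem : ∀ b → + 0 ≡ - + 1 * b + b
      lem = solve-∀
    A : Affinity.Affine n H.k (spokes (+ 0) (+ 1) H.a H.b) H.k (spokes (+ 0) (+ 1) H.a H.b)
    A = record { e = true ; h = false ; t = H.b ; π = π ; π⁻ = π ; k-eq = divides (+ 0) refl ; π-eq = reversed
      ; π⁻-eq = λ j → subst (λ l → + n ∣ spokes (+ 0) (+ 1) H.a H.b l - (- + 1 * spokes (+ 0) (+ 1) H.a H.b (π j) + H.b)) (ππ j) (reversed (π j)) }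
      where
      ππ : ∀ j → π (π j) ≡ j
      ππ i₀ = refl
      ππ i₁ = refl
      ππ i₂ = refl
      ππ i₃ = refl
    ι : Aut H.Γ
    ι = Affinity.affineIso n A
    ι-0 : app {H.Γ} {H.Γ} ι ⟦ U , + 0 ⟧ ≡ ⟦ U , + 0 ⟧
    ι-0 = affineIso-app n A (U , + 0)
    ι-1 : app {H.Γ} {H.Γ} ι ⟦ U , + 1 ⟧ ≡ ⟦ U , - + 1 ⟧
    ι-1 = affineIso-app n A (U , + 1)

targets-small : All (λ t → Target.n₋₁ t ℕ.≤ 11) targets
targets-small = toWitness {a? = All.all? (λ t → Target.n₋₁ t ℕ.≤? 11) targets} _

-- The congruences of (iii) are solved for: m = 4i + 2, and b = 4c + 7 is 4b₀ - 1 with b₀ = c + 2.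
module Cover (i c b : ℕ) (b≡ : b ≡ 7 ℕ.+ c ℕ.* 4) (m∣ : Divides (2 ℕ.+ i ℕ.* 4) (b ℕ.* b ℕ.+ 3))
  (b< : b ℕ.< 2 ℕ.* (2 ℕ.+ i ℕ.* 4)) where

  m n₋₁ n x c′ : ℕ
  m   = 2 ℕ.+ i ℕ.* 4
  n₋₁ = ℕ.pred (2 ℕ.* m)
  n   = suc n₋₁
  x   = b ℕ.+ m ℕ.+ 1
  c′  = modN x (2 ℕ.* m)

  private
    I C : ℤ
    I = + i
    C = + c

    m+ : + m ≡ + 4 * I + + 2
    m+ = trans (cong (λ z → + 2 + z) (ℤ.pos-* i 4)) (lem I)
      where
      lem : ∀ i → + 2 + i * + 4 ≡ + 4 * i + + 2
      lem = solve-∀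

    n+ : + n ≡ + 8 * I + + 4
    n+ = trans (ℤ.pos-* 2 m) (trans (cong (+ 2 *_) m+) (lem I))
      where
      lem : ∀ i → + 2 * (+ 4 * i + + 2) ≡ + 8 * i + + 4
      lem = solve-∀

    b+ : + b ≡ + 4 * C + + 7
    b+ = trans (cong +_ b≡) (trans (cong (λ z → + 7 + z) (ℤ.pos-* c 4)) (lem C))
      where
      lem : ∀ c → + 7 + c * + 4 ≡ + 4 * c + + 7
      lem = solve-∀

    multiple : ∀ {z} q → z ≡ q * (+ 8 * I + + 4) → + n ∣ z
    multiple q e = divides q (trans e (cong (q *_) (sym n+)))

    4∣n : + 4 ∣ + n
    4∣n = divides (+ 2 * I + + 1) (trans n+ (lem I))
      where
      lem : ∀ i → + 8 * i + + 4 ≡ (+ 2 * i + + 1) * + 4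
      lem = solve-∀

    c′-≡ : + n ∣ + c′ - (+ 4 * C + + 4 * I + + 10)
    c′-≡ = divides (- + (x ℕ./ n)) (trans (cong (λ z → + (x ℕ.% n) - z) (trans (sym x+) x≡)) (lem (+ (x ℕ.% n)) (+ (x ℕ./ n)) (+ n)))
      where
      x≡ : + x ≡ + (x ℕ.% n) + + (x ℕ./ n) * + n
      x≡ = trans (cong +_ (ℕ.m≡m%n+[m/n]*n x n)) (cong (λ z → + (x ℕ.% n) + z) (ℤ.pos-* (x ℕ./ n) n))
      x+ : + x ≡ + 4 * C + + 4 * I + + 10
      x+ = trans (cong₂ (λ y z → y + z + + 1) b+ m+) (l C I)
        where
        l : ∀ c i → + 4 * c + + 7 + (+ 4 * i + + 2) + + 1 ≡ + 4 * c + + 4 * i + + 10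
        l = solve-∀
      lem : ∀ r q n → r - (r + q * n) ≡ - q * n
      lem = solve-∀

    c′< : c′ ℕ.< n
    c′< = ℕ.m%n<n x n

    -- m divides b² + 3 = 4(4c² + 14c + 13), and both the quotient by 2m and m / 2 are odd.
    odd-quotient : ∃[ p ] (+ 2 * p + + 1) * (+ 2 * I + + 1) ≡ + 4 * C * C + + 14 * C + + 13
    odd-quotient = extract m∣
      where
      extract : Divides m (b ℕ.* b ℕ.+ 3) → ∃[ p ] (+ 2 * p + + 1) * (+ 2 * I + + 1) ≡ + 4 * C * C + + 14 * C + + 13
      extract (q , e) = halved (halve q)
        where
        e₁ : + q * (+ 2 * I + + 1) ≡ + 8 * C * C + + 28 * C + + 26
        e₁ = ℤ.*-cancelˡ-≡ (+ 2) _ _ (trans (l₁ (+ q) I) (trans (sym (trans (ℤ.pos-* q m) (cong (+ q *_) m+))) (trans (sym (cong +_ e))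
            (trans (cong (_+ + 3) (trans (ℤ.pos-* b b) (cong₂ _*_ b+ b+))) (l₂ C)))))
          where
          l₁ : ∀ q i → + 2 * (q * (+ 2 * i + + 1)) ≡ q * (+ 4 * i + + 2)
          l₁ = solve-∀
          l₂ : ∀ c → (+ 4 * c + + 7) * (+ 4 * c + + 7) + + 3 ≡ + 2 * (+ 8 * c * c + + 28 * c + + 26)
          l₂ = solve-∀
        halved : (∃[ j ] q ≡ j ℕ.+ j) ⊎ (∃[ j ] q ≡ suc (j ℕ.+ j)) → ∃[ p ] (+ 2 * p + + 1) * (+ 2 * I + + 1) ≡ + 4 * C * C + + 14 * C + + 13
        halved (inj₂ (j , q≡)) = ⊥-elim (even≢odd (+ 2 * + j * I + I + + j) (divides (+ 4 * C * C + + 14 * C + + 13)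
            (trans (l₁ (+ j) I) (trans (cong (λ z → z * (+ 2 * I + + 1)) (sym (cong +_ q≡))) (trans e₁ (l₂ C))))))
          where
          l₁ : ∀ j i → + 2 * (+ 2 * j * i + i + j) + + 1 ≡ (+ 1 + (j + j)) * (+ 2 * i + + 1)
          l₁ = solve-∀
          l₂ : ∀ c → + 8 * c * c + + 28 * c + + 26 ≡ (+ 4 * c * c + + 14 * c + + 13) * + 2
          l₂ = solve-∀
        halved (inj₁ (j , q≡)) = odd (halve j)
          where
          e₂ : + j * (+ 2 * I + + 1) ≡ + 4 * C * C + + 14 * C + + 13
          e₂ = ℤ.*-cancelˡ-≡ (+ 2) _ _ (trans (l₁ (+ j) I) (trans (cong (λ z → z * (+ 2 * I + + 1)) (sym (cong +_ q≡))) (trans e₁ (l₂ C))))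
            where
            l₁ : ∀ j i → + 2 * (j * (+ 2 * i + + 1)) ≡ (j + j) * (+ 2 * i + + 1)
            l₁ = solve-∀
            l₂ : ∀ c → + 8 * c * c + + 28 * c + + 26 ≡ + 2 * (+ 4 * c * c + + 14 * c + + 13)
            l₂ = solve-∀
          odd : (∃[ p ] j ≡ p ℕ.+ p) ⊎ (∃[ p ] j ≡ suc (p ℕ.+ p)) → ∃[ p ] (+ 2 * p + + 1) * (+ 2 * I + + 1) ≡ + 4 * C * C + + 14 * C + + 13
          odd (inj₁ (p , j≡)) = ⊥-elim (even≢odd (+ 2 * C * C + + 7 * C + + 6) (divides (+ p * (+ 2 * I + + 1))
              (trans (l₁ C) (trans (sym e₂) (trans (cong (λ z → z * (+ 2 * I + + 1)) (cong +_ j≡)) (l₂ (+ p) I))))))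
            where
            l₁ : ∀ c → + 2 * (+ 2 * c * c + + 7 * c + + 6) + + 1 ≡ + 4 * c * c + + 14 * c + + 13
            l₁ = solve-∀
            l₂ : ∀ p i → (p + p) * (+ 2 * i + + 1) ≡ p * (+ 2 * i + + 1) * + 2
            l₂ = solve-∀
          odd (inj₂ (p , j≡)) = + p , trans (cong (λ z → z * (+ 2 * I + + 1)) (trans (l (+ p)) (sym (cong +_ j≡)))) e₂
            where
            l : ∀ p → + 2 * p + + 1 ≡ + 1 + (p + p)
            l = solve-∀

    -- Chosen so that 2t = m and 2e = b + m + 1, the last spoke before reduction.
    t e : ℤ
    t = + 2 * I + + 1
    e = + 2 * C + + 2 * I + + 5

    h₁ : + n ∣ + 4 * t
    h₁ = multiple (+ 1) (lem I)
      where
      lem : ∀ i → + 4 * (+ 2 * i + + 1) ≡ + 1 * (+ 8 * i + + 4)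
      lem = solve-∀

    h₂ : + n ∣ + 2 * t * (e + + 1)
    h₂ = multiple (C + I + + 3) (lem I C)
      where
      lem : ∀ i c → + 2 * (+ 2 * i + + 1) * (+ 2 * c + + 2 * i + + 5 + + 1) ≡ (c + i + + 3) * (+ 8 * i + + 4)
      lem = solve-∀

    -- Half of the expression is a sum of two odd multiples of t = n/4, hence an even multiple. This
    -- is where the parity of the quotient matters.
    h₃ : + n ∣ + 2 * (e * e - e + + 1) - + 2 * t
    h₃ = extract odd-quotient
      where
      extract : (∃[ p ] (+ 2 * p + + 1) * (+ 2 * I + + 1) ≡ + 4 * C * C + + 14 * C + + 13) → + n ∣ + 2 * (e * e - e + + 1) - + 2 * t
      extract (p , hyp) = multiple (p + + 2 * C + + 4 + I) (trans (l₁ I C) (trans (cong (λ z → + 2 * (z + (+ 2 * I + + 1) * (+ 4 * C + + 7 + + 2 * I))) (sym hyp)) (l₂ p I C)))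
        where
        l₁ : ∀ i c → + 2 * ((+ 2 * c + + 2 * i + + 5) * (+ 2 * c + + 2 * i + + 5) - (+ 2 * c + + 2 * i + + 5) + + 1) - + 2 * (+ 2 * i + + 1)
          ≡ + 2 * (+ 4 * c * c + + 14 * c + + 13 + (+ 2 * i + + 1) * (+ 4 * c + + 7 + + 2 * i))
        l₁ = solve-∀
        l₂ : ∀ p i c → + 2 * ((+ 2 * p + + 1) * (+ 2 * i + + 1) + (+ 2 * i + + 1) * (+ 4 * c + + 7 + + 2 * i)) ≡ (p + + 2 * c + + 4 + i) * (+ 8 * i + + 4)
        l₂ = solve-∀

    module H = Homogeneous n e t (+ m) (ℤ.pos-* 2 m) h₁ h₂ h₃

    Γ : Graph
    Γ = B n₋₁ (suc m) b c′

    homogeneous≅ : H.Γ ≅ Γ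
    homogeneous≅ = relabelIso n false (Residue.≡⇒∣ n (trans (cong (λ z → + 1 + z) m+) (l I))) same′
      where
      l : ∀ i → + 1 + (+ 4 * i + + 2) ≡ + 1 * (+ 1 + + 2 * (+ 2 * i + + 1))
      l = solve-∀
      same′ : ∀ j → + n ∣ spokes (+ 0) (+ 1) (+ b) (+ c′) j - spokes (+ 0) (+ 1) H.a H.b j
      same′ i₀ = divides (+ 0) refl
      same′ i₁ = divides (+ 0) refl
      same′ i₂ = Residue.≡⇒∣ n (trans b+ (l₂ I C))
        where
        l₂ : ∀ i c → + 4 * c + + 7 ≡ + 2 * (+ 2 * c + + 2 * i + + 5) - + 1 - + 2 * (+ 2 * i + + 1)
        l₂ = solve-∀
      same′ i₃ = subst (λ z → + n ∣ + c′ - z) (l₃ I C) c′-≡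
        where
        l₃ : ∀ i c → + 4 * c + + 4 * i + + 10 ≡ + 2 * (+ 2 * c + + 2 * i + + 5)
        l₃ = solve-∀

    -- m = 2 contradicts 7 ≤ b < 2m. For m = 6 only b = 7 and b = 11 are small enough, but 6 divides
    -- neither 52 nor 124. Consequently n is at least 20, beyond all listed graphs.
    small-i : ¬ i ℕ.≤ 1
    small-i i≤1 = absurd i c i≤1 (subst (ℕ._< 2 ℕ.* m) b≡ b<) (subst (λ z → Divides m (z ℕ.* z ℕ.+ 3)) b≡ m∣)
      where
      absurd : ∀ i c → i ℕ.≤ 1 → 7 ℕ.+ c ℕ.* 4 ℕ.< 2 ℕ.* (2 ℕ.+ i ℕ.* 4) → ¬ Divides (2 ℕ.+ i ℕ.* 4) ((7 ℕ.+ c ℕ.* 4) ℕ.* (7 ℕ.+ c ℕ.* 4) ℕ.+ 3)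
      absurd 0 _ _ less _ = ℕ.<⇒≱ less (ℕ.≤-trans (ℕ.s≤s (ℕ.s≤s (ℕ.s≤s (ℕ.s≤s ℕ.z≤n)))) (ℕ.m≤m+n 7 _))
      absurd 1 0 _ _ (q , e) = contradiction (ℕ∣.divides q e) (toWitnessFalse {a? = 6 ℕ∣.∣? 52} _)
      absurd 1 1 _ _ (q , e) = contradiction (ℕ∣.divides q e) (toWitnessFalse {a? = 6 ℕ∣.∣? 124} _)
      absurd 1 (suc (suc c)) _ less _ = ℕ.<⇒≱ less (ℕ.≤-trans (toWitness {a? = 12 ℕ.≤? 15} _) (ℕ.m≤m+n 15 _))
      absurd (suc (suc _)) _ (ℕ.s≤s ()) _ _

    4≤n : 4 ℕ.≤ n
    4≤n = ℕ.*-monoʳ-≤ 2 (ℕ.s≤s (ℕ.s≤s (ℕ.z≤n {i ℕ.* 4})))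

    k< : suc m ℕ.< n
    k< = ℕ.≤-trans (ℕ.+-monoˡ-≤ m {2} {m} (ℕ.s≤s (ℕ.s≤s ℕ.z≤n))) (ℕ.≤-reflexive (lem m))
      where
      lem : ∀ m → m ℕ.+ m ≡ 2 ℕ.* m
      lem = ℕR.solve-∀

    1≤b : 1 ℕ.≤ b
    1≤b = subst (1 ℕ.≤_) (sym b≡) (ℕ.s≤s ℕ.z≤n)

    mod4 : ∀ r → 0 ℕ.< r → r ℕ.< 4 → ¬ (+ 4 ∣ + r)
    mod4 r = 0<∣<⇒⊥

    c′-mod4 : + 4 ∣ + c′ - + 2
    c′-mod4 = lin₂ (+ 1) (C + I + + 2) (∣-trans 4∣n c′-≡) ∣-refl (lem (+ c′) C I)
      where
      lem : ∀ x c i → x - + 2 ≡ + 1 * (x - (+ 4 * c + + 4 * i + + 10)) + (c + i + + 2) * + 4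
      lem = solve-∀

    -- n is divisible by 4, and 0, 1, b, `c′` are 0, 1, 3, 2 modulo 4.
    s-inj : ∀ i j → + n ∣ spokes (+ 0) (+ 1) (+ b) (+ c′) i - spokes (+ 0) (+ 1) (+ b) (+ c′) j → i ≡ j
    s-inj = spokes-injective (ℕ.s≤s ℕ.z≤n) (ℕ.≤-trans (ℕ.s≤s (ℕ.s≤s ℕ.z≤n)) 4≤n) 1≤b b< (ℕ.n≢0⇒n>0 c′≢0) c′< 1≢b 1≢c′ b≢c′
      where
      c′≢0 : c′ ≢ 0
      c′≢0 hyp = mod4 2 (ℕ.s≤s ℕ.z≤n) (ℕ.s≤s (ℕ.s≤s (ℕ.s≤s ℕ.z≤n))) (lin₁ (- + 1) (subst (λ z → + 4 ∣ + z - + 2) hyp c′-mod4) refl)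
      1≢b : 1 ≢ b
      1≢b hyp = ℕ.1+n≢0 (sym (ℕ.suc-injective (trans hyp b≡)))
      1≢c′ : 1 ≢ c′
      1≢c′ hyp = mod4 1 (ℕ.s≤s ℕ.z≤n) (ℕ.s≤s (ℕ.s≤s ℕ.z≤n)) (lin₁ (- + 1) (subst (λ z → + 4 ∣ + z - + 2) (sym hyp) c′-mod4) refl)
      b≢c′ : b ≢ c′
      b≢c′ hyp = mod4 1 (ℕ.s≤s ℕ.z≤n) (ℕ.s≤s (ℕ.s≤s ℕ.z≤n)) (lin₂ (+ 1) (- C - + 1) (subst (λ z → + 4 ∣ z - + 2) (trans (sym (cong +_ hyp)) b+) c′-mod4) ∣-refl (lem C))
        where
        lem : ∀ c → + 1 ≡ + 1 * (+ 4 * c + + 7 - + 2) + (- c - + 1) * + 4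
        lem = solve-∀

    setup : Setup n₋₁ (suc m) b c′
    setup = record
      { 4≤n = 4≤n ; k< = k< ; a< = b< ; b< = c′<
      ; independent = distinct-apart 4≤n (ℕ.s≤s ℕ.z≤n) k< (λ hyp → ℕ.1+n≢n (ℕ.*-cancelˡ-≡ (suc m) m 2 hyp)) s-inj
      ; et = transport-ET homogeneous≅ H.isEdgeTransitive }

    open Sound n (+ suc m) (+ b) (+ c′)

    zs : All Z relsC
    zs = vanishes (multiple (+ 1) (trans (cong (λ z → - + 2 + + 2 * (+ 1 + z) + + 0 * + b + + 0 * + c′) m+) (l₁ I (+ b) (+ c′))))
       ∷ vanishes (lin₁ (+ 1) c′-≡ (trans (cong₂ (λ y z → + 0 + - + 1 * (+ 1 + y) + - + 1 * z + + 1 * + c′) m+ b+) (l₂ I C (+ c′)))) ∷ []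
      where
      l₁ : ∀ i b c → - + 2 + + 2 * (+ 1 + (+ 4 * i + + 2)) + + 0 * b + + 0 * c ≡ + 1 * (+ 8 * i + + 4)
      l₁ = solve-∀
      l₂ : ∀ i c x → + 0 + - + 1 * (+ 1 + (+ 4 * i + + 2)) + - + 1 * (+ 4 * c + + 7) + + 1 * x ≡ + 1 * (x - (+ 4 * c + + 4 * i + + 10))
      l₂ = solve-∀

    -- k - 1 = m is 2 modulo 4, while n is divisible by 4.
    ¬torus : ¬ Z (vec (- + 1) (+ 1) (+ 0) (+ 0))
    ¬torus (vanishes z) = mod4 2 (ℕ.s≤s ℕ.z≤n) (ℕ.s≤s (ℕ.s≤s (ℕ.s≤s ℕ.z≤n))) (lin₂ (+ 1) (- I) (∣-trans 4∣n z) ∣-refl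
        (trans (l I (+ b) (+ c′)) (cong (λ z → + 1 * (- + 1 + + 1 * (+ 1 + z) + + 0 * + b + + 0 * + c′) + - I * + 4) (sym m+))))
      where
      l : ∀ i b c → + 2 ≡ + 1 * (- + 1 + + 1 * (+ 1 + (+ 4 * i + + 2)) + + 0 * b + + 0 * c) + - i * + 4
      l = solve-∀

    -- A reflection would force m / 2 to divide b, hence also 3.
    unreflected : ¬ (+ n ∣ + b + + c′ - + 1)
    unreflected d = small-i (i≤1-of i (∣ℤ⇒ℕ (subst (_∣ + 3) t+ t∣3)))
      where
      i≤1-of : ∀ i → suc (i ℕ.+ i) ℕ∣.∣ 3 → i ℕ.≤ 1
      i≤1-of 0             _ = ℕ.z≤n
      i≤1-of 1             _ = ℕ.s≤s ℕ.z≤n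
      i≤1-of (suc (suc i)) d = ⊥-elim (ℕ.<⇒≱ (ℕ.+-mono-≤ {3} {suc (suc (suc i))} {1} {suc (suc i)} (ℕ.s≤s (ℕ.s≤s (ℕ.s≤s ℕ.z≤n))) (ℕ.s≤s ℕ.z≤n)) (ℕ∣.∣⇒≤ d))
      t+ : t ≡ + suc (i ℕ.+ i)
      t+ = lem I
        where
        lem : ∀ i → + 2 * i + + 1 ≡ + 1 + (i + i)
        lem = solve-∀
      t∣n : t ∣ + n
      t∣n = divides (+ 4) (trans n+ (lem I))
        where
        lem : ∀ i → + 8 * i + + 4 ≡ + 4 * (+ 2 * i + + 1)
        lem = solve-∀
      n∣ : + n ∣ + 8 * C + + 4 * I + + 16
      n∣ = lin₂ (+ 1) (- + 1) d c′-≡ (trans (lem C I (+ c′)) (cong (λ z → + 1 * (z + + c′ - + 1) + - + 1 * (+ c′ - (+ 4 * C + + 4 * I + + 10))) (sym b+)))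
        where
        lem : ∀ c i x → + 8 * c + + 4 * i + + 16 ≡ + 1 * (+ 4 * c + + 7 + x - + 1) + - + 1 * (x - (+ 4 * c + + 4 * i + + 10))
        lem = solve-∀
      t∣2c+i+4 : t ∣ + 2 * C + I + + 4
      t∣2c+i+4 = extract n∣
        where
        extract : + n ∣ + 8 * C + + 4 * I + + 16 → t ∣ + 2 * C + I + + 4
        extract (divides q hyp) = divides q (ℤ.*-cancelˡ-≡ (+ 4) _ _ (trans (l₁ C I) (trans hyp (trans (cong (q *_) n+) (l₂ q I)))))
          where
          l₁ : ∀ c i → + 4 * (+ 2 * c + i + + 4) ≡ + 8 * c + + 4 * i + + 16
          l₁ = solve-∀
          l₂ : ∀ q i → q * (+ 8 * i + + 4) ≡ + 4 * (q * (+ 2 * i + + 1))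
          l₂ = solve-∀
      t∣quadratic : t ∣ + 4 * C * C + + 14 * C + + 13
      t∣quadratic = divides (+ 2 * proj₁ odd-quotient + + 1) (sym (proj₂ odd-quotient))
      t∣3 : t ∣ + 3
      t∣3 = lin₃ (+ 4) (- + 2 * (+ 4 * C + + 7)) (+ 4 * C + + 7) t∣quadratic t∣2c+i+4 ∣-refl (lem C I)
        where
        lem : ∀ c i → + 3 ≡ + 4 * (+ 4 * c * c + + 14 * c + + 13) + - + 2 * (+ 4 * c + + 7) * (+ 2 * c + i + + 4) + (+ 4 * c + + 7) * (+ 2 * i + + 1)
        lem = solve-∀

    -- Arc-transitivity yields an automorphism fixing u_0 and taking u_1 to its other rim neighbour,
    -- so its dihedral map has index 3. An odd index is allowed only for a reflection, and
    -- `reflected` then contradicts `unreflected`. The nongeneric alternative is excluded by the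
    -- order.
    ¬arc : ¬ ArcTransitive Γ
    ¬arc at = [ generic , listed ]′ (generic-or-listed setup (proj₁ modelC) zs (¬torus ∷ Setup.independent setup))
      where
      open Residue n
      o : Pt
      o = U , + 0
      generic : Apart (LocalModel.ap (proj₁ modelC)) → ⊥
      generic as = by-arc (at ⟦ o ⟧ ⟦ U , + 1 ⟧ ⟦ o ⟧ ⟦ U , - + 1 ⟧ (edge (+ suc m) _ o fwd) (edge (+ suc m) _ o bwd))
        where
        by-arc : ∃[ σ ] ((app {Γ} {Γ} σ ⟦ o ⟧ ≡ ⟦ o ⟧) × (app {Γ} {Γ} σ ⟦ U , + 1 ⟧ ≡ ⟦ U , - + 1 ⟧)) → ⊥
        by-arc (σ , fo , f1) = by-symmetry (rigidity setup (proj₁ modelC) zs (¬torus ∷ Setup.independent setup) as σ)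
          where
          module X = Hexagon n (+ suc m) (+ b) (+ c′)
          by-symmetry : ∃[ s ] ∃[ e ] evenDihedral s e ≡ true × X.Equivariant (app {Γ} {Γ} σ) (act s e) → ⊥
          by-symmetry (s , e , allowed , h) = conclude s e e≡ allowed h
            where
            e≡ : e ≡ d₃
            e≡ = X.N-inj (simple setup) o {e} {d₃} (trans (cong (λ z → ⟦ X.N o z ⟧) (sym (act-0 s e))) (trans (sym (X.equi h o o fo d₀)) f1))
            conclude : ∀ s e → e ≡ d₃ → evenDihedral s e ≡ true → X.Equivariant (app {Γ} {Γ} σ) (act s e) → ⊥
            conclude false _ refl () _
            conclude true  _ refl _  h = unreflected (Rotation.reflected n (+ suc m) (+ b) (+ c′) h fo c′ refl)
      listed : Listed n₋₁ (suc m) b c′ 4≤n k< b< c′< → ⊥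
      listed (t , t∈ , n≡ , _) = small-i (ℕ.≮⇒≥ λ 2≤i → ℕ.<⇒≱ (toWitness {a? = 13 ℕ.≤? 20} _)
          (ℕ.≤-trans (ℕ.*-monoʳ-≤ 2 {10} {m} (ℕ.s≤s (ℕ.s≤s (ℕ.*-monoˡ-≤ 4 2≤i)))) (ℕ.s≤s (subst (ℕ._≤ 11) (sym n≡) (All.lookup targets-small t∈)))))

  nest≅ : Nest (2 ℕ.* m) 1 b c′ (m ℕ.∸ 1) ≅ Γ
  nest≅ = ≅-trans (nest≅bicirc n₋₁ 1 b c′ (m ℕ.∸ 1)) (relabelIso n true
      (multiple (+ 1) (trans (cong (λ z → + 3 + z - - + 1 * (+ 1 + z)) (ℤ.pos-* i 4)) (lem I))) (λ j → Residue.≡⇒∣ n {spokes (+ 0) (+ 1) (+ b) (+ c′) j} refl))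
    where
    lem : ∀ i → + 3 + i * + 4 - - + 1 * (+ 1 + i * + 4) ≡ + 1 * (+ 8 * i + + 4)
    lem = solve-∀

  halfArcTransitive : HalfArcTransitive Γ
  halfArcTransitive = transport-VT homogeneous≅ H.isVertexTransitive , transport-ET homogeneous≅ H.isEdgeTransitive , ¬arc

case3-HAT : ∀ {G} → Case3 G → HalfArcTransitive G
case3-HAT {G} (m , b₀ , 1<b₀ , m∣ , m%4 , b< , φ) =
  at m b₀ (m ℕ./ 4) (trans (ℕ.m≡m%n+[m/n]*n m 4) (cong (ℕ._+ m ℕ./ 4 ℕ.* 4) m%4)) 1<b₀ m∣ b< φ
  where
  at : ∀ m b₀ i → m ≡ 2 ℕ.+ i ℕ.* 4 → 1 ℕ.< b₀ → Divides m ((4 ℕ.* b₀ ℕ.∸ 1) ℕ.* (4 ℕ.* b₀ ℕ.∸ 1) ℕ.+ 3) → 4 ℕ.* b₀ ℕ.∸ 1 ℕ.< 2 ℕ.* m →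
    G ≅ Nest (2 ℕ.* m) 1 (4 ℕ.* b₀ ℕ.∸ 1) (modN (4 ℕ.* b₀ ℕ.∸ 1 ℕ.+ m ℕ.+ 1) (2 ℕ.* m)) (m ℕ.∸ 1) → HalfArcTransitive G
  at m 1             i refl (ℕ.s≤s ()) _ _ _
  at m (suc (suc c)) i refl _ m∣ b< φ = transport-VT (≅-sym ψ) vt , transport-ET (≅-sym ψ) et , λ arc → ¬arc (transport-AT ψ arc)
    where
    b≡ : 4 ℕ.* suc (suc c) ℕ.∸ 1 ≡ 7 ℕ.+ c ℕ.* 4
    b≡ = cong (ℕ._∸ 1) (lem c)
      where
      lem : ∀ c → 4 ℕ.* suc (suc c) ≡ 8 ℕ.+ c ℕ.* 4
      lem = ℕR.solve-∀
    module K = Cover i c (4 ℕ.* suc (suc c) ℕ.∸ 1) b≡ m∣ b<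
    ψ = ≅-trans φ K.nest≅
    vt = proj₁ K.halfArcTransitive
    et = proj₁ (proj₂ K.halfArcTransitive)
    ¬arc = proj₂ (proj₂ K.halfArcTransitive)

cases⇒edgeTransitive : ∀ {G} → Cases G → EdgeTransitive G
cases⇒edgeTransitive {G} (inj₁ c)        = AT⇒ET {G} (case1-AT c)
cases⇒edgeTransitive {G} (inj₂ (inj₁ c)) = AT⇒ET {G} (case2-AT c)
cases⇒edgeTransitive     (inj₂ (inj₂ c)) = proj₁ (proj₂ (case3-HAT c))

theorem3p5 : (n a b c k : ℕ) → ValidNest n a b c k → HasGirth3 (Nest n a b c k) →
      (EdgeTransitive (Nest n a b c k)
         ⇔ (Case1 (Nest n a b c k) ⊎ Case2 (Nest n a b c k) ⊎ Case3 (Nest n a b c k)))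
    × (Case3 (Nest n a b c k) → HalfArcTransitive (Nest n a b c k))
    × (EdgeTransitive (Nest n a b c k) → ¬ Case3 (Nest n a b c k) → ArcTransitive (Nest n a b c k))
theorem3p5 zero      a b c k (() , _) girth
theorem3p5 (suc n₋₁) a b c k valid    girth =
    mk⇔ cases cases⇒edgeTransitive
  , case3-HAT
  , λ et ¬case3 → [ case1-AT , [ case2-AT , ⊥-elim ∘ ¬case3 ]′ ]′ (cases et)
  where
  cases : EdgeTransitive (Nest (suc n₋₁) a b c k) → Cases (Nest (suc n₋₁) a b c k)
  cases = nest-cases n₋₁ a b c k valid girth
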